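{- We have the following equality of bigraded subspaces of $\mathfrak{Lie}(B)$: \[ \mathfrak{stab}_{\mathfrak{Lie}(B)}(\tau)=\mathfrak{lq}\oplus\mathbb{Q}b_0 . \]
   Context: Let $B=\{b_0,b_1,b_2,\dots\}$, let $\mathbb{Q}\langle B\rangle$ be the free associative $\mathbb{Q}$-algebra on $B$ with coproduct $\Delta_B$ the algebra morphism with $\Delta_B(b_i)=b_i\otimes1+1\otimes b_i$, and let $\mathfrak{Lie}(B)$ be the free Lie algebra on $B$, identified with the $\Delta_B$-primitive elements. $\mathfrak{Lie}(B)$ is bigraded by weight and depth with $b_0$ of bidegree $(1,0)$ and $b_i$ of bidegree $(i,1)$ for $i\ge1$. Let $\mathbb{Q}\langle B\rangle^0$ be the span of words not ending in $b_0$ (a subalgebra, freely generated by the $b_0^mb_k$, $m\ge0,k\ge1$), and $\pi_0:\mathbb{Q}\langle B\rangle\to\mathbb{Q}\langle B\rangle^0$ the projection along $\mathbb{Q}\langle B\rangle b_0$ (it kills words ending in $b_0$ and fixes all other words). For a word $w=b_0^{m_1}b_{k_1}\cdots b_0^{m_d}b_{k_d}b_0^{m_{d+1}}$ ($d\ge1$, $k_i\ge1$, $m_i\ge0$), write $\mathbf{k}=(k_1,\dots,k_d)$ and for $\mathbf{l}=(l_1,\dots,l_d)\in\mathbb{Z}_{>0}^d$ set $w(\mathbf{l})=b_0^{m_1}b_{l_1}\cdots b_0^{m_d}b_{l_d}b_0^{m_{d+1}}$, $|\mathbf{k}|=\sum k_i$, $\binom{\mathbf{k}-1}{\mathbf{l}-1}=\prod_i\binom{k_i-1}{l_i-1}$,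 and $\mathbf{l}\le\mathbf{k}$ iff $l_i\le k_i$ for all $i$. Let $\partial_w$ be the derivation of $\mathbb{Q}\langle B\rangle$ with $\partial_w(b_0)=0$ and $\partial_w(b_i)=\sum_{\mathbf{l}\le\mathbf{k}}(-1)^{|\mathbf{k}|+|\mathbf{l}|}\binom{\mathbf{k}-1}{\mathbf{l}-1}[b_{i+|\mathbf{k}|-|\mathbf{l}|},w(\mathbf{l})]$ for $i\ge1$; if $w=b_0^m$ ($m\ge1$), $\partial_w(b_0)=0$ and $\partial_w(b_i)=[b_i,w]$. Extend $\psi\mapsto\partial_\psi$ linearly. The bracket $\{\psi_1,\psi_2\}_A=\partial_{\psi_1}(\psi_2)-\partial_{\psi_2}(\psi_1)+[\psi_1,\psi_2]$ is a Lie bracket on $\mathfrak{Lie}(B)$. For $\psi\in\mathfrak{Lie}(B)$ let $\sigma_\psi=\ell_\psi+\partial_\psi$ ($\ell_\psi$ left multiplication by $\psi$); it maps $\mathbb{Q}\langle B\rangle b_0$ into itself, so there is a unique linear endomorphism $\sigma^0_\psi$ of $\mathbb{Q}\langle B\rangle^0$ with $\pi_0\circ\sigma_\psi=\sigma^0_\psi\circ\pi_0$. Let $\tau$ be the algebra antiautomorphism of $\mathbb{Q}\langle B\rangle^0$ with $\tau(b_0^mb_k)=b_0^{k-1}b_{m+1}$ ($m\ge0,k\ge1$). Define $\mathfrak{stab}_{\mathfrak{Lie}(B)}(\tau)=\{\psi\in\mathfrak{Lie}(B)\mid\sigma^0_\psi\circ\tau=\tau\circ\sigma^0_\psi\}$.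 For a word $w$, $(\psi\mid w)$ is the coefficient of $w$ in $\psi$. Let $\mathfrak{lq}$ be the set of $\psi\in\mathbb{Q}\langle B\rangle$ with (i) $(\psi\mid b_0)=0$; (ii) $\Delta_B(\psi)=\psi\otimes1+1\otimes\psi$; (iii) $\tau(\pi_0(\psi))=\pi_0(\psi)$; (iv) $(\psi\mid b_0^mb_k)=0$ for all $m\ge0,k\ge1$ with $k+m$ even. -}

module Defs where

open import Data.Nat as ℕ using (ℕ; zero; suc; _∸_)
open import Data.Nat.DivMod using (_%_)
open import Data.Nat.Combinatorics using (_C_)
open import Data.Integer using (+_)
open import Data.Rational as ℚ using (ℚ; 0ℚ; 1ℚ; _/_)
open import Data.List using (List; []; _∷_; _++_; map; concatMap; replicate; upTo; foldr)
open import Data.List.Properties using (≡-dec)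
open import Data.Maybe using (Maybe; just; nothing)
open import Data.Product using (_×_; _,_; Σ; ∃)
open import Relation.Binary.PropositionalEquality using (_≡_)
open import Relation.Nullary using (yes; no)
open import Function.Bundles using (_⇔_)

-- Words in the alphabet B = {b₀, b₁, …}: the letter bᵢ is the number i.
Word : Set
Word = List ℕ

-- Elements of ℚ⟨B⟩ as finite formal linear combinations of words.
-- Two representations denote the same element iff all coefficients agree.
Poly : Set
Poly = List (ℚ × Word)

_≟w_ : (u v : Word) → Relation.Nullary.Dec (u ≡ v)
_≟w_ = ≡-dec ℕ._≟_

coeff : Poly → Word → ℚ
coeff [] w = 0ℚ
coeff ((c , u) ∷ p) w with u ≟w w
... | yes _ = c ℚ.+ coeff p w
... | no  _ = coeff p w

_≈_ : Poly → Poly → Set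
p ≈ q = ∀ w → coeff p w ≡ coeff q w

zeroP : Poly
zeroP = []

wordP : Word → Poly
wordP w = (1ℚ , w) ∷ []

_⊕_ : Poly → Poly → Poly
_⊕_ = _++_

scale : ℚ → Poly → Poly
scale c = map (λ { (d , w) → (c ℚ.* d , w) })

negP : Poly → Poly
negP = scale (ℚ.- 1ℚ)

_·_ : Poly → Poly → Poly
p · q = concatMap (λ { (c , u) → map (λ { (d , v) → (c ℚ.* d , u ++ v) }) q }) p

⟦_,_⟧ : Poly → Poly → Poly
⟦ p , q ⟧ = (p · q) ⊕ negP (q · p)

lin : (Word → Poly) → Poly → Poly
lin f = concatMap (λ { (c , w) → scale c (f w) })

b₀ : Poly
b₀ = wordP (0 ∷ [])

-- Coproduct Δ_B (letters primitive), with values in ℚ⟨B⟩ ⊗ ℚ⟨B⟩,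
-- represented as finite combinations of pairs of words.
Poly2 : Set
Poly2 = List (ℚ × Word × Word)

coeff2 : Poly2 → Word → Word → ℚ
coeff2 [] u v = 0ℚ
coeff2 ((c , u' , v') ∷ p) u v with u' ≟w u | v' ≟w v
... | yes _ | yes _ = c ℚ.+ coeff2 p u v
... | _     | _     = coeff2 p u v

deshuffle : Word → List (Word × Word)
deshuffle [] = ([] , []) ∷ []
deshuffle (x ∷ w) =
  concatMap (λ { (u , v) → (x ∷ u , v) ∷ (u , x ∷ v) ∷ [] }) (deshuffle w)

ΔB : Poly → Poly2
ΔB = concatMap (λ { (c , w) → map (λ { (u , v) → (c , u , v) }) (deshuffle w) })

prim2 : Poly → Poly2
prim2 p = map (λ { (c , w) → (c , w , []) }) p ++ map (λ { (c , w) → (c , [] , w) }) p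

-- 𝔏𝔦𝔢(B), identified with the Δ_B-primitive elements
IsLie : Poly → Set
IsLie ψ = ∀ u v → coeff2 (ΔB ψ) u v ≡ coeff2 (prim2 ψ) u v

der : (ℕ → Poly) → Word → Poly
der D [] = zeroP
der D (x ∷ w) = (D x · wordP w) ⊕ (wordP (x ∷ []) · der D w)

derP : (ℕ → Poly) → Poly → Poly
derP D = lin (der D)

sgn : ℕ → ℚ
sgn zero = 1ℚ
sgn (suc n) = ℚ.- sgn n

binQ : ℕ → ℕ → ℚ
binQ n k = (+ (n C k)) / 1

-- For w = b₀^{m₁} b_{k₁} ⋯ b₀^{m_d} b_{k_d} b₀^{m_{d+1}}, the list of triples
--   ( (−1)^{|k|+|l|} binom(k−1, l−1) , |k| − |l| , w(l) )   for l ≤ k.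
-- (A letter b_k with k = suc j is replaced by b_l with l = suc t, t ≤ j;
--  (−1)^{k+l} = (−1)^{j−t}.)
subs : Word → List (ℚ × ℕ × Word)
subs [] = (1ℚ , 0 , []) ∷ []
subs (zero ∷ w) = map (λ { (c , δ , u) → (c , δ , zero ∷ u) }) (subs w)
subs (suc j ∷ w) =
  concatMap (λ t → map (λ { (c , δ , u) →
      (sgn (j ∸ t) ℚ.* binQ j t ℚ.* c , (j ∸ t) ℕ.+ δ , suc t ∷ u) }) (subs w))
    (upTo (suc j))

-- ∂_w(bᵢ) for i ≥ 1 and a word w.  For w = b₀^m (d = 0) the list subs w is
-- the single triple (1, 0, w), giving ∂_w(bᵢ) = [bᵢ, w] as in the paper.
-- (For the empty word this gives [bᵢ,1] = 0; elements of 𝔏𝔦𝔢(B) have no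
-- constant term, so this case never matters.)
∂wletter : Word → ℕ → Poly
∂wletter w zero = zeroP
∂wletter w (suc i) =
  concatMap (λ { (c , δ , u) → scale c ⟦ wordP (suc i ℕ.+ δ ∷ []) , wordP u ⟧ }) (subs w)

∂ : Poly → Poly → Poly
∂ ψ = derP (λ i → lin (λ w → ∂wletter w i) ψ)

σ : Poly → Poly → Poly
σ ψ x = (ψ · x) ⊕ ∂ ψ x

π₀w : Word → Poly
π₀w [] = wordP []
π₀w (x ∷ []) with x
... | zero  = zeroP
... | suc _ = wordP (x ∷ [])
π₀w (x ∷ y ∷ w) = map (λ { (c , u) → (c , x ∷ u) }) (π₀w (y ∷ w))

π₀ : Poly → Poly
π₀ = lin π₀w

In⁰ : Poly → Set
In⁰ p = π₀ p ≈ p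

-- σ⁰_ψ on ℚ⟨B⟩⁰: the unique map with π₀ ∘ σ_ψ = σ⁰_ψ ∘ π₀ is given on
-- x ∈ ℚ⟨B⟩⁰ (where π₀ x = x) by σ⁰_ψ(x) = π₀(σ_ψ(x)).
σ⁰ : Poly → Poly → Poly
σ⁰ ψ x = π₀ (σ ψ x)

-- τ : antiautomorphism of ℚ⟨B⟩⁰ with τ(b₀^m b_k) = b₀^{k−1} b_{m+1}.
-- τw m acc w : m = number of pending b₀'s, acc = image of the blocks
-- already read (later blocks are put in front).  Words ending in b₀
-- (not in ℚ⟨B⟩⁰) give nothing.
τw : ℕ → Word → Word → Maybe Word
τw zero acc [] = just acc
τw (suc _) acc [] = nothing
τw m acc (zero ∷ w) = τw (suc m) acc w
τw m acc (suc j ∷ w) = τw zero (replicate j 0 ++ (suc m ∷ acc)) w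

τword : Word → Poly
τword w with τw 0 [] w
... | just u  = wordP u
... | nothing = zeroP

τ : Poly → Poly
τ = lin τword

InStab : Poly → Set
InStab ψ = IsLie ψ × (∀ x → In⁰ x → σ⁰ ψ (τ x) ≈ τ (σ⁰ ψ x))

InLq : Poly → Set
InLq ψ =
  (coeff ψ (0 ∷ []) ≡ 0ℚ)
  × (∀ u v → coeff2 (ΔB ψ) u v ≡ coeff2 (prim2 ψ) u v)
  × (τ (π₀ ψ) ≈ π₀ ψ)
  × (∀ m k → 1 ℕ.≤ k → (k ℕ.+ m) % 2 ≡ 0 → coeff ψ (replicate m 0 ++ (k ∷ [])) ≡ 0ℚ)

InLqPlusQb₀ : Poly → Set
InLqPlusQb₀ ψ = Σ Poly (λ φ → Σ ℚ (λ c → InLq φ × ψ ≈ (φ ⊕ scale c b₀)))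

{-# OPTIONS --safe #-}
module Submission where

open import Defs
open import Data.Empty using (⊥-elim)
import Data.Integer as ℤ
import Data.Integer.Properties as ℤ
open import Data.List using (List; []; _∷_; _++_; _∷ʳ_; map; concatMap; length; replicate; reverse; applyUpTo)
open import Data.List.Properties
  using (++-assoc; ++-identityʳ; map-++; reverse-++; unfold-reverse; length-map; length-++)
open import Data.Maybe using (Maybe; just; nothing)
open import Data.Nat as ℕ using (ℕ; zero; suc; _∸_)
open import Data.Nat.Combinatorics using (_C_; nCn≡1; nCk≡nC[n∸k]; k>n⇒nCk≡0; nCk+nC[k+1]≡[n+1]C[k+1])
open import Data.Nat.DivMod using (_%_)
import Data.Nat.Properties as ℕ
open import Data.Product using (_×_; _,_; proj₁; proj₂; ∃; ∃₂; swap)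
open import Data.Product.Properties using () renaming (≡-dec to ×-≡-dec)
open import Data.Rational as ℚ using (ℚ; 0ℚ; 1ℚ; ½; _+_; _*_; -_; _-_; 1/_; _<_)
open import Data.Rational.Properties hiding (_≟_)
open import Data.Rational.Solver using (module +-*-Solver)
import Data.Rational.Unnormalised as ℚᵘ
import Data.Rational.Unnormalised.Properties as ℚᵘ
open import Data.Sum using (_⊎_; inj₁; inj₂)
open import Data.Unit using (⊤; tt)
open import Function using (_∘_)
open import Function.Bundles using (_⇔_; mk⇔)
open import Relation.Binary.Definitions using (DecidableEquality; tri<; tri≈; tri>)
open import Relation.Binary.PropositionalEquality
open import Relation.Nullary using (¬_; yes; no)
open +-*-Solver using (solve; _:+_; _:*_; :-_; _:-_; _:=_; con)
open ≡-Reasoning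

-- A word of depth d is read as a monomial in xᵢ, yᵢ (the exponents of b₀ in the
-- gaps, the indices of the other letters), so that ψ becomes in each depth a
-- polynomial Ψ.  For primitive ψ it is invariant under translations of the x
-- (apart from the b₀-term), so only P = π₀ψ matters; τ is the reflection
-- xᵢ ↔ y_{d+1−i}; and σ_ψ inserts P to the right and, with opposite sign, to the
-- left of the letters bᵢ.  The right insertions commute with τ as soon as P is
-- τ-invariant, the left ones as soon as moreover P(z₁−z₀, …, z_d−z₀) is cyclically
-- invariant in z₀, …, z_d.  The value at 1 and at b₁ of the commutation with τ
-- gives τ-invariance and evenness in depth 1.
-- Conversely, τ and the antipode generate a rotation: P(z₁−z₀, …) is invariant under
-- the cyclic shift combined with z ↦ −z.  Hence its odd part N changes sign under the
-- shift.  This forces N = 0 when d + 1 is odd; when d ≥ 3 is odd, alternality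
-- (shuffling one letter into the others) says that the alternating sum of N over the
-- rotations of d letters vanishes, and adding two consecutive such sums gives 2N = 0.
-- So P is even, and cyclic invariance follows.

-- Values are compared rather than polynomials: ℚ is infinite, so a combination of words is
-- determined by its values at rational points. The coordinate e of the last gap is kept apart from
-- the points, because e = 0 is exactly π₀. The signed binomials of ∂_w expand (yᵢ - y)^{kᵢ-1}, with
-- y the coordinate of the letter at which ψ is inserted. So every inserted factor is P relative to
-- a base point, whose x comes from the gap to its right and whose y comes from that letter. For a
-- right insertion the two belong to opposite neighbours of the block, which τ exchanges. For a left
-- insertion both belong to the letter after the block, and τ puts that letter before it: the base
-- point must move from one end of the block to the other, which is one step of the cyclic shift.
-- Depth 1 needs a condition of its own, because there d + 1 is even and no second letter is left to
-- shuffle.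

x+x≡0⇒x≡0 : ∀ {x} → x + x ≡ 0ℚ → x ≡ 0ℚ
x+x≡0⇒x≡0 {x} p = begin
  x            ≡⟨ solve 1 (λ x → x := con ½ :* (x :+ x)) refl x ⟩
  ½ * (x + x)  ≡⟨ cong (½ *_) p ⟩
  ½ * 0ℚ       ≡⟨ *-zeroʳ ½ ⟩
  0ℚ           ∎

x-y≡0⇒x≡y : ∀ {x y} → x - y ≡ 0ℚ → x ≡ y
x-y≡0⇒x≡y {x} {y} p = begin
  x           ≡⟨ solve 2 (λ x y → x := (x :- y) :+ y) refl x y ⟩
  (x - y) + y ≡⟨ cong (_+ y) p ⟩
  0ℚ + y      ≡⟨ +-identityˡ y ⟩
  y           ∎

-- Formal linear combinations tested against functionals

pair : {K : Set} → List (ℚ × K) → (K → ℚ) → ℚ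
pair [] g = 0ℚ
pair ((c , k) ∷ p) g = c * g k + pair p g

module _ {K : Set} where

  pair-cong : ∀ (p : List (ℚ × K)) {g h} → (∀ k → g k ≡ h k) → pair p g ≡ pair p h
  pair-cong [] e = refl
  pair-cong ((c , k) ∷ p) e = cong₂ _+_ (cong (c *_) (e k)) (pair-cong p e)

  pair-++ : ∀ (p q : List (ℚ × K)) g → pair (p ++ q) g ≡ pair p g + pair q g
  pair-++ [] q g = sym (+-identityˡ _)
  pair-++ ((c , k) ∷ p) q g =
    trans (cong (c * g k +_) (pair-++ p q g)) (sym (+-assoc (c * g k) _ _))

  pair-+ : ∀ (p : List (ℚ × K)) g h → pair p (λ k → g k + h k) ≡ pair p g + pair p h
  pair-+ [] g h = refl
  pair-+ ((c , k) ∷ p) g h = trans (cong (c * (g k + h k) +_) (pair-+ p g h))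
    (solve 5 (λ c a b s t → c :* (a :+ b) :+ (s :+ t) := (c :* a :+ s) :+ (c :* b :+ t))
      refl c (g k) (h k) _ _)

  pair-*ˡ : ∀ (p : List (ℚ × K)) a g → pair p (λ k → a * g k) ≡ a * pair p g
  pair-*ˡ [] a g = sym (*-zeroʳ a)
  pair-*ˡ ((c , k) ∷ p) a g = trans (cong (c * (a * g k) +_) (pair-*ˡ p a g))
    (solve 4 (λ c a b s → c :* (a :* b) :+ a :* s := a :* (c :* b :+ s)) refl c a (g k) _)

  pair-0 : ∀ (p : List (ℚ × K)) {g} → (∀ k → g k ≡ 0ℚ) → pair p g ≡ 0ℚ
  pair-0 [] e = refl
  pair-0 ((c , k) ∷ p) e =
    cong₂ _+_ (trans (cong (c *_) (e k)) (*-zeroʳ c)) (pair-0 p e)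

  pair-neg : ∀ (p : List (ℚ × K)) g → pair p (λ k → - g k) ≡ - pair p g
  pair-neg [] g = refl
  pair-neg ((c , k) ∷ p) g = trans (cong (c * (- g k) +_) (pair-neg p g))
    (solve 3 (λ c b s → c :* (:- b) :+ (:- s) := :- (c :* b :+ s)) refl c (g k) _)

  pair-- : ∀ (p : List (ℚ × K)) g h → pair p (λ k → g k - h k) ≡ pair p g - pair p h
  pair-- p g h = trans (pair-+ p g (λ k → - h k)) (cong (pair p g +_) (pair-neg p h))

  -- Entries are neither merged nor dropped: the length stays the same, so a reweighted tail is
  -- still shorter than the list in the inductions on length below.
  reweight : {J : Set} → (K → ℚ) → (K → J) → List (ℚ × K) → List (ℚ × J)
  reweight f j [] = []
  reweight f j ((c , k) ∷ p) = (c * f k , j k) ∷ reweight f j p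

  pair-reweight : ∀ {J : Set} f (j : K → J) p g →
    pair (reweight f j p) g ≡ pair p (λ k → f k * g (j k))
  pair-reweight f j [] g = refl
  pair-reweight f j ((c , k) ∷ p) g =
    cong₂ _+_ (*-assoc c (f k) (g (j k))) (pair-reweight f j p g)

  length-reweight : ∀ {J : Set} f (j : K → J) p → length (reweight f j p) ≡ length p
  length-reweight f j [] = refl
  length-reweight f j (_ ∷ p) = cong suc (length-reweight f j p)

module Delta {K : Set} (_≟_ : DecidableEquality K) where

  δ : K → K → ℚ
  δ k k' with k' ≟ k
  ... | yes _ = 1ℚ
  ... | no  _ = 0ℚ

  δ-same : ∀ {k k'} → k' ≡ k → δ k k' ≡ 1ℚ
  δ-same {k} {k'} e with k' ≟ k
  ... | yes _ = refl
  ... | no ne = ⊥-elim (ne e)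

  δ-diff : ∀ {k k'} → ¬ (k' ≡ k) → δ k k' ≡ 0ℚ
  δ-diff {k} {k'} ne with k' ≟ k
  ... | yes e = ⊥-elim (ne e)
  ... | no _ = refl

  δ-transport : ∀ k (f : K → ℚ) k' → f k' * δ k k' ≡ f k * δ k k'
  δ-transport k f k' with k' ≟ k
  ... | yes refl = refl
  ... | no _ = trans (*-zeroʳ (f k')) (sym (*-zeroʳ (f k)))

  private
    off : K → K → ℚ
    off k k' = 1ℚ - δ k k'

    decompose : ∀ k p g → pair p g ≡ pair (reweight (off k) (λ z → z) p) g + g k * pair p (δ k)
    decompose k p g = begin
      pair p g
        ≡⟨ pair-cong p (λ k' → trans
             (solve 2 (λ d a → a := (con 1ℚ :- d) :* a :+ a :* d) refl (δ k k') (g k'))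
             (cong (off k k' * g k' +_) (δ-transport k g k'))) ⟩
      pair p (λ k' → off k k' * g k' + g k * δ k k')
        ≡⟨ pair-+ p _ _ ⟩
      pair p (λ k' → off k k' * g k') + pair p (λ k' → g k * δ k k')
        ≡⟨ cong₂ _+_ (sym (pair-reweight (off k) (λ z → z) p g)) (pair-*ˡ p (g k) (δ k)) ⟩
      pair (reweight (off k) (λ z → z) p) g + g k * pair p (δ k) ∎

    reweight-vanish : ∀ k p → (∀ k' → pair p (δ k') ≡ 0ℚ) →
      ∀ k' → pair (reweight (off k) (λ z → z) p) (δ k') ≡ 0ℚ
    reweight-vanish k p van k' = begin
      pair (reweight (off k) (λ z → z) p) (δ k')  ≡⟨ pair-reweight (off k) (λ z → z) p (δ k') ⟩
      pair p (λ j → off k j * δ k' j)             ≡⟨ pair-cong p (δ-transport k' (off k)) ⟩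
      pair p (λ j → off k k' * δ k' j)            ≡⟨ pair-*ˡ p (off k k') (δ k') ⟩
      off k k' * pair p (δ k')                    ≡⟨ cong (off k k' *_) (van k') ⟩
      off k k' * 0ℚ                               ≡⟨ *-zeroʳ (off k k') ⟩
      0ℚ                                          ∎

    drop-head : ∀ c k (p : List (ℚ × K)) g →
      pair (reweight (off k) (λ z → z) ((c , k) ∷ p)) g ≡ pair (reweight (off k) (λ z → z) p) g
    drop-head c k p g = trans
      (cong (λ t → c * (1ℚ - t) * g k + pair (reweight (off k) (λ z → z) p) g) (δ-same refl))
      (solve 3 (λ c a s → c :* (con 1ℚ :- con 1ℚ) :* a :+ s := s) refl c (g k) _)

    -- Keys may repeat, so vanishing coefficients do not make the list empty. Multiplying all
    -- weights by 1 - δ k, with k the key of the head, gives the head weight 0 and leaves a shorter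
    -- list; what was removed is g k times the coefficient of k.
    ext : ∀ n p → length p ≡ n → (∀ k → pair p (δ k) ≡ 0ℚ) → ∀ g → pair p g ≡ 0ℚ
    ext n [] _ van g = refl
    ext (suc n) q@((c , k) ∷ p) len van g = begin
      pair q g
        ≡⟨ decompose k q g ⟩
      pair (reweight (off k) (λ z → z) q) g + g k * pair q (δ k)
        ≡⟨ cong₂ _+_ (drop-head c k p g) (trans (cong (g k *_) (van k)) (*-zeroʳ (g k))) ⟩
      pair (reweight (off k) (λ z → z) p) g + 0ℚ
        ≡⟨ +-identityʳ _ ⟩
      pair (reweight (off k) (λ z → z) p) g
        ≡⟨ ext n (reweight (off k) (λ z → z) p)
             (trans (length-reweight (off k) (λ z → z) p) (cong ℕ.pred len))
             (λ k' → trans (sym (drop-head c k p (δ k'))) (reweight-vanish k q van k')) g ⟩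
      0ℚ ∎

  pair-vanish : ∀ p → (∀ k → pair p (δ k) ≡ 0ℚ) → ∀ g → pair p g ≡ 0ℚ
  pair-vanish p = ext (length p) p refl

  pair-determined : ∀ p q → (∀ k → pair p (δ k) ≡ pair q (δ k)) → ∀ g → pair p g ≡ pair q g
  pair-determined p q e g = x-y≡0⇒x≡y (trans (sym (difference g))
    (pair-vanish (p ++ reweight (λ _ → - 1ℚ) (λ z → z) q)
      (λ k → trans (difference (δ k)) (trans (cong (_- pair q (δ k)) (e k)) (+-inverseʳ (pair q (δ k))))) g))
    where
    difference : ∀ g → pair (p ++ reweight (λ _ → - 1ℚ) (λ z → z) q) g ≡ pair p g - pair q g
    difference g = trans (pair-++ p (reweight (λ _ → - 1ℚ) (λ z → z) q) g)
      (cong (pair p g +_) (trans (pair-reweight (λ _ → - 1ℚ) (λ z → z) q g) (trans (pair-*ˡ q (- 1ℚ) g)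
        (solve 1 (λ x → (:- con 1ℚ) :* x := :- x) refl (pair q g)))))

open Delta _≟w_ using (δ; δ-same; δ-diff; δ-transport)

coeff-pair : ∀ p w → coeff p w ≡ pair p (δ w)
coeff-pair [] w = refl
coeff-pair ((c , u) ∷ p) w with u ≟w w
... | yes _ = cong₂ _+_ (sym (*-identityʳ c)) (coeff-pair p w)
... | no  _ = trans (coeff-pair p w) (sym (trans (cong (_+ _) (*-zeroʳ c)) (+-identityˡ _)))

scale-pair : ∀ a p g → pair (scale a p) g ≡ a * pair p g
scale-pair a [] g = sym (*-zeroʳ a)
scale-pair a ((c , u) ∷ p) g = trans (cong (a * c * g u +_) (scale-pair a p g))
  (solve 4 (λ a c b s → a :* c :* b :+ a :* s := a :* (c :* b :+ s)) refl a c (g u) _)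

negP-pair : ∀ p g → pair (negP p) g ≡ - pair p g
negP-pair p g = trans (scale-pair (- 1ℚ) p g)
  (solve 1 (λ x → (:- con 1ℚ) :* x := :- x) refl (pair p g))

lin-pair : ∀ F p g → pair (lin F p) g ≡ pair p (λ w → pair (F w) g)
lin-pair F [] g = refl
lin-pair F ((c , w) ∷ p) g = trans (pair-++ (scale c (F w)) (lin F p) g)
  (cong₂ _+_ (scale-pair c (F w) g) (lin-pair F p g))

·-pair : ∀ p q g → pair (p · q) g ≡ pair p (λ u → pair q (λ v → g (u ++ v)))
·-pair [] q g = refl
·-pair ((c , u) ∷ p) q g = trans (pair-++ (map _ q) (p · q) g) (cong₂ _+_ (go q) (·-pair p q g))
  where
  go : ∀ q → pair (map (λ { (d , v) → (c * d , u ++ v) }) q) g ≡ c * pair q (λ v → g (u ++ v))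
  go [] = sym (*-zeroʳ c)
  go ((d , v) ∷ q) = trans (cong (c * d * g (u ++ v) +_) (go q))
    (solve 4 (λ c d b s → c :* d :* b :+ c :* s := c :* (d :* b :+ s)) refl c d (g (u ++ v)) _)

wordP-pair : ∀ w (g : Word → ℚ) → pair (wordP w) g ≡ g w
wordP-pair w g = solve 1 (λ x → con 1ℚ :* x :+ con 0ℚ := x) refl (g w)

-- `≈` compares coefficients only; this is what allows an arbitrary functional to be applied to an
-- equality in ℚ⟨B⟩.
pair-≈ : ∀ p q → p ≈ q → ∀ g → pair p g ≡ pair q g
pair-≈ p q e = Delta.pair-determined _≟w_ p q
  (λ w → trans (sym (coeff-pair p w)) (trans (e w) (coeff-pair q w)))

pair-coeff-vanish : ∀ p g → (∀ w → coeff p w * g w ≡ 0ℚ) → pair p g ≡ 0ℚ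
pair-coeff-vanish p g van = begin
  pair p g                                        ≡⟨ pair-cong p (λ w → sym (*-identityʳ (g w))) ⟩
  pair p (λ w → g w * 1ℚ)                         ≡⟨ sym (pair-reweight g (λ z → z) p (λ _ → 1ℚ)) ⟩
  pair (reweight g (λ z → z) p) (λ _ → 1ℚ)        ≡⟨ Delta.pair-vanish _≟w_ (reweight g (λ z → z) p) van' _ ⟩
  0ℚ ∎
  where
  van' : ∀ w → pair (reweight g (λ z → z) p) (δ w) ≡ 0ℚ
  van' w = begin
    pair (reweight g (λ z → z) p) (δ w) ≡⟨ pair-reweight g (λ z → z) p (δ w) ⟩
    pair p (λ k → g k * δ w k)          ≡⟨ pair-cong p (δ-transport w g) ⟩
    pair p (λ k → g w * δ w k)          ≡⟨ pair-*ˡ p (g w) (δ w) ⟩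
    g w * pair p (δ w)                  ≡⟨ cong (g w *_) (sym (coeff-pair p w)) ⟩
    g w * coeff p w                     ≡⟨ *-comm (g w) (coeff p w) ⟩
    coeff p w * g w                     ≡⟨ van w ⟩
    0ℚ                                  ∎

_≟w²_ : DecidableEquality (Word × Word)
_≟w²_ = ×-≡-dec _≟w_ _≟w_

-- `coeff2` decides the two components separately, `δ` on pairs decides them together. Passing `d`
-- with its two defining properties keeps the two case analyses apart.
coeff2-∷ : ∀ c u' v' p u v d → ((u' , v') ≡ (u , v) → d ≡ 1ℚ) → (¬ ((u' , v') ≡ (u , v)) → d ≡ 0ℚ) →
  coeff2 ((c , u' , v') ∷ p) u v ≡ c * d + coeff2 p u v
coeff2-∷ c u' v' p u v d same diff with u' ≟w u | v' ≟w v
... | yes refl | yes refl =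
  cong (_+ _) (sym (trans (cong (c *_) (same refl)) (*-identityʳ c)))
... | no ne | _ = sym (trans (cong (_+ _)
  (trans (cong (c *_) (diff (λ { refl → ne refl }))) (*-zeroʳ c))) (+-identityˡ _))
... | yes refl | no ne = sym (trans (cong (_+ _)
  (trans (cong (c *_) (diff (λ { refl → ne refl }))) (*-zeroʳ c))) (+-identityˡ _))

coeff2-pair : ∀ p u v → coeff2 p u v ≡ pair p (Delta.δ _≟w²_ (u , v))
coeff2-pair [] u v = refl
coeff2-pair ((c , u' , v') ∷ p) u v = trans
  (coeff2-∷ c u' v' p u v _ (Delta.δ-same _≟w²_) (Delta.δ-diff _≟w²_))
  (cong (c * Delta.δ _≟w²_ (u , v) (u' , v') +_) (coeff2-pair p u v))

-- Powers, and polynomials in one variable that vanish at every rational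

infixr 8 _^_
_^_ : ℚ → ℕ → ℚ
x ^ zero  = 1ℚ
x ^ suc n = x * x ^ n

1^ : ∀ n → 1ℚ ^ n ≡ 1ℚ
1^ zero = refl
1^ (suc n) = trans (*-identityˡ _) (1^ n)

^-distrib-* : ∀ a x n → (a * x) ^ n ≡ a ^ n * x ^ n
^-distrib-* a x zero = refl
^-distrib-* a x (suc n) = trans (cong (a * x *_) (^-distrib-* a x n))
  (solve 4 (λ a x s t → a :* x :* (s :* t) := a :* s :* (x :* t)) refl a x (a ^ n) (x ^ n))

2ℚ : ℚ
2ℚ = 1ℚ + 1ℚ

2^-suc : ∀ n → 2ℚ ^ suc n ≡ 2ℚ ^ n + 2ℚ ^ n
2^-suc n = solve 1 (λ x → (con 1ℚ :+ con 1ℚ) :* x := x :+ x) refl (2ℚ ^ n)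

0<2^ : ∀ n → 0ℚ < 2ℚ ^ n
2^n<2^1+n : ∀ n → 2ℚ ^ n < 2ℚ ^ suc n
0<2^ zero = positive⁻¹ 1ℚ
0<2^ (suc n) = <-trans (0<2^ n) (2^n<2^1+n n)
2^n<2^1+n n = subst₂ _<_ (+-identityʳ (2ℚ ^ n)) (sym (2^-suc n)) (+-monoʳ-< (2ℚ ^ n) (0<2^ n))

2^-mono-< : ∀ {i j} → i ℕ.<′ j → 2ℚ ^ i < 2ℚ ^ j
2^-mono-< {i} (ℕ.≤′-reflexive refl) = 2^n<2^1+n i
2^-mono-< (ℕ.≤′-step {n} i<n) = <-trans (2^-mono-< i<n) (2^n<2^1+n n)

2^-injective : ∀ {i j} → 2ℚ ^ i ≡ 2ℚ ^ j → i ≡ j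
2^-injective {i} {j} e with ℕ.<-cmp i j
... | tri< i<j _ _ = ⊥-elim (<-irrefl e (2^-mono-< (ℕ.≤⇒≤′ i<j)))
... | tri≈ _ i≡j _ = i≡j
... | tri> _ _ j<i = ⊥-elim (<-irrefl (sym e) (2^-mono-< (ℕ.≤⇒≤′ j<i)))

module ℕδ = Delta ℕ._≟_

-- The powers of 2 separate exponents. Taking r = 0 at i = j and the inverse of the gap elsewhere
-- makes one formula cover both cases.
2^-gap-inverse : ∀ j i → ∃ λ r → (2ℚ ^ i - 2ℚ ^ j) * r ≡ 1ℚ - ℕδ.δ j i
2^-gap-inverse j i with i ℕ.≟ j
... | yes refl = 0ℚ , *-zeroʳ (2ℚ ^ i - 2ℚ ^ i)
... | no i≢j = 1/_ d {{nz}} , *-inverseʳ d {{nz}}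
  where
  d = 2ℚ ^ i - 2ℚ ^ j
  nz : ℚ.NonZero d
  nz = ℚ.≢-nonZero (λ d≡0 → i≢j (2^-injective (x-y≡0⇒x≡y d≡0)))

module _ where
  private
    gap : ℕ → ℕ → ℚ
    gap j i = 2ℚ ^ i - 2ℚ ^ j

    drop-head : ∀ c j q (g : ℕ → ℚ) → pair ((c , j) ∷ q) (λ i → gap j i * g i) ≡ pair q (λ i → gap j i * g i)
    drop-head c j q g = solve 4 (λ c a b s → c :* ((a :- a) :* b) :+ s := s) refl c (2ℚ ^ j) (g j) _

    -- f(2x) − 2ʲ f(x) has no term of degree j.
    lower : ∀ q j → (∀ x → pair q (x ^_) ≡ 0ℚ) → ∀ x → pair q (λ i → gap j i * x ^ i) ≡ 0ℚ
    lower q j van x = begin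
      pair q (λ i → gap j i * x ^ i)
        ≡⟨ pair-cong q (λ i → trans
             (solve 3 (λ a b y → (a :- b) :* y := a :* y :- b :* y) refl (2ℚ ^ i) (2ℚ ^ j) (x ^ i))
             (cong (_- 2ℚ ^ j * x ^ i) (sym (^-distrib-* 2ℚ x i)))) ⟩
      pair q (λ i → (2ℚ * x) ^ i - 2ℚ ^ j * x ^ i)
        ≡⟨ pair-- q _ _ ⟩
      pair q ((2ℚ * x) ^_) - pair q (λ i → 2ℚ ^ j * x ^ i)
        ≡⟨ cong₂ _-_ (van (2ℚ * x)) (trans (pair-*ˡ q (2ℚ ^ j) (x ^_))
             (trans (cong (2ℚ ^ j *_) (van x)) (*-zeroʳ (2ℚ ^ j)))) ⟩
      0ℚ - 0ℚ
        ≡⟨ refl ⟩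
      0ℚ ∎

    -- Weighting by `gap j`, with j the exponent of the head, kills the head, so induction applies
    -- to the tail. The gaps at i ≠ j are invertible; hence `q` acts on every h as h j times its
    -- coefficient at j, and h = (1 ^_) shows that this coefficient is 0.
    univ : ∀ n q → length q ≡ n → (∀ x → pair q (x ^_) ≡ 0ℚ) → ∀ g → pair q g ≡ 0ℚ
    univ n [] _ van g = refl
    univ (suc n) q@((c , j) ∷ q') len van g =
      trans (split g) (trans (cong (g j *_) at-j) (*-zeroʳ (g j)))
      where
      gap-vanish : ∀ h → pair q (λ i → gap j i * h i) ≡ 0ℚ
      gap-vanish h = begin
        pair q (λ i → gap j i * h i)                   ≡⟨ drop-head c j q' h ⟩
        pair q' (λ i → gap j i * h i)                  ≡⟨ sym (pair-reweight (gap j) (λ z → z) q' h) ⟩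
        pair (reweight (gap j) (λ z → z) q') h
          ≡⟨ univ n (reweight (gap j) (λ z → z) q')
               (trans (length-reweight (gap j) (λ z → z) q') (cong ℕ.pred len))
               (λ x → trans (pair-reweight (gap j) (λ z → z) q' (x ^_))
                 (trans (sym (drop-head c j q' (x ^_))) (lower q j van x))) h ⟩
        0ℚ ∎
      split : ∀ h → pair q h ≡ h j * pair q (ℕδ.δ j)
      split h = begin
        pair q h
          ≡⟨ pair-cong q (λ i → let (r , e) = 2^-gap-inverse j i in begin
               h i
                 ≡⟨ solve 2 (λ d a → a := (con 1ℚ :- d) :* a :+ a :* d) refl (ℕδ.δ j i) (h i) ⟩
               (1ℚ - ℕδ.δ j i) * h i + h i * ℕδ.δ j i
                 ≡⟨ cong₂ _+_ (trans (cong (_* h i) (sym e)) (*-assoc (gap j i) r (h i)))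
                      (ℕδ.δ-transport j h i) ⟩
               gap j i * (r * h i) + h j * ℕδ.δ j i ∎) ⟩
        pair q (λ i → gap j i * (proj₁ (2^-gap-inverse j i) * h i) + h j * ℕδ.δ j i)
          ≡⟨ pair-+ q _ _ ⟩
        _ ≡⟨ cong₂ _+_ (gap-vanish (λ i → proj₁ (2^-gap-inverse j i) * h i)) (pair-*ˡ q (h j) (ℕδ.δ j)) ⟩
        0ℚ + h j * pair q (ℕδ.δ j)
          ≡⟨ +-identityˡ _ ⟩
        h j * pair q (ℕδ.δ j) ∎
      at-j : pair q (ℕδ.δ j) ≡ 0ℚ
      at-j = begin
        pair q (ℕδ.δ j)            ≡⟨ sym (*-identityˡ _) ⟩
        1ℚ * pair q (ℕδ.δ j)       ≡⟨ cong (_* pair q (ℕδ.δ j)) (sym (1^ j)) ⟩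
        1ℚ ^ j * pair q (ℕδ.δ j)   ≡⟨ sym (split (1ℚ ^_)) ⟩
        pair q (1ℚ ^_)             ≡⟨ van 1ℚ ⟩
        0ℚ                         ∎

  vanishing-polynomial : ∀ q → (∀ x → pair q (x ^_) ≡ 0ℚ) → ∀ g → pair q g ≡ 0ℚ
  vanishing-polynomial q = univ (length q) q refl

-- Words as polynomial functions; values determine coefficients

replicate-shift : ∀ k (w : Word) → replicate k 0 ++ 0 ∷ w ≡ 0 ∷ replicate k 0 ++ w
replicate-shift zero w = refl
replicate-shift (suc k) w = cong (0 ∷_) (replicate-shift k w)

Points : Set
Points = List (ℚ × ℚ)

hd : ℚ → Points → ℚ
hd e [] = e
hd e ((x , _) ∷ _) = x

-- b₀^{m₁} b_{k₁} ⋯ b₀^{m_d} b_{k_d} b₀^{m_{d+1}} is read as the monomial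
-- ∏ xᵢ^{mᵢ} yᵢ^{kᵢ−1} · e^{m_{d+1}}, evaluated at a list of d points (xᵢ , yᵢ);
-- its value at a list of any other length is 0.
ev : ℚ → Word → Points → ℚ
ev e [] [] = 1ℚ
ev e [] (_ ∷ _) = 0ℚ
ev e (zero ∷ w) L = hd e L * ev e w L
ev e (suc j ∷ w) [] = 0ℚ
ev e (suc j ∷ w) ((x , y) ∷ L) = y ^ j * ev e w L

evP : ℚ → Poly → Points → ℚ
evP e p L = pair p (λ w → ev e w L)

module _ where
  private
    lead : Word → ℕ
    lead (zero ∷ w) = suc (lead w)
    lead _ = 0

    rest : Word → Word
    rest (zero ∷ w) = rest w
    rest w = w

    -- The value left after the leading power is split off. The clause for a leading b₀ is a
    -- default: `rest` never produces such a word.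
    ev⁺ : ℚ → Word → Points → ℚ
    ev⁺ e [] [] = 1ℚ
    ev⁺ e [] (_ ∷ _) = 0ℚ
    ev⁺ e (zero ∷ w) L = 0ℚ
    ev⁺ e (suc j ∷ w) [] = 0ℚ
    ev⁺ e (suc j ∷ w) ((x , y) ∷ L) = y ^ j * ev e w L

    ev-lead : ∀ e w L → ev e w L ≡ hd e L ^ lead w * ev⁺ e (rest w) L
    ev-lead e [] [] = refl
    ev-lead e [] (_ ∷ _) = refl
    ev-lead e (zero ∷ w) L = trans (cong (hd e L *_) (ev-lead e w L)) (sym (*-assoc (hd e L) _ _))
    ev-lead e (suc j ∷ w) [] = refl
    ev-lead e (suc j ∷ w) ((x , y) ∷ L) = sym (*-identityˡ _)

    -- The coordinate `hd e L` enters `ev` only through the leading power, so it can be varied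
    -- freely while the other factor stays fixed.
    ev⁺-at : ∀ e L x → ∃₂ λ e' L' → hd e' L' ≡ x × (∀ w → ev⁺ e' w L' ≡ ev⁺ e w L)
    ev⁺-at e [] x = x , [] , refl , λ { [] → refl ; (zero ∷ w) → refl ; (suc j ∷ w) → refl }
    ev⁺-at e ((_ , y) ∷ L) x =
      e , (x , y) ∷ L , refl , λ { [] → refl ; (zero ∷ w) → refl ; (suc j ∷ w) → refl }

    Vanishes : Poly → Set
    Vanishes p = ∀ e L → evP e p L ≡ 0ℚ

    -- As a function of the first x-coordinate the value is a polynomial with exponents `lead w`. It
    -- vanishes identically, so the power may be replaced by any function of the exponent, in
    -- particular by a delta.
    split-lead : ∀ p → Vanishes p → ∀ g e L →
      pair p (λ w → ev⁺ e (rest w) L * g (lead w)) ≡ 0ℚ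
    split-lead p van g e L = trans (sym (pair-reweight (λ w → ev⁺ e (rest w) L) lead p g))
      (vanishing-polynomial (reweight (λ w → ev⁺ e (rest w) L) lead p) (λ x →
        let (e' , L' , h , same) = ev⁺-at e L x in begin
        pair (reweight (λ w → ev⁺ e (rest w) L) lead p) (x ^_)
          ≡⟨ pair-reweight (λ w → ev⁺ e (rest w) L) lead p (x ^_) ⟩
        pair p (λ w → ev⁺ e (rest w) L * x ^ lead w)
          ≡⟨ pair-cong p (λ w → trans (*-comm _ (x ^ lead w))
               (trans (cong₂ (λ a b → a ^ lead w * b) (sym h) (sym (same (rest w)))) (sym (ev-lead e' w L')))) ⟩
        evP e' p L'
          ≡⟨ van e' L' ⟩
        0ℚ ∎) g)

    index : Word → ℕ
    index (suc j ∷ _) = j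
    index _ = 0

    tail : Word → Word
    tail (_ ∷ w) = w
    tail [] = []

    starts⁺ : Word → ℚ
    starts⁺ (suc _ ∷ _) = 1ℚ
    starts⁺ _ = 0ℚ

    ev⁺-index : ∀ e w x y L → ev⁺ e w ((x , y) ∷ L) ≡ starts⁺ w * ev e (tail w) L * y ^ index w
    ev⁺-index e [] x y L = sym (trans (cong (_* 1ℚ) (*-zeroˡ (ev e [] L))) refl)
    ev⁺-index e (zero ∷ w) x y L = sym (trans (cong (_* 1ℚ) (*-zeroˡ (ev e w L))) refl)
    ev⁺-index e (suc j ∷ w) x y L =
      solve 2 (λ a b → a :* b := con 1ℚ :* b :* a) refl (y ^ j) (ev e w L)

    split-index : ∀ p → Vanishes p → ∀ g h e L →
      pair p (λ w → g (lead w) * (starts⁺ (rest w) * ev e (tail (rest w)) L) * h (index (rest w))) ≡ 0ℚ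
    split-index p van g h e L = trans (sym (pair-reweight f ix p h))
      (vanishing-polynomial (reweight f ix p) (λ y → begin
        pair (reweight f ix p) (y ^_)
          ≡⟨ pair-reweight f ix p (y ^_) ⟩
        pair p (λ w → f w * y ^ ix w)
          ≡⟨ pair-cong p (λ w → trans (*-assoc (g (lead w)) _ _)
               (trans (cong (g (lead w) *_) (sym (ev⁺-index e (rest w) 0ℚ y L)))
                 (*-comm (g (lead w)) _))) ⟩
        pair p (λ w → ev⁺ e (rest w) ((0ℚ , y) ∷ L) * g (lead w))
          ≡⟨ split-lead p van g e ((0ℚ , y) ∷ L) ⟩
        0ℚ ∎) h)
      where
      f : Word → ℚ
      f w = g (lead w) * (starts⁺ (rest w) * ev e (tail (rest w)) L)
      ix : Word → ℕ
      ix w = index (rest w)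

    lead-rest : ∀ w → w ≡ replicate (lead w) 0 ++ rest w
    lead-rest [] = refl
    lead-rest (zero ∷ w) = cong (0 ∷_) (lead-rest w)
    lead-rest (suc j ∷ w) = refl

    rest-nonzero : ∀ w w' → ¬ (rest w ≡ zero ∷ w')
    rest-nonzero [] w' ()
    rest-nonzero (zero ∷ w) w' e = rest-nonzero w w' e
    rest-nonzero (suc j ∷ w) w' ()

    lead-replicate : ∀ k j w → lead (replicate k 0 ++ suc j ∷ w) ≡ k
    lead-replicate zero j w = refl
    lead-replicate (suc k) j w = cong suc (lead-replicate k j w)

    rest-replicate : ∀ k j w → rest (replicate k 0 ++ suc j ∷ w) ≡ suc j ∷ w
    rest-replicate zero j w = refl
    rest-replicate (suc k) j w = rest-replicate k j w

    lead-zeros : ∀ k → lead (replicate k 0 ++ []) ≡ k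
    lead-zeros zero = refl
    lead-zeros (suc k) = cong suc (lead-zeros k)

    rest-zeros : ∀ k → rest (replicate k 0 ++ []) ≡ []
    rest-zeros zero = refl
    rest-zeros (suc k) = rest-zeros k

    -- The delta factors through the first block and the tail, so the block can be stripped by
    -- reweighting. `index` and `tail` take default values when no letter of positive index follows
    -- the leading b₀; the factor `starts⁺` removes those words.
    δ-block : ∀ k j w' w → δ (replicate k 0 ++ suc j ∷ w') w ≡
      ℕδ.δ k (lead w) * starts⁺ (rest w) * ℕδ.δ j (index (rest w)) * δ w' (tail (rest w))
    δ-block k j w' w with w ≟w (replicate k 0 ++ suc j ∷ w')
    ... | yes refl rewrite lead-replicate k j w' | rest-replicate k j w'
          | ℕδ.δ-same {k} refl | ℕδ.δ-same {j} refl | δ-same {w'} refl = refl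
    ... | no ne with rest w in er
    ...   | [] = sym (trans (cong (λ a → a * ℕδ.δ j 0 * δ w' []) (*-zeroʳ (ℕδ.δ k (lead w))))
              (trans (cong (_* δ w' []) (*-zeroˡ (ℕδ.δ j 0))) (*-zeroˡ (δ w' []))))
    ...   | zero ∷ u = ⊥-elim (rest-nonzero w u er)
    ...   | suc i ∷ u with lead w ℕ.≟ k
    ...     | no _ = sym (solve 2 (λ a b → con 0ℚ :* con 1ℚ :* a :* b := con 0ℚ) refl (ℕδ.δ j i) (δ w' u))
    ...     | yes ek with i ℕ.≟ j
    ...       | no _ = sym (solve 1 (λ b → con 1ℚ :* con 1ℚ :* con 0ℚ :* b := con 0ℚ) refl (δ w' u))
    ...       | yes ej with u ≟w w'
    ...         | no _ = refl
    ...         | yes eu = ⊥-elim (ne (trans (lead-rest w) (cong₂ _++_ (cong (λ k → replicate k 0) ek)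
                    (trans er (cong₂ _∷_ (cong suc ej) eu)))))

    δ-zeros : ∀ k w → δ (replicate k 0 ++ []) w ≡ ev⁺ 0ℚ (rest w) [] * ℕδ.δ k (lead w)
    δ-zeros k w with w ≟w (replicate k 0 ++ [])
    ... | yes refl rewrite lead-zeros k | rest-zeros k | ℕδ.δ-same {k} refl = refl
    ... | no ne with rest w in er
    ...   | zero ∷ u = ⊥-elim (rest-nonzero w u er)
    ...   | suc i ∷ u = sym (*-zeroˡ (ℕδ.δ k (lead w)))
    ...   | [] with lead w ℕ.≟ k
    ...     | no _ = refl
    ...     | yes refl = ⊥-elim (ne (trans (lead-rest w) (cong (replicate (lead w) 0 ++_) er)))

    -- k counts the letters b₀ already passed. At the end of a block the weights isolate that block
    -- and the list is pushed forward to the tails; by `split-index` the tails again vanish at all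
    -- points, so the induction continues.
    ident : ∀ w k p → Vanishes p → pair p (δ (replicate k 0 ++ w)) ≡ 0ℚ
    ident [] k p van = trans (pair-cong p (δ-zeros k)) (split-lead p van (ℕδ.δ k) 0ℚ [])
    ident (zero ∷ w) k p van =
      trans (cong (λ u → pair p (δ u)) (replicate-shift k w)) (ident w (suc k) p van)
    ident (suc j ∷ w) k p van = begin
      pair p (δ (replicate k 0 ++ suc j ∷ w))  ≡⟨ pair-cong p (δ-block k j w) ⟩
      pair p (λ u → f u * δ w (tl u))          ≡⟨ sym (pair-reweight f tl p (δ w)) ⟩
      pair (reweight f tl p) (δ w)             ≡⟨ ident w 0 (reweight f tl p) van' ⟩
      0ℚ                                       ∎
      where
      f : Word → ℚ
      f u = ℕδ.δ k (lead u) * starts⁺ (rest u) * ℕδ.δ j (index (rest u))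
      tl : Word → Word
      tl u = tail (rest u)
      van' : Vanishes (reweight f tl p)
      van' e L = begin
        evP e (reweight f tl p) L
          ≡⟨ pair-reweight f tl p (λ u → ev e u L) ⟩
        pair p (λ u → f u * ev e (tl u) L)
          ≡⟨ pair-cong p (λ u → solve 4 (λ a b c d → a :* b :* c :* d := a :* (b :* d) :* c) refl
               (ℕδ.δ k (lead u)) (starts⁺ (rest u)) (ℕδ.δ j (index (rest u))) (ev e (tl u) L)) ⟩
        pair p (λ u → ℕδ.δ k (lead u) * (starts⁺ (rest u) * ev e (tl u) L) * ℕδ.δ j (index (rest u)))
          ≡⟨ split-index p van (ℕδ.δ k) (ℕδ.δ j) e L ⟩
        0ℚ ∎

  coeff-vanish : ∀ p → (∀ e L → evP e p L ≡ 0ℚ) → ∀ w → coeff p w ≡ 0ℚ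
  coeff-vanish p van w = trans (coeff-pair p w) (ident w 0 p van)

evP-injective : ∀ p q → (∀ e L → evP e p L ≡ evP e q L) → p ≈ q
evP-injective p q same w = x-y≡0⇒x≡y (begin
  coeff p w - coeff q w                ≡⟨ cong₂ _-_ (coeff-pair p w) (coeff-pair q w) ⟩
  pair p (δ w) - pair q (δ w)          ≡⟨ cong (pair p (δ w) +_) (sym (negP-pair q (δ w))) ⟩
  pair p (δ w) + pair (negP q) (δ w)   ≡⟨ sym (pair-++ p (negP q) (δ w)) ⟩
  pair (p ⊕ negP q) (δ w)              ≡⟨ sym (coeff-pair (p ⊕ negP q) w) ⟩
  coeff (p ⊕ negP q) w                 ≡⟨ coeff-vanish (p ⊕ negP q) van w ⟩
  0ℚ                                   ∎)
  where
  van : ∀ e L → evP e (p ⊕ negP q) L ≡ 0ℚ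
  van e L = trans (pair-++ p (negP q) (λ u → ev e u L))
    (trans (cong₂ _+_ (same e L) (negP-pair q (λ u → ev e u L))) (+-inverseʳ (evP e q L)))

-- Sums over the cuts of a list; evaluation of products, π₀ and τ

splitSum : {A : Set} → (List A → List A → ℚ) → List A → ℚ
splitSum g [] = g [] []
splitSum g (a ∷ l) = g [] (a ∷ l) + splitSum (λ s t → g (a ∷ s) t) l

-- Moves the cut one place to the right. A cut at the end has no successor, which is why the first
-- clause is 0.
advance : {A : Set} → (List A → List A → ℚ) → List A → List A → ℚ
advance g s [] = 0ℚ
advance g s (a ∷ t) = g (s ∷ʳ a) t

module _ {A : Set} where

  splitSum-cong : ∀ {g h : List A → List A → ℚ} l →
    (∀ s t → s ++ t ≡ l → g s t ≡ h s t) → splitSum g l ≡ splitSum h l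
  splitSum-cong [] e = e [] [] refl
  splitSum-cong (a ∷ l) e = cong₂ _+_ (e [] (a ∷ l) refl)
    (splitSum-cong l (λ s t st → e (a ∷ s) t (cong (a ∷_) st)))

  splitSum-*ˡ : ∀ a (g : List A → List A → ℚ) l → splitSum (λ s t → a * g s t) l ≡ a * splitSum g l
  splitSum-*ˡ a g [] = refl
  splitSum-*ˡ a g (x ∷ l) = trans (cong (a * g [] (x ∷ l) +_) (splitSum-*ˡ a (λ s t → g (x ∷ s) t) l))
    (sym (*-distribˡ-+ a _ _))

  splitSum-+ : ∀ (g h : List A → List A → ℚ) l →
    splitSum (λ s t → g s t + h s t) l ≡ splitSum g l + splitSum h l
  splitSum-+ g h [] = refl
  splitSum-+ g h (x ∷ l) =
    trans (cong (g [] (x ∷ l) + h [] (x ∷ l) +_) (splitSum-+ (λ s t → g (x ∷ s) t) (λ s t → h (x ∷ s) t) l))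
      (solve 4 (λ a b c d → a :+ b :+ (c :+ d) := (a :+ c) :+ (b :+ d)) refl (g [] (x ∷ l)) (h [] (x ∷ l)) _ _)

  splitSum-0 : ∀ {g : List A → List A → ℚ} l → (∀ s t → g s t ≡ 0ℚ) → splitSum g l ≡ 0ℚ
  splitSum-0 [] e = e [] []
  splitSum-0 (a ∷ l) e = cong₂ _+_ (e [] (a ∷ l)) (splitSum-0 l (λ s t → e (a ∷ s) t))

  pair-splitSum : ∀ {K : Set} p (g : K → List A → List A → ℚ) l →
    pair p (λ k → splitSum (g k) l) ≡ splitSum (λ s t → pair p (λ k → g k s t)) l
  pair-splitSum p g [] = refl
  pair-splitSum p g (a ∷ l) = trans (pair-+ p _ _)
    (cong (pair p (λ k → g k [] (a ∷ l)) +_) (pair-splitSum p (λ k s t → g k (a ∷ s) t) l))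

  splitSum-advance : ∀ (g : List A → List A → ℚ) l → splitSum g l ≡ g [] l + splitSum (advance g) l
  splitSum-advance g [] = sym (+-identityʳ _)
  splitSum-advance g (a ∷ l) = cong (g [] (a ∷ l) +_) (trans (splitSum-advance (λ s t → g (a ∷ s) t) l)
    (cong (g (a ∷ []) l +_) (splitSum-cong {h = λ s t → advance g (a ∷ s) t} l (λ { s [] _ → refl ; s (_ ∷ _) _ → refl }))))

  splitSum-first : ∀ {g : List A → List A → ℚ} l → (∀ a s t → g (a ∷ s) t ≡ 0ℚ) → splitSum g l ≡ g [] l
  splitSum-first [] e = refl
  splitSum-first {g} (a ∷ l) e =
    trans (cong (g [] (a ∷ l) +_) (splitSum-0 l (e a))) (+-identityʳ _)

  splitSum-last : ∀ {g : List A → List A → ℚ} l → (∀ s a t → g s (a ∷ t) ≡ 0ℚ) → splitSum g l ≡ g l []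
  splitSum-last [] e = refl
  splitSum-last (a ∷ l) e = trans (cong₂ _+_ (e [] a l) (splitSum-last l (λ s → e (a ∷ s)))) (+-identityˡ _)

splitSum-map : ∀ {A B : Set} (f : A → B) g l → splitSum g (map f l) ≡ splitSum (λ s t → g (map f s) (map f t)) l
splitSum-map f g [] = refl
splitSum-map f g (a ∷ l) = cong (g [] (f a ∷ map f l) +_) (splitSum-map f (λ s t → g (f a ∷ s) t) l)

splitSum-∷ʳ : ∀ {A : Set} (g : List A → List A → ℚ) l a →
  splitSum g (l ∷ʳ a) ≡ splitSum (λ s t → g s (t ∷ʳ a)) l + g (l ∷ʳ a) []
splitSum-∷ʳ g [] a = refl
splitSum-∷ʳ g (b ∷ l) a = trans (cong (g [] (b ∷ l ∷ʳ a) +_) (splitSum-∷ʳ (λ s t → g (b ∷ s) t) l a))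
  (sym (+-assoc (g [] (b ∷ l ∷ʳ a)) _ _))

hd-++ : ∀ e A B → hd (hd e B) A ≡ hd e (A ++ B)
hd-++ e [] B = refl
hd-++ e (_ ∷ _) B = refl

-- Only the cut after as many points as `u` has letters of positive index contributes. The trailing
-- b₀ of `u` run into the first gap of `v`, hence the end coordinate `hd e B` for `u`.
ev-++ : ∀ e u v L → ev e (u ++ v) L ≡ splitSum (λ A B → ev (hd e B) u A * ev e v B) L
ev-++ e [] v L = sym (trans (splitSum-first L (λ a s t → *-zeroˡ (ev e v t))) (*-identityˡ _))
ev-++ e (zero ∷ u) v L = begin
  hd e L * ev e (u ++ v) L
    ≡⟨ cong (hd e L *_) (ev-++ e u v L) ⟩
  hd e L * splitSum (λ A B → ev (hd e B) u A * ev e v B) L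
    ≡⟨ sym (splitSum-*ˡ (hd e L) _ L) ⟩
  splitSum (λ A B → hd e L * (ev (hd e B) u A * ev e v B)) L
    ≡⟨ splitSum-cong L (λ A B AB → trans (sym (*-assoc (hd e L) _ _))
         (cong (λ h → h * ev (hd e B) u A * ev e v B)
           (trans (cong (hd e) (sym AB)) (sym (hd-++ e A B))))) ⟩
  splitSum (λ A B → hd (hd e B) A * ev (hd e B) u A * ev e v B) L ∎
ev-++ e (suc j ∷ u) v [] = sym (*-zeroˡ (ev e v []))
ev-++ e (suc j ∷ u) v ((x , y) ∷ L) = begin
  y ^ j * ev e (u ++ v) L
    ≡⟨ cong (y ^ j *_) (ev-++ e u v L) ⟩
  y ^ j * splitSum (λ A B → ev (hd e B) u A * ev e v B) L
    ≡⟨ sym (splitSum-*ˡ (y ^ j) _ L) ⟩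
  splitSum (λ A B → y ^ j * (ev (hd e B) u A * ev e v B)) L
    ≡⟨ splitSum-cong L (λ A B _ → sym (*-assoc (y ^ j) _ _)) ⟩
  splitSum (λ A B → y ^ j * ev (hd e B) u A * ev e v B) L
    ≡⟨ sym (trans (cong (_+ _) (*-zeroˡ (ev e v ((x , y) ∷ L)))) (+-identityˡ _)) ⟩
  0ℚ * ev e v ((x , y) ∷ L) + splitSum (λ A B → y ^ j * ev (hd e B) u A * ev e v B) L ∎

ev-∷-[] : ∀ y w → ev 0ℚ (y ∷ w) [] ≡ 0ℚ
ev-∷-[] zero w = *-zeroˡ (ev 0ℚ w [])
ev-∷-[] (suc j) w = refl

cons-pair : ∀ (x : ℕ) p (g : Word → ℚ) → pair (map (λ { (c , u) → (c , x ∷ u) }) p) g ≡ pair p (λ u → g (x ∷ u))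
cons-pair x [] g = refl
cons-pair x ((c , u) ∷ p) g = cong (c * g (x ∷ u) +_) (cons-pair x p g)

-- The end coordinate occurs with exponent m_{d+1}, so setting it to 0 discards exactly the words
-- ending in b₀; on the other words it does not occur.
π₀w-ev : ∀ e w L → evP e (π₀w w) L ≡ ev 0ℚ w L
π₀w-ev e [] [] = refl
π₀w-ev e [] (_ ∷ _) = refl
π₀w-ev e (zero ∷ []) [] = refl
π₀w-ev e (zero ∷ []) ((x , y) ∷ L) = sym (*-zeroʳ x)
π₀w-ev e (suc j ∷ []) [] = refl
π₀w-ev e (suc j ∷ []) ((x , y) ∷ []) = wordP-pair (suc j ∷ []) (λ w → ev e w ((x , y) ∷ []))
π₀w-ev e (suc j ∷ []) ((x , y) ∷ z ∷ L) = wordP-pair (suc j ∷ []) (λ w → ev e w ((x , y) ∷ z ∷ L))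
π₀w-ev e (zero ∷ y ∷ w) [] = begin
  evP e (π₀w (zero ∷ y ∷ w)) []                ≡⟨ cons-pair 0 (π₀w (y ∷ w)) (λ u → ev e u []) ⟩
  pair (π₀w (y ∷ w)) (λ u → e * ev e u [])     ≡⟨ pair-*ˡ (π₀w (y ∷ w)) e (λ u → ev e u []) ⟩
  e * evP e (π₀w (y ∷ w)) []                   ≡⟨ cong (e *_) (trans (π₀w-ev e (y ∷ w) []) (ev-∷-[] y w)) ⟩
  e * 0ℚ                                       ≡⟨ *-zeroʳ e ⟩
  0ℚ                                           ≡⟨ sym (*-zeroˡ (ev 0ℚ (y ∷ w) [])) ⟩
  0ℚ * ev 0ℚ (y ∷ w) []                        ∎
π₀w-ev e (zero ∷ y ∷ w) L@((x , _) ∷ _) = begin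
  evP e (π₀w (zero ∷ y ∷ w)) L                 ≡⟨ cons-pair 0 (π₀w (y ∷ w)) (λ u → ev e u L) ⟩
  pair (π₀w (y ∷ w)) (λ u → x * ev e u L)      ≡⟨ pair-*ˡ (π₀w (y ∷ w)) x (λ u → ev e u L) ⟩
  x * evP e (π₀w (y ∷ w)) L                    ≡⟨ cong (x *_) (π₀w-ev e (y ∷ w) L) ⟩
  x * ev 0ℚ (y ∷ w) L                          ∎
π₀w-ev e (suc j ∷ y ∷ w) [] = trans (cons-pair (suc j) (π₀w (y ∷ w)) (λ u → ev e u []))
  (pair-0 (π₀w (y ∷ w)) (λ _ → refl))
π₀w-ev e (suc j ∷ y ∷ w) ((x , z) ∷ L) = begin
  evP e (π₀w (suc j ∷ y ∷ w)) ((x , z) ∷ L)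
    ≡⟨ cons-pair (suc j) (π₀w (y ∷ w)) (λ u → ev e u ((x , z) ∷ L)) ⟩
  pair (π₀w (y ∷ w)) (λ u → z ^ j * ev e u L)  ≡⟨ pair-*ˡ (π₀w (y ∷ w)) (z ^ j) (λ u → ev e u L) ⟩
  z ^ j * evP e (π₀w (y ∷ w)) L                ≡⟨ cong (z ^ j *_) (π₀w-ev e (y ∷ w) L) ⟩
  z ^ j * ev 0ℚ (y ∷ w) L                      ∎

π₀-ev : ∀ e p L → evP e (π₀ p) L ≡ evP 0ℚ p L
π₀-ev e p L = trans (lin-pair π₀w p (λ u → ev e u L)) (pair-cong p (λ w → π₀w-ev e w L))

sw : Points → Points
sw L = reverse (map swap L)

sw-∷ʳ : ∀ L z → sw (L ∷ʳ z) ≡ swap z ∷ sw L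
sw-∷ʳ L z = trans (cong reverse (map-++ swap L (z ∷ []))) (reverse-++ (map swap L) (swap z ∷ []))

sw-∷ : ∀ z L → sw (z ∷ L) ≡ sw L ∷ʳ swap z
sw-∷ z L = unfold-reverse (swap z) (map swap L)

ev-[]-∷ʳ : ∀ e L z → ev e [] (L ∷ʳ z) ≡ 0ℚ
ev-[]-∷ʳ e [] z = refl
ev-[]-∷ʳ e (_ ∷ _) z = refl

ev-zeros-∷ : ∀ e m u x y L → ev e (replicate m 0 ++ u) ((x , y) ∷ L) ≡ x ^ m * ev e u ((x , y) ∷ L)
ev-zeros-∷ e zero u x y L = sym (*-identityˡ _)
ev-zeros-∷ e (suc m) u x y L = trans (cong (x *_) (ev-zeros-∷ e m u x y L)) (sym (*-assoc x (x ^ m) _))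

ev-zeros : ∀ m L → ev 0ℚ (replicate (suc m) 0 ++ []) L ≡ 0ℚ
ev-zeros m [] = *-zeroˡ (ev 0ℚ (replicate m 0 ++ []) [])
ev-zeros m ((x , y) ∷ L) = trans (ev-zeros-∷ 0ℚ (suc m) [] x y L) (*-zeroʳ (x ^ suc m))

ev-zeros-suc-[] : ∀ e m j u → ev e (replicate m 0 ++ suc j ∷ u) [] ≡ 0ℚ
ev-zeros-suc-[] e zero j u = refl
ev-zeros-suc-[] e (suc m) j u = trans (cong (e *_) (ev-zeros-suc-[] e m j u)) (*-zeroʳ e)

maybeP : Maybe Word → Poly
maybeP (just u) = wordP u
maybeP nothing = zeroP

-- acc is the image of the blocks already read, so L splits into the points of
-- the pending word (reflected) followed by the points of acc.
τw-ev : ∀ e m acc w L → evP e (maybeP (τw m acc w)) L ≡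
  splitSum (λ A B → ev 0ℚ (replicate m 0 ++ w) (sw A) * ev e acc B) L
τw-ev e zero acc [] L = trans (wordP-pair acc (λ u → ev e u L))
  (sym (trans (splitSum-first L (λ z s t →
      trans (cong (_* ev e acc t) (trans (cong (ev 0ℚ []) (sw-∷ z s)) (ev-[]-∷ʳ 0ℚ (sw s) (swap z))))
        (*-zeroˡ (ev e acc t))))
    (*-identityˡ _)))
τw-ev e (suc m) acc [] L =
  sym (splitSum-0 L (λ A B → trans (cong (_* ev e acc B) (ev-zeros m (sw A))) (*-zeroˡ (ev e acc B))))
τw-ev e zero acc (zero ∷ w) L = τw-ev e 1 acc w L
τw-ev e (suc m) acc (zero ∷ w) L = trans (τw-ev e (suc (suc m)) acc w L)
  (splitSum-cong L (λ A B _ → cong (λ u → ev 0ℚ u (sw A) * ev e acc B) (sym (replicate-shift (suc m) w))))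
τw-ev e m acc (suc j ∷ w) L = trans (cong (λ u → evP e (maybeP u) L) (unfold m)) (begin
  evP e (maybeP (τw zero acc' w)) L
    ≡⟨ τw-ev e zero acc' w L ⟩
  splitSum (λ A B → ev 0ℚ w (sw A) * ev e acc' B) L
    ≡⟨ splitSum-cong L (λ A B _ → block A B) ⟩
  splitSum (advance g) L
    ≡⟨ sym (+-identityˡ _) ⟩
  0ℚ + splitSum (advance g) L
    ≡⟨ cong (_+ splitSum (advance g) L)
         (sym (trans (cong (_* ev e acc L) (ev-zeros-suc-[] 0ℚ m j w)) (*-zeroˡ (ev e acc L)))) ⟩
  g [] L + splitSum (advance g) L
    ≡⟨ sym (splitSum-advance g L) ⟩
  splitSum g L ∎)
  where
  acc' : Word
  acc' = replicate j 0 ++ (suc m ∷ acc)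
  unfold : ∀ m → τw m acc (suc j ∷ w) ≡ τw zero (replicate j 0 ++ (suc m ∷ acc)) w
  unfold zero = refl
  unfold (suc _) = refl
  g : Points → Points → ℚ
  g A B = ev 0ℚ (replicate m 0 ++ suc j ∷ w) (sw A) * ev e acc B
  block : ∀ A B → ev 0ℚ w (sw A) * ev e acc' B ≡ advance g A B
  block A [] = trans (cong (ev 0ℚ w (sw A) *_) (ev-zeros-suc-[] e j m acc)) (*-zeroʳ (ev 0ℚ w (sw A)))
  block A ((x , y) ∷ B) = begin
    ev 0ℚ w (sw A) * ev e acc' ((x , y) ∷ B)
      ≡⟨ cong (ev 0ℚ w (sw A) *_) (ev-zeros-∷ e j (suc m ∷ acc) x y B) ⟩
    ev 0ℚ w (sw A) * (x ^ j * (y ^ m * ev e acc B))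
      ≡⟨ solve 4 (λ a b c d → a :* (b :* (c :* d)) := c :* (b :* a) :* d) refl
           (ev 0ℚ w (sw A)) (x ^ j) (y ^ m) (ev e acc B) ⟩
    y ^ m * (x ^ j * ev 0ℚ w (sw A)) * ev e acc B
      ≡⟨ cong (_* ev e acc B) (sym (ev-zeros-∷ 0ℚ m (suc j ∷ w) y x (sw A))) ⟩
    ev 0ℚ (replicate m 0 ++ suc j ∷ w) ((y , x) ∷ sw A) * ev e acc B
      ≡⟨ cong (λ M → ev 0ℚ (replicate m 0 ++ suc j ∷ w) M * ev e acc B) (sym (sw-∷ʳ A (x , y))) ⟩
    g (A ∷ʳ (x , y)) B ∎

τword-ev : ∀ e w L → evP e (τword w) L ≡ ev 0ℚ w (sw L)
τword-ev e w L = begin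
  evP e (τword w) L                                      ≡⟨ cong (λ p → evP e p L) (same w) ⟩
  evP e (maybeP (τw 0 [] w)) L                           ≡⟨ τw-ev e 0 [] w L ⟩
  splitSum (λ A B → ev 0ℚ w (sw A) * ev e [] B) L        ≡⟨ splitSum-last L (λ s a t → *-zeroʳ (ev 0ℚ w (sw s))) ⟩
  ev 0ℚ w (sw L) * 1ℚ                                    ≡⟨ *-identityʳ _ ⟩
  ev 0ℚ w (sw L)                                         ∎
  where
  same : ∀ w → τword w ≡ maybeP (τw 0 [] w)
  same w with τw 0 [] w
  ... | just _ = refl
  ... | nothing = refl

τ-ev : ∀ e p L → evP e (τ p) L ≡ evP 0ℚ p (sw L)
τ-ev e p L = trans (lin-pair τword p (λ u → ev e u L)) (pair-cong p (λ w → τword-ev e w L))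

-- The binomial theorem and the evaluation of σ_ψ

sumTo : ℕ → (ℕ → ℚ) → ℚ
sumTo zero f = 0ℚ
sumTo (suc n) f = f 0 + sumTo n (f ∘ suc)

sumTo-cong : ∀ n {f g} → (∀ t → t ℕ.< n → f t ≡ g t) → sumTo n f ≡ sumTo n g
sumTo-cong zero e = refl
sumTo-cong (suc n) e = cong₂ _+_ (e 0 (ℕ.s≤s ℕ.z≤n)) (sumTo-cong n (λ t t<n → e (suc t) (ℕ.s≤s t<n)))

sumTo-+ : ∀ n f g → sumTo n (λ t → f t + g t) ≡ sumTo n f + sumTo n g
sumTo-+ zero f g = refl
sumTo-+ (suc n) f g = trans (cong (f 0 + g 0 +_) (sumTo-+ n (f ∘ suc) (g ∘ suc)))
  (solve 4 (λ a b c d → a :+ b :+ (c :+ d) := (a :+ c) :+ (b :+ d)) refl (f 0) (g 0) _ _)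

sumTo-*ˡ : ∀ n a f → sumTo n (λ t → a * f t) ≡ a * sumTo n f
sumTo-*ˡ zero a f = sym (*-zeroʳ a)
sumTo-*ˡ (suc n) a f = trans (cong (a * f 0 +_) (sumTo-*ˡ n a (f ∘ suc))) (sym (*-distribˡ-+ a _ _))

sumTo-suc : ∀ n f → sumTo (suc n) f ≡ sumTo n f + f n
sumTo-suc zero f = +-comm (f 0) 0ℚ
sumTo-suc (suc n) f = trans (cong (f 0 +_) (sumTo-suc n (f ∘ suc))) (sym (+-assoc (f 0) _ _))

concatMap-pair : ∀ {K : Set} (F : ℕ → List (ℚ × K)) h n g →
  pair (concatMap F (applyUpTo h n)) g ≡ sumTo n (λ t → pair (F (h t)) g)
concatMap-pair F h zero g = refl
concatMap-pair F h (suc n) g = trans (pair-++ (F (h 0)) (concatMap F (applyUpTo (h ∘ suc) n)) g)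
  (cong (pair (F (h 0)) g +_) (concatMap-pair F (h ∘ suc) n g))

-- The quotient is normalised, so the sum is compared among unnormalised rationals, where it is an
-- identity of integers.
/1-homo-+ : ∀ m n → (ℤ.+ (m ℕ.+ n)) ℚ./ 1 ≡ (ℤ.+ m) ℚ./ 1 + (ℤ.+ n) ℚ./ 1
/1-homo-+ m n = toℚᵘ-injective
  (ℚᵘ.≃-trans (toℚᵘ-fromℚᵘ (ℚᵘ.mkℚᵘ (ℤ.+ (m ℕ.+ n)) 0))
  (ℚᵘ.≃-trans (ℚᵘ.*≡* (cong₂ ℤ._*_ (sym (cong₂ ℤ._+_ (ℤ.*-identityʳ (ℤ.+ m)) (ℤ.*-identityʳ (ℤ.+ n)))) refl))
  (ℚᵘ.≃-trans (ℚᵘ.+-cong (ℚᵘ.≃-sym (toℚᵘ-fromℚᵘ (ℚᵘ.mkℚᵘ (ℤ.+ m) 0))) (ℚᵘ.≃-sym (toℚᵘ-fromℚᵘ (ℚᵘ.mkℚᵘ (ℤ.+ n) 0))))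
  (ℚᵘ.≃-sym (toℚᵘ-homo-+ ((ℤ.+ m) ℚ./ 1) ((ℤ.+ n) ℚ./ 1))))))

^-+ : ∀ x m n → x ^ (m ℕ.+ n) ≡ x ^ m * x ^ n
^-+ x zero n = sym (*-identityˡ _)
^-+ x (suc m) n = trans (cong (x *_) (^-+ x m n)) (sym (*-assoc x (x ^ m) (x ^ n)))

sgn-^ : ∀ x n → sgn n * x ^ n ≡ (- x) ^ n
sgn-^ x zero = refl
sgn-^ x (suc n) = trans
  (solve 3 (λ s x p → (:- s) :* (x :* p) := (:- x) :* (s :* p)) refl (sgn n) x (x ^ n))
  (cong (- x *_) (sgn-^ x n))

nC0≡1 : ∀ n → n C 0 ≡ 1
nC0≡1 n = trans (nCk≡nC[n∸k] {0} {n} ℕ.z≤n) (nCn≡1 n)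

suc-∸-suc : ∀ {t n} → t ℕ.< n → suc (n ∸ suc t) ≡ n ∸ t
suc-∸-suc {zero} {suc n} _ = refl
suc-∸-suc {suc t} {suc n} (ℕ.s≤s t<n) = suc-∸-suc t<n

binomial : ∀ a b n → sumTo (suc n) (λ t → binQ n t * (b ^ (n ∸ t) * a ^ t)) ≡ (a + b) ^ n
binomial a b zero = refl
binomial a b (suc n) = begin
  binQ (suc n) 0 * (b ^ suc n * 1ℚ) + sumTo (suc n) (λ t → binQ (suc n) (suc t) * (b ^ (n ∸ t) * a ^ suc t))
    ≡⟨ cong₂ _+_ (cong (_* (b ^ suc n * 1ℚ)) (trans (binQ0 (suc n)) (sym (binQ0 n))))
         (trans (sumTo-cong (suc n) (λ t _ → pascal t)) (sumTo-+ (suc n) (λ t → a * T t) T')) ⟩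
  binQ n 0 * (b ^ suc n * 1ℚ) + (sumTo (suc n) (λ t → a * T t) + sumTo (suc n) (λ t → T' t))
    ≡⟨ cong (λ s → binQ n 0 * (b ^ suc n * 1ℚ) + s) (cong₂ _+_ (sumTo-*ˡ (suc n) a T) tail-sum) ⟩
  binQ n 0 * (b ^ suc n * 1ℚ) + (a * sumTo (suc n) T + b * sumTo n (T ∘ suc))
    ≡⟨ solve 6 (λ c b p a s r → c :* (b :* p :* con 1ℚ) :+ (a :* s :+ b :* r)
                             := a :* s :+ b :* (c :* (p :* con 1ℚ) :+ r)) refl
         (binQ n 0) b (b ^ n) a (sumTo (suc n) T) (sumTo n (T ∘ suc)) ⟩
  a * sumTo (suc n) T + b * sumTo (suc n) T
    ≡⟨ sym (*-distribʳ-+ (sumTo (suc n) T) a b) ⟩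
  (a + b) * sumTo (suc n) T
    ≡⟨ cong ((a + b) *_) (binomial a b n) ⟩
  (a + b) * (a + b) ^ n ∎
  where
  T T' : ℕ → ℚ
  T t = binQ n t * (b ^ (n ∸ t) * a ^ t)
  T' t = binQ n (suc t) * (b ^ (n ∸ t) * a ^ suc t)
  binQ0 : ∀ n → binQ n 0 ≡ 1ℚ
  binQ0 n = cong (λ k → (ℤ.+ k) ℚ./ 1) (nC0≡1 n)
  pascal : ∀ t → binQ (suc n) (suc t) * (b ^ (n ∸ t) * a ^ suc t) ≡ a * T t + T' t
  pascal t = trans
    (cong (_* (b ^ (n ∸ t) * a ^ suc t))
      (trans (cong (λ k → (ℤ.+ k) ℚ./ 1) (sym (nCk+nC[k+1]≡[n+1]C[k+1] n t))) (/1-homo-+ (n C t) (n C suc t))))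
    (solve 5 (λ c c' p a q → (c :+ c') :* (p :* (a :* q)) := a :* (c :* (p :* q)) :+ c' :* (p :* (a :* q))) refl
      (binQ n t) (binQ n (suc t)) (b ^ (n ∸ t)) a (a ^ t))
  tail-sum : sumTo (suc n) T' ≡ b * sumTo n (T ∘ suc)
  tail-sum = begin
    sumTo (suc n) T'
      ≡⟨ sumTo-suc n T' ⟩
    sumTo n T' + T' n
      ≡⟨ cong₂ _+_ (sumTo-cong n (λ t t<n → trans
           (cong (λ k → binQ n (suc t) * (b ^ k * a ^ suc t)) (sym (suc-∸-suc t<n)))
           (solve 4 (λ c b p q → c :* (b :* p :* q) := b :* (c :* (p :* q))) refl
             (binQ n (suc t)) b (b ^ (n ∸ suc t)) (a ^ suc t))))
           (trans (cong (λ k → (ℤ.+ k) ℚ./ 1 * (b ^ (n ∸ n) * a ^ suc n)) (k>n⇒nCk≡0 (ℕ.n<1+n n)))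
             (*-zeroˡ (b ^ (n ∸ n) * a ^ suc n))) ⟩
    sumTo n (λ t → b * T (suc t)) + 0ℚ
      ≡⟨ +-identityʳ _ ⟩
    sumTo n (λ t → b * T (suc t))
      ≡⟨ sumTo-*ˡ n b (T ∘ suc) ⟩
    b * sumTo n (T ∘ suc) ∎

shiftY : ℚ → Points → Points
shiftY t = map (λ { (x , y) → (x , y - t) })

shiftY-zero : ∀ L → shiftY 0ℚ L ≡ L
shiftY-zero [] = refl
shiftY-zero ((x , y) ∷ L) = cong₂ _∷_ (cong (x ,_) (+-identityʳ y)) (shiftY-zero L)

hd-shiftY : ∀ e t L → hd e (shiftY t L) ≡ hd e L
hd-shiftY e t [] = refl
hd-shiftY e t (_ ∷ _) = refl

-- Letter by letter, the signed binomials weighted by powers of y expand (y' - y)^j. The weight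
-- y^(|k|-|l|) will come from the letter b_{i+|k|-|l|} in the formula for ∂_w.
subs-ev : ∀ e y w L → pair (subs w) (λ { (d , u) → y ^ d * ev e u L }) ≡ ev e w (shiftY y L)
subs-ev e y [] [] = refl
subs-ev e y [] (_ ∷ _) = refl
subs-ev e y (zero ∷ w) L = begin
  pair (map (λ { (c , d , u) → (c , d , zero ∷ u) }) (subs w)) (λ { (d , u) → y ^ d * ev e u L })
    ≡⟨ go (subs w) ⟩
  hd e L * pair (subs w) (λ { (d , u) → y ^ d * ev e u L })
    ≡⟨ cong₂ _*_ (sym (hd-shiftY e y L)) (subs-ev e y w L) ⟩
  hd e (shiftY y L) * ev e w (shiftY y L) ∎
  where
  go : ∀ l → pair (map (λ { (c , d , u) → (c , d , zero ∷ u) }) l) (λ { (d , u) → y ^ d * ev e u L })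
    ≡ hd e L * pair l (λ { (d , u) → y ^ d * ev e u L })
  go [] = sym (*-zeroʳ (hd e L))
  go ((c , d , u) ∷ l) = trans (cong (c * (y ^ d * (hd e L * ev e u L)) +_) (go l))
    (solve 5 (λ c p h v s → c :* (p :* (h :* v)) :+ h :* s := h :* (c :* (p :* v) :+ s)) refl
      c (y ^ d) (hd e L) (ev e u L) _)
subs-ev e y (suc j ∷ w) L = begin
  pair (subs (suc j ∷ w)) (λ { (d , u) → y ^ d * ev e u L })
    ≡⟨ concatMap-pair F (λ t → t) (suc j) (λ { (d , u) → y ^ d * ev e u L }) ⟩
  sumTo (suc j) (λ t → pair (F t) (λ { (d , u) → y ^ d * ev e u L }))
    ≡⟨ evaluate L ⟩
  ev e (suc j ∷ w) (shiftY y L) ∎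
  where
  F : ℕ → List (ℚ × ℕ × Word)
  F t = map (λ { (c , d , u) → (sgn (j ∸ t) * binQ j t * c , (j ∸ t) ℕ.+ d , suc t ∷ u) }) (subs w)
  go-[] : ∀ t l → pair (map (λ { (c , d , u) → (sgn (j ∸ t) * binQ j t * c , (j ∸ t) ℕ.+ d , suc t ∷ u) }) l)
      (λ { (d , u) → y ^ d * ev e u [] }) ≡ 0ℚ
  go-[] t [] = refl
  go-[] t ((c , d , u) ∷ l) = trans (cong₂ _+_
      (trans (cong (sgn (j ∸ t) * binQ j t * c *_) (*-zeroʳ (y ^ ((j ∸ t) ℕ.+ d)))) (*-zeroʳ (sgn (j ∸ t) * binQ j t * c)))
      (go-[] t l)) refl
  go-∷ : ∀ t x' y' L l →
    pair (map (λ { (c , d , u) → (sgn (j ∸ t) * binQ j t * c , (j ∸ t) ℕ.+ d , suc t ∷ u) }) l)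
      (λ { (d , u) → y ^ d * ev e u ((x' , y') ∷ L) })
    ≡ pair l (λ { (d , u) → y ^ d * ev e u L }) * (binQ j t * ((- y) ^ (j ∸ t) * y' ^ t))
  go-∷ t x' y' L [] = sym (*-zeroˡ (binQ j t * ((- y) ^ (j ∸ t) * y' ^ t)))
  go-∷ t x' y' L ((c , d , u) ∷ l) = begin
    sgn (j ∸ t) * binQ j t * c * (y ^ ((j ∸ t) ℕ.+ d) * (y' ^ t * ev e u L)) + _
      ≡⟨ cong₂ _+_ (cong (λ q → sgn (j ∸ t) * binQ j t * c * (q * (y' ^ t * ev e u L))) (^-+ y (j ∸ t) d))
           (go-∷ t x' y' L l) ⟩
    sgn (j ∸ t) * binQ j t * c * (y ^ (j ∸ t) * y ^ d * (y' ^ t * ev e u L)) + S * (binQ j t * ((- y) ^ (j ∸ t) * y' ^ t))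
      ≡⟨ cong (_+ S * (binQ j t * ((- y) ^ (j ∸ t) * y' ^ t)))
           (solve 7 (λ s b c p q r v → s :* b :* c :* (p :* q :* (r :* v)) := c :* (q :* v) :* (b :* (s :* p :* r))) refl
             (sgn (j ∸ t)) (binQ j t) c (y ^ (j ∸ t)) (y ^ d) (y' ^ t) (ev e u L)) ⟩
    c * (y ^ d * ev e u L) * (binQ j t * (sgn (j ∸ t) * y ^ (j ∸ t) * y' ^ t)) + S * (binQ j t * ((- y) ^ (j ∸ t) * y' ^ t))
      ≡⟨ cong (λ q → c * (y ^ d * ev e u L) * (binQ j t * (q * y' ^ t)) + S * (binQ j t * ((- y) ^ (j ∸ t) * y' ^ t)))
           (sgn-^ y (j ∸ t)) ⟩
    c * (y ^ d * ev e u L) * (binQ j t * ((- y) ^ (j ∸ t) * y' ^ t)) + S * (binQ j t * ((- y) ^ (j ∸ t) * y' ^ t))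
      ≡⟨ sym (*-distribʳ-+ (binQ j t * ((- y) ^ (j ∸ t) * y' ^ t)) (c * (y ^ d * ev e u L)) S) ⟩
    (c * (y ^ d * ev e u L) + S) * (binQ j t * ((- y) ^ (j ∸ t) * y' ^ t)) ∎
    where S = pair l (λ { (d , u) → y ^ d * ev e u L })
  sumTo-0 : ∀ n {f} → (∀ t → f t ≡ 0ℚ) → sumTo n f ≡ 0ℚ
  sumTo-0 zero _ = refl
  sumTo-0 (suc n) e = cong₂ _+_ (e 0) (sumTo-0 n (e ∘ suc))
  evaluate : ∀ L → sumTo (suc j) (λ t → pair (F t) (λ { (d , u) → y ^ d * ev e u L })) ≡ ev e (suc j ∷ w) (shiftY y L)
  evaluate [] = sumTo-0 (suc j) (λ t → go-[] t (subs w))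
  evaluate ((x' , y') ∷ L) = begin
    sumTo (suc j) (λ t → pair (F t) (λ { (d , u) → y ^ d * ev e u ((x' , y') ∷ L) }))
      ≡⟨ sumTo-cong (suc j) (λ t _ → go-∷ t x' y' L (subs w)) ⟩
    sumTo (suc j) (λ t → pair (subs w) (λ { (d , u) → y ^ d * ev e u L }) * (binQ j t * ((- y) ^ (j ∸ t) * y' ^ t)))
      ≡⟨ sumTo-*ˡ (suc j) (pair (subs w) (λ { (d , u) → y ^ d * ev e u L }))
           (λ t → binQ j t * ((- y) ^ (j ∸ t) * y' ^ t)) ⟩
    pair (subs w) (λ { (d , u) → y ^ d * ev e u L }) * sumTo (suc j) (λ t → binQ j t * ((- y) ^ (j ∸ t) * y' ^ t))
      ≡⟨ cong₂ _*_ (subs-ev e y w L) (binomial y' (- y) j) ⟩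
    ev e w (shiftY y L) * (y' - y) ^ j
      ≡⟨ *-comm (ev e w (shiftY y L)) ((y' - y) ^ j) ⟩
    (y' - y) ^ j * ev e w (shiftY y L) ∎

∂wletter-pair : ∀ w i g → pair (∂wletter w (suc i)) g ≡
  pair (subs w) (λ { (d , u) → g (suc (i ℕ.+ d) ∷ u) - g (u ++ suc (i ℕ.+ d) ∷ []) })
∂wletter-pair w i g = go (subs w)
  where
  go : ∀ l → pair (concatMap (λ { (c , d , u) → scale c ⟦ wordP (suc i ℕ.+ d ∷ []) , wordP u ⟧ }) l) g
    ≡ pair l (λ { (d , u) → g (suc (i ℕ.+ d) ∷ u) - g (u ++ suc (i ℕ.+ d) ∷ []) })
  go [] = refl
  go ((c , d , u) ∷ l) = trans (pair-++ (scale c ⟦ wordP (suc i ℕ.+ d ∷ []) , wordP u ⟧)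
      (concatMap (λ { (c , d , u) → scale c ⟦ wordP (suc i ℕ.+ d ∷ []) , wordP u ⟧ }) l) g)
    (cong₂ _+_ (trans (scale-pair c ⟦ wordP (suc i ℕ.+ d ∷ []) , wordP u ⟧ g) (cong (c *_)
      (solve 2 (λ a b → con 1ℚ :* con 1ℚ :* a :+ ((:- con 1ℚ) :* (con 1ℚ :* con 1ℚ) :* b :+ con 0ℚ) := a :- b) refl
        (g (suc (i ℕ.+ d) ∷ u)) (g (u ++ suc (i ℕ.+ d) ∷ []))))) (go l))

-- In the coordinates of ev the derivation ∂_ψ inserts ψ directly to the right
-- (R) and, with sign −1, to the left (L) of each letter bᵢ, i ≥ 1, the y-variables
-- of ψ being shifted by that of the letter; left multiplication is the insertion
-- R₀ at the far left, with shift 0.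
module Insertion (Ψ : ℚ → Points → ℚ) (e : ℚ) where

  R₀ : ℚ → (Points → ℚ) → Points → ℚ
  R₀ t f L = splitSum (λ A B → Ψ (hd e B) (shiftY t A) * f B) L

  R⁺ : (Points → ℚ) → Points → ℚ
  R⁺ f [] = 0ℚ
  R⁺ f (z ∷ L) = R₀ (proj₂ z) (λ M → f (z ∷ M)) L + R⁺ (λ M → f (z ∷ M)) L

  -- ψ takes the points `A` just before the letter (x, y). The gap directly before that letter now
  -- ends the inserted factor, so x is its end coordinate; once `A` is removed, the letter inherits
  -- the first gap of `A`, hence `hd x A`.
  L-term : (Points → ℚ) → Points → Points → ℚ
  L-term f A [] = 0ℚ
  L-term f A ((x , y) ∷ B) = Ψ x (shiftY y A) * f ((hd x A , y) ∷ B)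

  L⁺ : (Points → ℚ) → Points → ℚ
  L⁺ f [] = 0ℚ
  L⁺ f (z ∷ L) = splitSum (L-term f) (z ∷ L) + L⁺ (λ M → f (z ∷ M)) L

  Φ : (Points → ℚ) → Points → ℚ
  Φ f L = R₀ 0ℚ f L + R⁺ f L - L⁺ f L

  R₀-cong : ∀ t {f g} → (∀ L → f L ≡ g L) → ∀ L → R₀ t f L ≡ R₀ t g L
  R₀-cong t fg L = splitSum-cong L (λ A B _ → cong (Ψ (hd e B) (shiftY t A) *_) (fg B))

  L-term-cong : ∀ {f g} → (∀ L → f L ≡ g L) → ∀ A B → L-term f A B ≡ L-term g A B
  L-term-cong fg A [] = refl
  L-term-cong fg A ((x , y) ∷ B) = cong (Ψ x (shiftY y A) *_) (fg ((hd x A , y) ∷ B))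

  R⁺-cong : ∀ {f g} → (∀ L → f L ≡ g L) → ∀ L → R⁺ f L ≡ R⁺ g L
  R⁺-cong fg [] = refl
  R⁺-cong fg (z ∷ L) =
    cong₂ _+_ (R₀-cong (proj₂ z) (λ M → fg (z ∷ M)) L) (R⁺-cong (λ M → fg (z ∷ M)) L)

  L⁺-cong : ∀ {f g} → (∀ L → f L ≡ g L) → ∀ L → L⁺ f L ≡ L⁺ g L
  L⁺-cong fg [] = refl
  L⁺-cong fg (z ∷ L) = cong₂ _+_ (splitSum-cong (z ∷ L) (λ A B _ → L-term-cong fg A B))
    (L⁺-cong (λ M → fg (z ∷ M)) L)

  Φ-cong : ∀ {f g} → (∀ L → f L ≡ g L) → ∀ L → Φ f L ≡ Φ g L
  Φ-cong fg L = cong₂ _-_ (cong₂ _+_ (R₀-cong 0ℚ fg L) (R⁺-cong fg L)) (L⁺-cong fg L)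

  module _ {K : Set} (p : List (ℚ × K)) where

    pair-R₀ : ∀ t (g : K → Points → ℚ) L →
      pair p (λ k → R₀ t (g k) L) ≡ R₀ t (λ M → pair p (λ k → g k M)) L
    pair-R₀ t g L = trans (pair-splitSum p _ L)
      (splitSum-cong L (λ A B _ → pair-*ˡ p (Ψ (hd e B) (shiftY t A)) (λ k → g k B)))

    pair-R⁺ : ∀ (g : K → Points → ℚ) L → pair p (λ k → R⁺ (g k) L) ≡ R⁺ (λ M → pair p (λ k → g k M)) L
    pair-R⁺ g [] = pair-0 p (λ _ → refl)
    pair-R⁺ g (z ∷ L) = trans (pair-+ p _ _)
      (cong₂ _+_ (pair-R₀ (proj₂ z) (λ k M → g k (z ∷ M)) L) (pair-R⁺ (λ k M → g k (z ∷ M)) L))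

    pair-L-term : ∀ (g : K → Points → ℚ) A B →
      pair p (λ k → L-term (g k) A B) ≡ L-term (λ M → pair p (λ k → g k M)) A B
    pair-L-term g A [] = pair-0 p (λ _ → refl)
    pair-L-term g A ((x , y) ∷ B) = pair-*ˡ p (Ψ x (shiftY y A)) (λ k → g k ((hd x A , y) ∷ B))

    pair-L⁺ : ∀ (g : K → Points → ℚ) L → pair p (λ k → L⁺ (g k) L) ≡ L⁺ (λ M → pair p (λ k → g k M)) L
    pair-L⁺ g [] = pair-0 p (λ _ → refl)
    pair-L⁺ g (z ∷ L) = trans (pair-+ p _ _) (cong₂ _+_
      (trans (pair-splitSum p (λ k → L-term (g k)) (z ∷ L))
        (splitSum-cong (z ∷ L) (λ A B _ → pair-L-term g A B)))
      (pair-L⁺ (λ k M → g k (z ∷ M)) L))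

  private
    single : ℚ → List (ℚ × ⊤)
    single a = (a , tt) ∷ []

    pair-single : ∀ a c → pair (single a) (λ _ → c) ≡ a * c
    pair-single a c = +-identityʳ (a * c)

  -- Multiplication by a is pairing with a list of one entry of weight a, so homogeneity is an
  -- instance of `pair-R⁺`.
  R⁺-*ˡ : ∀ a f L → R⁺ (λ M → a * f M) L ≡ a * R⁺ f L
  R⁺-*ˡ a f L = trans (R⁺-cong (λ M → sym (pair-single a (f M))) L)
    (trans (sym (pair-R⁺ (single a) (λ _ → f) L)) (pair-single a (R⁺ f L)))

  L⁺-*ˡ : ∀ a f L → L⁺ (λ M → a * f M) L ≡ a * L⁺ f L
  L⁺-*ˡ a f L = trans (L⁺-cong (λ M → sym (pair-single a (f M))) L)
    (trans (sym (pair-L⁺ (single a) (λ _ → f) L)) (pair-single a (L⁺ f L)))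

  R⁺-0 : ∀ {f} → (∀ z M → f (z ∷ M) ≡ 0ℚ) → ∀ L → R⁺ f L ≡ 0ℚ
  R⁺-0 f0 [] = refl
  R⁺-0 f0 (z ∷ L) = cong₂ _+_
    (splitSum-0 L (λ A B → trans (cong (Ψ (hd e B) (shiftY (proj₂ z) A) *_) (f0 z B))
      (*-zeroʳ (Ψ (hd e B) (shiftY (proj₂ z) A)))))
    (R⁺-0 (λ z' M → f0 z (z' ∷ M)) L)

  L⁺-0 : ∀ {f} → (∀ z M → f (z ∷ M) ≡ 0ℚ) → ∀ L → L⁺ f L ≡ 0ℚ
  L⁺-0 f0 [] = refl
  L⁺-0 {f} f0 (z ∷ L) = cong₂ _+_ (splitSum-0 (z ∷ L) term) (L⁺-0 (λ z' M → f0 z (z' ∷ M)) L)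
    where
    term : ∀ A B → L-term f A B ≡ 0ℚ
    term A [] = refl
    term A ((x , y) ∷ B) =
      trans (cong (Ψ x (shiftY y A) *_) (f0 (hd x A , y) B)) (*-zeroʳ (Ψ x (shiftY y A)))

module _ (ψ : Poly) (e : ℚ) where
  open Insertion (λ e' L → evP e' ψ L) e

  private
    D : ℕ → Poly
    D i = lin (λ w → ∂wletter w i) ψ

    D-zero : ∀ l → lin (λ w → ∂wletter w 0) l ≡ []
    D-zero [] = refl
    D-zero ((c , w) ∷ l) = D-zero l

  -- The new letter contributes y^(i+d). The factor y^d is consumed by `subs-ev` and becomes the
  -- shift by y; the factor y^i is the value of the original letter.
  right-insertion : ∀ i v x y L →
    pair ψ (λ w → pair (subs w) (λ { (d , u) → ev e (suc (i ℕ.+ d) ∷ u ++ v) ((x , y) ∷ L) }))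
      ≡ R₀ y (λ M → y ^ i * ev e v M) L
  right-insertion i v x y L = begin
    pair ψ (λ w → pair (subs w) (λ { (d , u) → y ^ (i ℕ.+ d) * ev e (u ++ v) L }))
      ≡⟨ pair-cong ψ (λ w → trans (pair-cong (subs w) (λ { (d , u) → inner d u }))
           (pair-splitSum (subs w) _ L)) ⟩
    pair ψ (λ w → splitSum (λ A B → pair (subs w) (λ { (d , u) → (y ^ i * ev e v B) * (y ^ d * ev (hd e B) u A) })) L)
      ≡⟨ pair-splitSum ψ _ L ⟩
    splitSum (λ A B → pair ψ (λ w → pair (subs w) (λ { (d , u) → (y ^ i * ev e v B) * (y ^ d * ev (hd e B) u A) }))) L
      ≡⟨ splitSum-cong L (λ A B _ → trans
           (pair-cong ψ (λ w → trans (pair-*ˡ (subs w) (y ^ i * ev e v B) _)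
             (cong (y ^ i * ev e v B *_) (subs-ev (hd e B) y w A))))
           (trans (pair-*ˡ ψ (y ^ i * ev e v B) _) (*-comm (y ^ i * ev e v B) _))) ⟩
    splitSum (λ A B → evP (hd e B) ψ (shiftY y A) * (y ^ i * ev e v B)) L ∎
    where
    inner : ∀ d u → y ^ (i ℕ.+ d) * ev e (u ++ v) L
      ≡ splitSum (λ A B → (y ^ i * ev e v B) * (y ^ d * ev (hd e B) u A)) L
    inner d u = begin
      y ^ (i ℕ.+ d) * ev e (u ++ v) L
        ≡⟨ cong₂ _*_ (^-+ y i d) (ev-++ e u v L) ⟩
      y ^ i * y ^ d * splitSum (λ A B → ev (hd e B) u A * ev e v B) L
        ≡⟨ sym (splitSum-*ˡ (y ^ i * y ^ d) _ L) ⟩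
      splitSum (λ A B → y ^ i * y ^ d * (ev (hd e B) u A * ev e v B)) L
        ≡⟨ splitSum-cong L (λ A B _ → solve 4 (λ p q a b → p :* q :* (a :* b) := p :* b :* (q :* a)) refl
             (y ^ i) (y ^ d) (ev (hd e B) u A) (ev e v B)) ⟩
      splitSum (λ A B → (y ^ i * ev e v B) * (y ^ d * ev (hd e B) u A)) L ∎

  left-insertion : ∀ i v L →
    pair ψ (λ w → pair (subs w) (λ { (d , u) → ev e (u ++ suc (i ℕ.+ d) ∷ v) L }))
      ≡ splitSum (L-term (ev e (suc i ∷ v))) L
  left-insertion i v L = begin
    pair ψ (λ w → pair (subs w) (λ { (d , u) → ev e (u ++ suc (i ℕ.+ d) ∷ v) L }))
      ≡⟨ pair-cong ψ (λ w → trans (pair-cong (subs w) (λ { (d , u) → ev-++ e u (suc (i ℕ.+ d) ∷ v) L }))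
           (pair-splitSum (subs w) _ L)) ⟩
    pair ψ (λ w → splitSum (λ A B → pair (subs w) (λ { (d , u) → ev (hd e B) u A * ev e (suc (i ℕ.+ d) ∷ v) B })) L)
      ≡⟨ pair-splitSum ψ _ L ⟩
    splitSum (λ A B → pair ψ (λ w → pair (subs w) (λ { (d , u) → ev (hd e B) u A * ev e (suc (i ℕ.+ d) ∷ v) B }))) L
      ≡⟨ splitSum-cong L (λ A B _ → term A B) ⟩
    splitSum (L-term (ev e (suc i ∷ v))) L ∎
    where
    term : ∀ A B → pair ψ (λ w → pair (subs w) (λ { (d , u) → ev (hd e B) u A * ev e (suc (i ℕ.+ d) ∷ v) B }))
      ≡ L-term (ev e (suc i ∷ v)) A B
    term A [] = pair-0 ψ (λ w → pair-0 (subs w) (λ { (d , u) → *-zeroʳ (ev e u A) }))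
    term A ((x , y) ∷ B) = begin
      pair ψ (λ w → pair (subs w) (λ { (d , u) → ev x u A * (y ^ (i ℕ.+ d) * ev e v B) }))
        ≡⟨ pair-cong ψ (λ w → trans
             (pair-cong (subs w) (λ { (d , u) → trans
               (cong (λ q → ev x u A * (q * ev e v B)) (^-+ y i d))
               (solve 4 (λ a p q b → a :* (p :* q :* b) := p :* b :* (q :* a)) refl (ev x u A) (y ^ i) (y ^ d) (ev e v B)) }))
             (trans (pair-*ˡ (subs w) (y ^ i * ev e v B) _) (cong (y ^ i * ev e v B *_) (subs-ev x y w A)))) ⟩
      pair ψ (λ w → (y ^ i * ev e v B) * ev x w (shiftY y A))
        ≡⟨ trans (pair-*ˡ ψ (y ^ i * ev e v B) _) (*-comm (y ^ i * ev e v B) _) ⟩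
      evP x ψ (shiftY y A) * (y ^ i * ev e v B) ∎

  letter-insertion : ∀ i v L → evP e (D (suc i) · wordP v) L ≡
    pair ψ (λ w → pair (subs w) (λ { (d , u) → ev e (suc (i ℕ.+ d) ∷ u ++ v) L }))
    - splitSum (L-term (ev e (suc i ∷ v))) L
  letter-insertion i v L = begin
    evP e (D (suc i) · wordP v) L
      ≡⟨ ·-pair (D (suc i)) (wordP v) (λ u → ev e u L) ⟩
    pair (D (suc i)) (λ u → pair (wordP v) (λ v → ev e (u ++ v) L))
      ≡⟨ pair-cong (D (suc i)) (λ u → wordP-pair v (λ v → ev e (u ++ v) L)) ⟩
    pair (D (suc i)) (λ u → ev e (u ++ v) L)
      ≡⟨ lin-pair (λ w → ∂wletter w (suc i)) ψ (λ u → ev e (u ++ v) L) ⟩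
    pair ψ (λ w → pair (∂wletter w (suc i)) (λ u → ev e (u ++ v) L))
      ≡⟨ pair-cong ψ (λ w → trans (∂wletter-pair w i (λ u → ev e (u ++ v) L))
           (trans (pair-cong (subs w) (λ { (d , u) → cong (λ s → ev e (suc (i ℕ.+ d) ∷ u ++ v) L - ev e s L)
              (++-assoc u (suc (i ℕ.+ d) ∷ []) v) }))
             (pair-- (subs w) _ _))) ⟩
    pair ψ (λ w → pair (subs w) (λ { (d , u) → ev e (suc (i ℕ.+ d) ∷ u ++ v) L })
                  - pair (subs w) (λ { (d , u) → ev e (u ++ suc (i ℕ.+ d) ∷ v) L }))
      ≡⟨ pair-- ψ _ _ ⟩
    _ ≡⟨ cong (λ s → pair ψ (λ w → pair (subs w) (λ { (d , u) → ev e (suc (i ℕ.+ d) ∷ u ++ v) L })) - s)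
           (left-insertion i v L) ⟩
    pair ψ (λ w → pair (subs w) (λ { (d , u) → ev e (suc (i ℕ.+ d) ∷ u ++ v) L }))
      - splitSum (L-term (ev e (suc i ∷ v))) L ∎

  der-ev : ∀ v L → evP e (der D v) L ≡ R⁺ (ev e v) L - L⁺ (ev e v) L
  der-ev [] L = sym (cong₂ _-_ (R⁺-0 (λ _ _ → refl) L) (L⁺-0 (λ _ _ → refl) L))
  der-ev (zero ∷ v) L = begin
    evP e ((D 0 · wordP v) ⊕ (wordP (0 ∷ []) · der D v)) L
      ≡⟨ cong (λ p → evP e ((p · wordP v) ⊕ (wordP (0 ∷ []) · der D v)) L) (D-zero ψ) ⟩
    evP e (wordP (0 ∷ []) · der D v) L
      ≡⟨ trans (·-pair (wordP (0 ∷ [])) (der D v) (λ u → ev e u L))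
           (wordP-pair (0 ∷ []) (λ u → pair (der D v) (λ w → ev e (u ++ w) L))) ⟩
    pair (der D v) (λ u → hd e L * ev e u L)
      ≡⟨ pair-*ˡ (der D v) (hd e L) (λ u → ev e u L) ⟩
    hd e L * evP e (der D v) L
      ≡⟨ cong (hd e L *_) (der-ev v L) ⟩
    hd e L * (R⁺ (ev e v) L - L⁺ (ev e v) L)
      ≡⟨ pull L ⟩
    R⁺ (ev e (0 ∷ v)) L - L⁺ (ev e (0 ∷ v)) L ∎
    where
    -- No insertion changes the coordinate of the first gap: the right insertions keep the first
    -- point, and in `L-term` the surviving letter inherits `hd x A`. So the factor of a leading b₀
    -- comes out, matching ∂_ψ(b₀) = 0.
    pull : ∀ L → hd e L * (R⁺ (ev e v) L - L⁺ (ev e v) L) ≡ R⁺ (ev e (0 ∷ v)) L - L⁺ (ev e (0 ∷ v)) L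
    pull [] = *-zeroʳ e
    pull (z@(x , y) ∷ L) = sym (begin
      R₀ y (λ M → x * f M) L + R⁺ (λ M → x * f M) L - (splitSum (L-term (ev e (0 ∷ v))) (z ∷ L) + L⁺ (λ M → x * f M) L)
        ≡⟨ cong₂ _-_ (cong₂ _+_ R₀-* (R⁺-*ˡ x f L)) (cong₂ _+_ L-* (L⁺-*ˡ x f L)) ⟩
      x * R₀ y f L + x * R⁺ f L - (x * splitSum (L-term (ev e v)) (z ∷ L) + x * L⁺ f L)
        ≡⟨ solve 5 (λ x a b c d → x :* a :+ x :* b :- (x :* c :+ x :* d) := x :* (a :+ b :- (c :+ d))) refl
             x (R₀ y f L) (R⁺ f L) (splitSum (L-term (ev e v)) (z ∷ L)) (L⁺ f L) ⟩
      x * (R₀ y f L + R⁺ f L - (splitSum (L-term (ev e v)) (z ∷ L) + L⁺ f L)) ∎)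
      where
      f : Points → ℚ
      f M = ev e v (z ∷ M)
      R₀-* : R₀ y (λ M → x * f M) L ≡ x * R₀ y f L
      R₀-* = trans (splitSum-cong L (λ A B _ →
          solve 3 (λ p x q → p :* (x :* q) := x :* (p :* q)) refl (evP (hd e B) ψ (shiftY y A)) x (f B)))
        (splitSum-*ˡ x _ L)
      L-* : splitSum (L-term (ev e (0 ∷ v))) (z ∷ L) ≡ x * splitSum (L-term (ev e v)) (z ∷ L)
      L-* = trans (cong₂ _+_
          (solve 3 (λ p x q → p :* (x :* q) := x :* (p :* q)) refl (evP x ψ []) x (ev e v (z ∷ L)))
          (trans (splitSum-cong {h = λ A B → x * L-term (ev e v) (z ∷ A) B} L (λ { A [] _ → sym (*-zeroʳ x) ; A ((x' , y') ∷ B) _ →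
              solve 3 (λ p x q → p :* (x :* q) := x :* (p :* q)) refl (evP x' ψ (shiftY y' (z ∷ A))) x (ev e v ((x , y') ∷ B)) }))
            (splitSum-*ˡ x (λ A B → L-term (ev e v) (z ∷ A) B) L)))
        (sym (*-distribˡ-+ x _ _))
  der-ev (suc i ∷ v) L = begin
    evP e ((D (suc i) · wordP v) ⊕ (wordP (suc i ∷ []) · der D v)) L
      ≡⟨ pair-++ (D (suc i) · wordP v) (wordP (suc i ∷ []) · der D v) (λ u → ev e u L) ⟩
    evP e (D (suc i) · wordP v) L + evP e (wordP (suc i ∷ []) · der D v) L
      ≡⟨ cong₂ _+_ (letter-insertion i v L)
           (trans (·-pair (wordP (suc i ∷ [])) (der D v) (λ u → ev e u L))
             (wordP-pair (suc i ∷ []) (λ u → pair (der D v) (λ w → ev e (u ++ w) L)))) ⟩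
    X L - splitSum (L-term (ev e (suc i ∷ v))) L + pair (der D v) (λ u → ev e (suc i ∷ u) L)
      ≡⟨ finish L ⟩
    R⁺ (ev e (suc i ∷ v)) L - L⁺ (ev e (suc i ∷ v)) L ∎
    where
    X : Points → ℚ
    X L = pair ψ (λ w → pair (subs w) (λ { (d , u) → ev e (suc (i ℕ.+ d) ∷ u ++ v) L }))
    finish : ∀ L → X L - splitSum (L-term (ev e (suc i ∷ v))) L + pair (der D v) (λ u → ev e (suc i ∷ u) L)
      ≡ R⁺ (ev e (suc i ∷ v)) L - L⁺ (ev e (suc i ∷ v)) L
    finish [] = cong₂ _+_ (cong (_- 0ℚ) (pair-0 ψ (λ w → pair-0 (subs w) (λ _ → refl))))
      (pair-0 (der D v) (λ _ → refl))
    finish (z@(x , y) ∷ L) = begin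
      X (z ∷ L) - S + pair (der D v) (λ u → y ^ i * ev e u L)
        ≡⟨ cong₂ (λ a b → a - S + b) (right-insertion i v x y L)
             (trans (pair-*ˡ (der D v) (y ^ i) (λ u → ev e u L)) (cong (y ^ i *_) (der-ev v L))) ⟩
      R₀ y f L - S + y ^ i * (R⁺ (ev e v) L - L⁺ (ev e v) L)
        ≡⟨ solve 5 (λ r s p a b → r :- s :+ p :* (a :- b) := r :+ p :* a :- (s :+ p :* b)) refl
             (R₀ y f L) S (y ^ i) (R⁺ (ev e v) L) (L⁺ (ev e v) L) ⟩
      R₀ y f L + y ^ i * R⁺ (ev e v) L - (S + y ^ i * L⁺ (ev e v) L)
        ≡⟨ cong₂ (λ a b → R₀ y f L + a - (S + b)) (sym (R⁺-*ˡ (y ^ i) (ev e v) L)) (sym (L⁺-*ˡ (y ^ i) (ev e v) L)) ⟩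
      R₀ y f L + R⁺ f L - (S + L⁺ f L) ∎
      where
      f : Points → ℚ
      f M = y ^ i * ev e v M
      S = splitSum (L-term (ev e (suc i ∷ v))) (z ∷ L)

  σ-ev : ∀ p L → evP e (σ ψ p) L ≡ Φ (evP e p) L
  σ-ev p L = begin
    evP e ((ψ · p) ⊕ ∂ ψ p) L
      ≡⟨ pair-++ (ψ · p) (∂ ψ p) (λ u → ev e u L) ⟩
    evP e (ψ · p) L + evP e (∂ ψ p) L
      ≡⟨ cong₂ _+_ left (trans (lin-pair (der D) p (λ u → ev e u L)) (pair-cong p (λ v → der-ev v L))) ⟩
    R₀ 0ℚ (evP e p) L + pair p (λ v → R⁺ (ev e v) L - L⁺ (ev e v) L)
      ≡⟨ cong (R₀ 0ℚ (evP e p) L +_) (trans (pair-- p _ _) (cong₂ _-_ (pair-R⁺ p (λ v → ev e v) L) (pair-L⁺ p (λ v → ev e v) L))) ⟩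
    R₀ 0ℚ (evP e p) L + (R⁺ (evP e p) L - L⁺ (evP e p) L)
      ≡⟨ sym (+-assoc (R₀ 0ℚ (evP e p) L) (R⁺ (evP e p) L) (- L⁺ (evP e p) L)) ⟩
    Φ (evP e p) L ∎
    where
    left : evP e (ψ · p) L ≡ R₀ 0ℚ (evP e p) L
    left = begin
      evP e (ψ · p) L
        ≡⟨ ·-pair ψ p (λ u → ev e u L) ⟩
      pair ψ (λ w → pair p (λ v → ev e (w ++ v) L))
        ≡⟨ pair-cong ψ (λ w → trans (pair-cong p (λ v → ev-++ e w v L)) (trans (pair-splitSum p _ L)
             (splitSum-cong L (λ A B _ → trans (pair-*ˡ p (ev (hd e B) w A) (λ v → ev e v B)) (*-comm _ (evP e p B)))))) ⟩
      pair ψ (λ w → splitSum (λ A B → evP e p B * ev (hd e B) w A) L)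
        ≡⟨ pair-splitSum ψ _ L ⟩
      splitSum (λ A B → pair ψ (λ w → evP e p B * ev (hd e B) w A)) L
        ≡⟨ splitSum-cong L (λ A B _ → trans (pair-*ˡ ψ (evP e p B) (λ w → ev (hd e B) w A))
             (trans (*-comm (evP e p B) _) (cong (λ M → evP (hd e B) ψ M * evP e p B) (sym (shiftY-zero A))))) ⟩
      R₀ 0ℚ (evP e p) L ∎

-- Primitive elements: translation, alternality, antipode

dsum : Word → (Word → Word → ℚ) → ℚ
dsum [] h = h [] []
dsum (x ∷ w) h = dsum w (λ u v → h (x ∷ u) v + h u (x ∷ v))

dsum-cong : ∀ w {g h} → (∀ u v → g u v ≡ h u v) → dsum w g ≡ dsum w h
dsum-cong [] e = e [] []
dsum-cong (x ∷ w) e = dsum-cong w (λ u v → cong₂ _+_ (e (x ∷ u) v) (e u (x ∷ v)))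

dsum-0 : ∀ w {h} → (∀ u v → h u v ≡ 0ℚ) → dsum w h ≡ 0ℚ
dsum-0 [] e = e [] []
dsum-0 (x ∷ w) e = dsum-0 w (λ u v → cong₂ _+_ (e (x ∷ u) v) (e u (x ∷ v)))

dsum-*ˡ : ∀ a w h → dsum w (λ u v → a * h u v) ≡ a * dsum w h
dsum-*ˡ a [] h = refl
dsum-*ˡ a (x ∷ w) h = trans (dsum-cong w (λ u v → sym (*-distribˡ-+ a (h (x ∷ u) v) (h u (x ∷ v)))))
  (dsum-*ˡ a w (λ u v → h (x ∷ u) v + h u (x ∷ v)))

dsum-+ : ∀ w g h → dsum w (λ u v → g u v + h u v) ≡ dsum w g + dsum w h
dsum-+ [] g h = refl
dsum-+ (x ∷ w) g h = trans
  (dsum-cong w (λ u v → solve 4 (λ a b c d → a :+ b :+ (c :+ d) := (a :+ c) :+ (b :+ d)) refl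
    (g (x ∷ u) v) (h (x ∷ u) v) (g u (x ∷ v)) (h u (x ∷ v))))
  (dsum-+ w (λ u v → g (x ∷ u) v + g u (x ∷ v)) (λ u v → h (x ∷ u) v + h u (x ∷ v)))

module _ where
  private
    weigh : ℚ → List (Word × Word) → Poly2
    weigh c = map (λ { (u , v) → (c , u , v) })

    weigh-∷ : ∀ c x l (h : Word → Word → ℚ) →
      pair (weigh c (concatMap (λ { (u , v) → (x ∷ u , v) ∷ (u , x ∷ v) ∷ [] }) l)) (λ { (u , v) → h u v })
      ≡ pair (weigh c l) (λ { (u , v) → h (x ∷ u) v + h u (x ∷ v) })
    weigh-∷ c x [] h = refl
    weigh-∷ c x ((u , v) ∷ l) h = trans (cong (λ s → c * h (x ∷ u) v + (c * h u (x ∷ v) + s)) (weigh-∷ c x l h))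
      (solve 4 (λ c a b s → c :* a :+ (c :* b :+ s) := c :* (a :+ b) :+ s) refl c (h (x ∷ u) v) (h u (x ∷ v)) _)

    deshuffle-pair : ∀ c w h → pair (weigh c (deshuffle w)) (λ { (u , v) → h u v }) ≡ c * dsum w h
    deshuffle-pair c [] h = +-identityʳ (c * h [] [])
    deshuffle-pair c (x ∷ w) h = trans (weigh-∷ c x (deshuffle w) h)
      (deshuffle-pair c w (λ u v → h (x ∷ u) v + h u (x ∷ v)))

    prim-pair₁ : ∀ ψ (h : Word → Word → ℚ) →
      pair (map (λ { (c , w) → (c , w , []) }) ψ) (λ { (u , v) → h u v }) ≡ pair ψ (λ w → h w [])
    prim-pair₁ [] h = refl
    prim-pair₁ ((c , w) ∷ ψ) h = cong (c * h w [] +_) (prim-pair₁ ψ h)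

    prim-pair₂ : ∀ ψ (h : Word → Word → ℚ) →
      pair (map (λ { (c , w) → (c , [] , w) }) ψ) (λ { (u , v) → h u v }) ≡ pair ψ (λ w → h [] w)
    prim-pair₂ [] h = refl
    prim-pair₂ ((c , w) ∷ ψ) h = cong (c * h [] w +_) (prim-pair₂ ψ h)

  ΔB-pair : ∀ ψ h → pair (ΔB ψ) (λ { (u , v) → h u v }) ≡ pair ψ (λ w → dsum w h)
  ΔB-pair [] h = refl
  ΔB-pair ((c , w) ∷ ψ) h = trans (pair-++ (weigh c (deshuffle w)) (ΔB ψ) (λ { (u , v) → h u v }))
    (cong₂ _+_ (deshuffle-pair c w h) (ΔB-pair ψ h))

  prim2-pair : ∀ ψ h → pair (prim2 ψ) (λ { (u , v) → h u v }) ≡ pair ψ (λ w → h w []) + pair ψ (λ w → h [] w)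
  prim2-pair ψ h = trans
    (pair-++ (map (λ { (c , w) → (c , w , []) }) ψ) (map (λ { (c , w) → (c , [] , w) }) ψ) (λ { (u , v) → h u v }))
    (cong₂ _+_ (prim-pair₁ ψ h) (prim-pair₂ ψ h))

-- Primitivity tested on all functionals of pairs of words. Each property of primitive elements
-- below comes from one choice of `h`.
Primitive : Poly → Set
Primitive ψ = ∀ h → pair ψ (λ w → dsum w h) ≡ pair ψ (λ w → h w []) + pair ψ (λ w → h [] w)

lie⇒primitive : ∀ ψ → IsLie ψ → Primitive ψ
lie⇒primitive ψ lie h = trans (sym (ΔB-pair ψ h)) (trans
  (Delta.pair-determined _≟w²_ (ΔB ψ) (prim2 ψ)
    (λ { (u , v) → trans (sym (coeff2-pair (ΔB ψ) u v)) (trans (lie u v) (coeff2-pair (prim2 ψ) u v)) })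
    (λ { (u , v) → h u v }))
  (prim2-pair ψ h))

primitive⇒lie : ∀ ψ → Primitive ψ → IsLie ψ
primitive⇒lie ψ prim u v = trans (coeff2-pair (ΔB ψ) u v) (trans (ΔB-pair ψ d)
  (trans (prim d) (trans (sym (prim2-pair ψ d)) (sym (coeff2-pair (prim2 ψ) u v)))))
  where
  d : Word → Word → ℚ
  d u' v' = Delta.δ _≟w²_ (u , v) (u' , v')

shiftX : ℚ → Points → Points
shiftX t = map (λ { (x , y) → (t + x , y) })

hd-shiftX : ∀ t e L → hd (t + e) (shiftX t L) ≡ t + hd e L
hd-shiftX t e [] = refl
hd-shiftX t e (_ ∷ _) = refl

-- `ev t u []` is 0 unless u consists of letters b₀. So each b₀ of w either moves to u with value t
-- or stays in v with the coordinate of its gap, and the two choices add up.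
dsum-translation : ∀ w t e L → dsum w (λ u v → ev t u [] * ev e v L) ≡ ev (t + e) w (shiftX t L)
dsum-translation [] t e [] = refl
dsum-translation [] t e (_ ∷ _) = refl
dsum-translation (zero ∷ w) t e L = begin
  dsum w (λ u v → t * ev t u [] * ev e v L + ev t u [] * (hd e L * ev e v L))
    ≡⟨ dsum-cong w (λ u v → solve 4 (λ t a h b → t :* a :* b :+ a :* (h :* b) := (t :+ h) :* (a :* b)) refl
         t (ev t u []) (hd e L) (ev e v L)) ⟩
  dsum w (λ u v → (t + hd e L) * (ev t u [] * ev e v L))
    ≡⟨ dsum-*ˡ (t + hd e L) w _ ⟩
  (t + hd e L) * dsum w (λ u v → ev t u [] * ev e v L)
    ≡⟨ cong₂ _*_ (sym (hd-shiftX t e L)) (dsum-translation w t e L) ⟩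
  hd (t + e) (shiftX t L) * ev (t + e) w (shiftX t L) ∎
dsum-translation (suc j ∷ w) t e [] = dsum-0 w (λ u v →
  cong₂ _+_ (*-zeroˡ (ev e v [])) (*-zeroʳ (ev t u [])))
dsum-translation (suc j ∷ w) t e ((x , y) ∷ L) = begin
  dsum w (λ u v → 0ℚ * ev e v ((x , y) ∷ L) + ev t u [] * (y ^ j * ev e v L))
    ≡⟨ dsum-cong w (λ u v → solve 4 (λ c a p b → con 0ℚ :* c :+ a :* (p :* b) := p :* (a :* b)) refl
         (ev e v ((x , y) ∷ L)) (ev t u []) (y ^ j) (ev e v L)) ⟩
  dsum w (λ u v → y ^ j * (ev t u [] * ev e v L))
    ≡⟨ dsum-*ˡ (y ^ j) w _ ⟩
  y ^ j * dsum w (λ u v → ev t u [] * ev e v L)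
    ≡⟨ cong (y ^ j *_) (dsum-translation w t e L) ⟩
  y ^ j * ev (t + e) w (shiftX t L) ∎

-- xs e recovers the xᵢ from the differences uᵢ = xᵢ − xᵢ₊₁, where x_{d+1} = e;
-- in the uᵢ the deshuffling coproduct is dual to the shuffling of points.
xs : ℚ → Points → Points
xs e [] = []
xs e ((u , y) ∷ G) = (u + hd e (xs e G) , y) ∷ xs e G

hd-xs-insert : ∀ e a η s t → hd e (xs e (s ++ (a , η) ∷ t)) ≡ a + hd e (xs e (s ++ t))
hd-xs-insert e a η [] t = refl
hd-xs-insert e a η ((u , y) ∷ s) t = trans (cong (u +_) (hd-xs-insert e a η s t))
  (solve 3 (λ u a h → u :+ (a :+ h) := a :+ (u :+ h)) refl u a (hd e (xs e (s ++ t))))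

shiftX-0 : ∀ L → shiftX 0ℚ L ≡ L
shiftX-0 [] = refl
shiftX-0 ((x , y) ∷ L) = cong₂ _∷_ (cong (_, y) (+-identityˡ x)) (shiftX-0 L)

-- Only u of the form b₀^m b_k contributes: a b₀ behind its letter has value 0. A b₀ of w in front
-- of the extracted letter thus goes to u or to v, with total value a + x, while one behind it stays
-- in v. In the differences this is the insertion of a single point, which raises all earlier x by
-- a.
dsum-insert : ∀ w a η e G → dsum w (λ u v → ev 0ℚ u ((a , η) ∷ []) * ev e v (xs e G)) ≡
  splitSum (λ s t → ev e w (xs e (s ++ (a , η) ∷ t))) G
dsum-insert [] a η e G = trans (*-zeroˡ (ev e [] (xs e G)))
  (sym (splitSum-0 G (λ { [] t → refl ; (_ ∷ _) t → refl })))
dsum-insert (zero ∷ w) a η e G = begin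
  dsum w (λ u v → a * ev 0ℚ u g * ev e v (xs e G) + ev 0ℚ u g * (h * ev e v (xs e G)))
    ≡⟨ dsum-cong w (λ u v → solve 4 (λ t a h b → t :* a :* b :+ a :* (h :* b) := (t :+ h) :* (a :* b)) refl
         a (ev 0ℚ u g) h (ev e v (xs e G))) ⟩
  dsum w (λ u v → (a + h) * (ev 0ℚ u g * ev e v (xs e G)))
    ≡⟨ dsum-*ˡ (a + h) w _ ⟩
  (a + h) * dsum w (λ u v → ev 0ℚ u g * ev e v (xs e G))
    ≡⟨ cong ((a + h) *_) (dsum-insert w a η e G) ⟩
  (a + h) * splitSum (λ s t → ev e w (xs e (s ++ (a , η) ∷ t))) G
    ≡⟨ sym (splitSum-*ˡ (a + h) _ G) ⟩
  splitSum (λ s t → (a + h) * ev e w (xs e (s ++ (a , η) ∷ t))) G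
    ≡⟨ splitSum-cong G (λ s t st → cong (_* ev e w (xs e (s ++ (a , η) ∷ t)))
         (trans (cong (λ l → a + hd e (xs e l)) (sym st)) (sym (hd-xs-insert e a η s t)))) ⟩
  splitSum (λ s t → hd e (xs e (s ++ (a , η) ∷ t)) * ev e w (xs e (s ++ (a , η) ∷ t))) G ∎
  where
  g : Points
  g = (a , η) ∷ []
  h : ℚ
  h = hd e (xs e G)
dsum-insert (suc j ∷ w) a η e G = begin
  dsum w (λ u v → η ^ j * ev 0ℚ u [] * ev e v (xs e G) + ev 0ℚ u g * ev e (suc j ∷ v) (xs e G))
    ≡⟨ dsum-+ w _ _ ⟩
  dsum w (λ u v → η ^ j * ev 0ℚ u [] * ev e v (xs e G)) + dsum w (λ u v → ev 0ℚ u g * ev e (suc j ∷ v) (xs e G))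
    ≡⟨ cong₂ _+_ first (second G) ⟩
  η ^ j * ev e w (xs e G) + later G
    ≡⟨ assemble G ⟩
  splitSum (λ s t → ev e (suc j ∷ w) (xs e (s ++ (a , η) ∷ t))) G ∎
  where
  g : Points
  g = (a , η) ∷ []
  later : Points → ℚ
  later [] = 0ℚ
  later ((u , y) ∷ G) = y ^ j * splitSum (λ s t → ev e w (xs e (s ++ (a , η) ∷ t))) G
  -- Here the leading letter itself is extracted. What else goes to u is evaluated at 0, so this is
  -- the translation by 0.
  first : dsum w (λ u v → η ^ j * ev 0ℚ u [] * ev e v (xs e G)) ≡ η ^ j * ev e w (xs e G)
  first = trans (dsum-cong w (λ u v → *-assoc (η ^ j) (ev 0ℚ u []) (ev e v (xs e G))))
    (trans (dsum-*ˡ (η ^ j) w (λ u v → ev 0ℚ u [] * ev e v (xs e G))) (cong (η ^ j *_)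
      (trans (dsum-translation w 0ℚ e (xs e G)) (cong₂ (λ e' L → ev e' w L) (+-identityˡ e) (shiftX-0 (xs e G))))))
  second : ∀ G → dsum w (λ u v → ev 0ℚ u g * ev e (suc j ∷ v) (xs e G)) ≡ later G
  second [] = dsum-0 w (λ u v → *-zeroʳ (ev 0ℚ u g))
  second ((u' , y) ∷ G) = trans
    (dsum-cong w (λ u v → solve 3 (λ a p b → a :* (p :* b) := p :* (a :* b)) refl (ev 0ℚ u g) (y ^ j) (ev e v (xs e G))))
    (trans (dsum-*ˡ (y ^ j) w _) (cong (y ^ j *_) (dsum-insert w a η e G)))
  assemble : ∀ G → η ^ j * ev e w (xs e G) + later G ≡ splitSum (λ s t → ev e (suc j ∷ w) (xs e (s ++ (a , η) ∷ t))) G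
  assemble [] = +-identityʳ _
  assemble ((u , y) ∷ G) = cong (η ^ j * ev e w (xs e ((u , y) ∷ G)) +_) (sym (splitSum-*ˡ (y ^ j) _ G))

-- The convolution of antipode and identity. The first letter of w either ends the reversed u, with
-- an additional sign, or begins v; both give the same word, so the terms cancel in pairs.
dsum-antipode : ∀ w (k : Word → ℚ) → k [] ≡ 0ℚ → dsum w (λ u v → sgn (length u) * k (reverse u ++ v)) ≡ 0ℚ
dsum-antipode [] k k0 = trans (*-identityˡ (k [])) k0
dsum-antipode (x ∷ w) k k0 = dsum-0 w (λ u v → begin
  - sgn (length u) * k (reverse (x ∷ u) ++ v) + sgn (length u) * k (reverse u ++ x ∷ v)
    ≡⟨ cong (λ l → - sgn (length u) * k l + sgn (length u) * k (reverse u ++ x ∷ v))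
         (trans (cong (_++ v) (unfold-reverse x u)) (++-assoc (reverse u) (x ∷ []) v)) ⟩
  - sgn (length u) * k (reverse u ++ x ∷ v) + sgn (length u) * k (reverse u ++ x ∷ v)
    ≡⟨ solve 2 (λ s a → (:- s) :* a :+ s :* a := con 0ℚ) refl (sgn (length u)) (k (reverse u ++ x ∷ v)) ⟩
  0ℚ ∎)

-- Reversal exchanges the gap before a letter with the gap after it, so the letter (x, y) takes the
-- coordinate of the following gap. The first x becomes the end coordinate, as `ev-reverse` shows.
rv : ℚ → Points → Points
rv e [] = []
rv e ((x , y) ∷ L) = rv e L ∷ʳ (hd e L , y)

ev-∷ʳ-zero : ∀ e u L → ev e (u ∷ʳ 0) L ≡ e * ev e u L
ev-∷ʳ-zero e [] [] = refl
ev-∷ʳ-zero e [] ((x , y) ∷ L) = trans (*-zeroʳ x) (sym (*-zeroʳ e))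
ev-∷ʳ-zero e (zero ∷ u) L = trans (cong (hd e L *_) (ev-∷ʳ-zero e u L))
  (solve 3 (λ h e v → h :* (e :* v) := e :* (h :* v)) refl (hd e L) e (ev e u L))
ev-∷ʳ-zero e (suc j ∷ u) [] = sym (*-zeroʳ e)
ev-∷ʳ-zero e (suc j ∷ u) ((x , y) ∷ L) = trans (cong (y ^ j *_) (ev-∷ʳ-zero e u L))
  (solve 3 (λ h e v → h :* (e :* v) := e :* (h :* v)) refl (y ^ j) e (ev e u L))

ev-∷ʳ-suc-[] : ∀ e u j → ev e (u ∷ʳ suc j) [] ≡ 0ℚ
ev-∷ʳ-suc-[] e [] j = refl
ev-∷ʳ-suc-[] e (zero ∷ u) j = trans (cong (e *_) (ev-∷ʳ-suc-[] e u j)) (*-zeroʳ e)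
ev-∷ʳ-suc-[] e (suc _ ∷ u) j = refl

ev-∷ʳ-suc : ∀ e u j L x y → ev e (u ∷ʳ suc j) (L ∷ʳ (x , y)) ≡ y ^ j * ev x u L
ev-∷ʳ-suc e [] j [] x y = refl
ev-∷ʳ-suc e [] j ((_ , y') ∷ L) x y =
  trans (trans (cong (y' ^ j *_) (ev-[]-∷ʳ e L (x , y))) (*-zeroʳ (y' ^ j))) (sym (*-zeroʳ (y ^ j)))
ev-∷ʳ-suc e (zero ∷ u) j L x y = trans (cong₂ _*_ (sym (hd-++ e L ((x , y) ∷ []))) (ev-∷ʳ-suc e u j L x y))
  (solve 3 (λ h p v → h :* (p :* v) := p :* (h :* v)) refl (hd x L) (y ^ j) (ev x u L))
ev-∷ʳ-suc e (suc i ∷ u) j [] x y =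
  trans (trans (cong (y ^ i *_) (ev-∷ʳ-suc-[] e u j)) (*-zeroʳ (y ^ i))) (sym (*-zeroʳ (y ^ j)))
ev-∷ʳ-suc e (suc i ∷ u) j ((_ , y') ∷ L) x y = trans (cong (y' ^ i *_) (ev-∷ʳ-suc e u j L x y))
  (solve 3 (λ h p v → h :* (p :* v) := p :* (h :* v)) refl (y' ^ i) (y ^ j) (ev x u L))

ev-reverse : ∀ e w L → ev (hd e L) (reverse w) (rv e L) ≡ ev e w L
ev-reverse e [] [] = refl
ev-reverse e [] ((x , y) ∷ L) = ev-[]-∷ʳ x (rv e L) (hd e L , y)
ev-reverse e (zero ∷ w) L = trans (cong (λ u → ev (hd e L) u (rv e L)) (unfold-reverse 0 w))
  (trans (ev-∷ʳ-zero (hd e L) (reverse w) (rv e L)) (cong (hd e L *_) (ev-reverse e w L)))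
ev-reverse e (suc j ∷ w) [] = trans (cong (λ u → ev e u []) (unfold-reverse (suc j) w)) (ev-∷ʳ-suc-[] e (reverse w) j)
ev-reverse e (suc j ∷ w) ((x , y) ∷ L) = trans
  (cong (λ u → ev x u (rv e L ∷ʳ (hd e L , y))) (unfold-reverse (suc j) w))
  (trans (ev-∷ʳ-suc x (reverse w) j (rv e L) (hd e L) y) (cong (y ^ j *_) (ev-reverse e w L)))

negX : Points → Points
negX = map (λ { (x , y) → (- x , y) })

hd-negX : ∀ e L → hd (- e) (negX L) ≡ - hd e L
hd-negX e [] = refl
hd-negX e (_ ∷ _) = refl

-- The length counts the letters b₀ and the other letters. The signs of the b₀ are absorbed by
-- negating x; the others number `length L` whenever the value is nonzero.
sgn-ev : ∀ e w L → sgn (length w) * ev e w L ≡ sgn (length L) * ev (- e) w (negX L)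
sgn-ev e [] [] = refl
sgn-ev e [] (_ ∷ L) = sym (*-zeroʳ (- sgn (length L)))
sgn-ev e (zero ∷ w) L = begin
  - sgn (length w) * (hd e L * ev e w L)
    ≡⟨ solve 3 (λ s h v → (:- s) :* (h :* v) := (:- h) :* (s :* v)) refl (sgn (length w)) (hd e L) (ev e w L) ⟩
  - hd e L * (sgn (length w) * ev e w L)
    ≡⟨ cong₂ _*_ (sym (hd-negX e L)) (sgn-ev e w L) ⟩
  hd (- e) (negX L) * (sgn (length L) * ev (- e) w (negX L))
    ≡⟨ solve 3 (λ h s v → h :* (s :* v) := s :* (h :* v)) refl
         (hd (- e) (negX L)) (sgn (length L)) (ev (- e) w (negX L)) ⟩
  sgn (length L) * (hd (- e) (negX L) * ev (- e) w (negX L)) ∎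
sgn-ev e (suc j ∷ w) [] = *-zeroʳ (- sgn (length w))
sgn-ev e (suc j ∷ w) ((x , y) ∷ L) = begin
  - sgn (length w) * (y ^ j * ev e w L)
    ≡⟨ solve 3 (λ s p v → (:- s) :* (p :* v) := (:- p) :* (s :* v)) refl (sgn (length w)) (y ^ j) (ev e w L) ⟩
  - (y ^ j) * (sgn (length w) * ev e w L)
    ≡⟨ cong (- (y ^ j) *_) (sgn-ev e w L) ⟩
  - (y ^ j) * (sgn (length L) * ev (- e) w (negX L))
    ≡⟨ solve 3 (λ s p v → (:- p) :* (s :* v) := (:- s) :* (p :* v)) refl (sgn (length L)) (y ^ j) (ev (- e) w (negX L)) ⟩
  - sgn (length L) * (y ^ j * ev (- e) w (negX L)) ∎

module PrimitiveElement (ψ : Poly) (prim : Primitive ψ) where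

  -- In positive depth the primitive term with v empty has value 0, so only u empty remains. In
  -- depth 0 both terms survive, and additivity takes the place of invariance.
  translation : ∀ t e z L → evP (t + e) ψ (shiftX t (z ∷ L)) ≡ evP e ψ (z ∷ L)
  translation t e z L = begin
    evP (t + e) ψ (shiftX t (z ∷ L))
      ≡⟨ pair-cong ψ (λ w → sym (dsum-translation w t e (z ∷ L))) ⟩
    pair ψ (λ w → dsum w (λ u v → ev t u [] * ev e v (z ∷ L)))
      ≡⟨ prim (λ u v → ev t u [] * ev e v (z ∷ L)) ⟩
    pair ψ (λ w → ev t w [] * 0ℚ) + pair ψ (λ w → 1ℚ * ev e w (z ∷ L))
      ≡⟨ cong₂ _+_ (pair-0 ψ (λ w → *-zeroʳ (ev t w []))) (pair-cong ψ (λ w → *-identityˡ _)) ⟩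
    0ℚ + evP e ψ (z ∷ L)
      ≡⟨ +-identityˡ _ ⟩
    evP e ψ (z ∷ L) ∎

  depth0-additive : ∀ s t → evP (s + t) ψ [] ≡ evP s ψ [] + evP t ψ []
  depth0-additive s t = begin
    evP (s + t) ψ []
      ≡⟨ pair-cong ψ (λ w → sym (dsum-translation w s t [])) ⟩
    pair ψ (λ w → dsum w (λ u v → ev s u [] * ev t v []))
      ≡⟨ prim (λ u v → ev s u [] * ev t v []) ⟩
    pair ψ (λ w → ev s w [] * 1ℚ) + pair ψ (λ w → 1ℚ * ev t w [])
      ≡⟨ cong₂ _+_ (pair-cong ψ (λ w → *-identityʳ _)) (pair-cong ψ (λ w → *-identityˡ _)) ⟩
    evP s ψ [] + evP t ψ [] ∎

  -- Both tensor factors are evaluated in positive depth, where the empty word has value 0, so both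
  -- primitive terms vanish.
  alternality : ∀ g e g' G → splitSum (λ s t → evP e ψ (xs e (s ++ g ∷ t))) (g' ∷ G) ≡ 0ℚ
  alternality g@(a , η) e g' G = begin
    splitSum (λ s t → evP e ψ (xs e (s ++ g ∷ t))) (g' ∷ G)
      ≡⟨ sym (pair-splitSum ψ (λ w s t → ev e w (xs e (s ++ g ∷ t))) (g' ∷ G)) ⟩
    pair ψ (λ w → splitSum (λ s t → ev e w (xs e (s ++ g ∷ t))) (g' ∷ G))
      ≡⟨ pair-cong ψ (λ w → sym (dsum-insert w a η e (g' ∷ G))) ⟩
    pair ψ (λ w → dsum w (λ u v → ev 0ℚ u (g ∷ []) * ev e v (xs e (g' ∷ G))))
      ≡⟨ prim (λ u v → ev 0ℚ u (g ∷ []) * ev e v (xs e (g' ∷ G))) ⟩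
    pair ψ (λ w → ev 0ℚ w (g ∷ []) * 0ℚ) + pair ψ (λ w → 0ℚ * ev e w (xs e (g' ∷ G)))
      ≡⟨ cong₂ _+_ (pair-0 ψ (λ w → *-zeroʳ (ev 0ℚ w (g ∷ [])))) (pair-0 ψ (λ w → *-zeroˡ (ev e w (xs e (g' ∷ G))))) ⟩
    0ℚ ∎

  -- The antipode, which sends w to (-1)^|w| times the reversed word, acts as -1 on primitive
  -- elements. `A` is the value of the antipode of ψ and `B` that of ψ, both at the reversed points.
  antipode : ∀ e z L → evP (hd e (z ∷ L)) ψ (rv e (z ∷ L)) ≡ - sgn (suc (length L)) * evP (- e) ψ (negX (z ∷ L))
  antipode e z L = begin
    B
      ≡⟨ solve 2 (λ a b → b := (a :+ b) :- a) refl A B ⟩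
    (A + B) - A
      ≡⟨ cong₂ _-_ A+B A-sgn ⟩
    0ℚ - sgn (suc (length L)) * evP (- e) ψ (negX (z ∷ L))
      ≡⟨ solve 2 (λ s p → con 0ℚ :- s :* p := (:- s) :* p) refl (sgn (suc (length L))) (evP (- e) ψ (negX (z ∷ L))) ⟩
    - sgn (suc (length L)) * evP (- e) ψ (negX (z ∷ L)) ∎
    where
    k : Word → ℚ
    k w = ev (hd e (z ∷ L)) w (rv e (z ∷ L))
    A B : ℚ
    A = pair ψ (λ w → sgn (length w) * k (reverse w))
    B = pair ψ k
    A+B : A + B ≡ 0ℚ
    A+B = begin
      A + B
        ≡⟨ cong₂ _+_ (pair-cong ψ (λ w → cong (λ u → sgn (length w) * k u) (sym (++-identityʳ (reverse w)))))
             (pair-cong ψ (λ w → sym (*-identityˡ (k w)))) ⟩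
      pair ψ (λ w → sgn (length w) * k (reverse w ++ [])) + pair ψ (λ w → 1ℚ * k w)
        ≡⟨ sym (prim (λ u v → sgn (length u) * k (reverse u ++ v))) ⟩
      pair ψ (λ w → dsum w (λ u v → sgn (length u) * k (reverse u ++ v)))
        ≡⟨ pair-0 ψ (λ w → dsum-antipode w k (ev-[]-∷ʳ (hd e (z ∷ L)) (rv e L) (hd e L , proj₂ z))) ⟩
      0ℚ ∎
    A-sgn : A ≡ sgn (suc (length L)) * evP (- e) ψ (negX (z ∷ L))
    A-sgn = trans (pair-cong ψ (λ w → trans (cong (sgn (length w) *_) (ev-reverse e w (z ∷ L))) (sgn-ev e w (z ∷ L))))
      (pair-*ˡ ψ (sgn (suc (length L))) (λ w → ev (- e) w (negX (z ∷ L))))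

-- Parity and cyclic invariance of P

sgn-±1 : ∀ n → sgn n ≡ 1ℚ ⊎ sgn n ≡ - 1ℚ
sgn-±1 zero = inj₁ refl
sgn-±1 (suc n) with sgn-±1 n
... | inj₁ e = inj₂ (cong -_ e)
... | inj₂ e = inj₁ (cong -_ e)

x≡-x⇒x≡0 : ∀ {x} → x ≡ - x → x ≡ 0ℚ
x≡-x⇒x≡0 {x} e = x+x≡0⇒x≡0 (trans (cong (x +_) e) (+-inverseʳ x))

infixl 6 _⊖_
_⊖_ : ℚ × ℚ → ℚ × ℚ → ℚ × ℚ
(a , b) ⊖ (x , y) = (a - x , b - y)

neg : ℚ × ℚ → ℚ × ℚ
neg (x , y) = (- x , - y)

neg-involutive : ∀ L → map neg (map neg L) ≡ L
neg-involutive [] = refl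
neg-involutive ((x , y) ∷ L) =
  cong₂ _∷_ (cong₂ _,_ (neg-involutive-ℚ x) (neg-involutive-ℚ y)) (neg-involutive L)
  where
  neg-involutive-ℚ : ∀ x → - (- x) ≡ x
  neg-involutive-ℚ x = solve 1 (λ x → :- (:- x) := x) refl x

tot : Points → ℚ
tot [] = 0ℚ
tot ((u , _) ∷ G) = u + tot G

tot-++ : ∀ s t → tot (s ++ t) ≡ tot s + tot t
tot-++ [] t = sym (+-identityˡ _)
tot-++ ((u , _) ∷ s) t = trans (cong (u +_) (tot-++ s t)) (sym (+-assoc u (tot s) (tot t)))

tot-rotate : ∀ s t → tot (s ++ t) ≡ tot (t ++ s)
tot-rotate s t = trans (tot-++ s t) (trans (+-comm (tot s) (tot t)) (sym (tot-++ t s)))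

tot-neg : ∀ G → tot (map neg G) ≡ - tot G
tot-neg [] = refl
tot-neg ((u , _) ∷ G) = trans (cong (- u +_) (tot-neg G))
  (solve 2 (λ u t → (:- u) :+ (:- t) := :- (u :+ t)) refl u (tot G))

tot-shiftY : ∀ y G → tot (shiftY y G) ≡ tot G
tot-shiftY y [] = refl
tot-shiftY y ((u , _) ∷ G) = cong (u +_) (tot-shiftY y G)

hd-xs : ∀ G → hd 0ℚ (xs 0ℚ G) ≡ tot G
hd-xs [] = refl
hd-xs ((u , y) ∷ G) = cong (u +_) (hd-xs G)

hd-xs-neg : ∀ G → hd 0ℚ (xs 0ℚ (map neg G)) ≡ - hd 0ℚ (xs 0ℚ G)
hd-xs-neg G = trans (hd-xs (map neg G)) (trans (tot-neg G) (cong -_ (sym (hd-xs G))))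

xs-neg : ∀ G → xs 0ℚ (map neg G) ≡ map neg (xs 0ℚ G)
xs-neg [] = refl
xs-neg ((u , y) ∷ G) = cong₂ _∷_
  (cong (_, - y) (trans (cong (- u +_) (hd-xs-neg G))
    (solve 2 (λ u t → (:- u) :+ (:- t) := :- (u :+ t)) refl u (hd 0ℚ (xs 0ℚ G)))))
  (xs-neg G)

gaps : Points → Points
gaps [] = []
gaps ((x , y) ∷ M) = (x - hd 0ℚ M , y) ∷ gaps M

xs-gaps : ∀ M → xs 0ℚ (gaps M) ≡ M
xs-gaps [] = refl
xs-gaps ((x , y) ∷ M) = cong₂ _∷_
  (cong (_, y) (trans (cong (λ L → x - hd 0ℚ M + hd 0ℚ L) (xs-gaps M))
    (solve 2 (λ x h → x :- h :+ h := x) refl x (hd 0ℚ M))))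
  (xs-gaps M)

hd-⊖-∷ʳ : ∀ a b L → hd 0ℚ (map ((a , b) ⊖_) (L ∷ʳ (0ℚ , 0ℚ))) ≡ a - hd 0ℚ L
hd-⊖-∷ʳ a b [] = refl
hd-⊖-∷ʳ a b (_ ∷ _) = refl

-- The composite of the reflection sw with the reflection of the antipode.
turn : ℚ → Points → Points
turn a [] = []
turn a ((x , y) ∷ L) = (y , a - hd 0ℚ L) ∷ turn a L

length-turn : ∀ a L → length (turn a L) ≡ length L
length-turn a [] = refl
length-turn a (_ ∷ L) = cong suc (length-turn a L)

-- Two reflections compose to a rotation. With (a , b) = z = z₁ and z₀ = 0, the list z₁, ..., z_d
-- becomes z₁ - z₂, ..., z₁ - z_d, z₁ - z₀.
turn-turn : ∀ a b z M → turn b (turn a (z ∷ M)) ≡ map ((a , b) ⊖_) (M ∷ʳ (0ℚ , 0ℚ))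
turn-turn a b z [] = refl
turn-turn a b z (z' ∷ M) = cong ((a - proj₁ z' , b - proj₂ z') ∷_) (turn-turn a b z' M)

sw-shiftX-rv-negX : ∀ a L → sw (shiftX a (rv 0ℚ (negX L))) ≡ turn a L
sw-shiftX-rv-negX a [] = refl
sw-shiftX-rv-negX a ((x , y) ∷ L) = begin
  sw (shiftX a (rv 0ℚ (negX L) ∷ʳ (hd 0ℚ (negX L) , y)))
    ≡⟨ cong sw (map-++ _ (rv 0ℚ (negX L)) ((hd 0ℚ (negX L) , y) ∷ [])) ⟩
  sw (shiftX a (rv 0ℚ (negX L)) ∷ʳ (a + hd 0ℚ (negX L) , y))
    ≡⟨ sw-∷ʳ (shiftX a (rv 0ℚ (negX L))) (a + hd 0ℚ (negX L) , y) ⟩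
  (y , a + hd 0ℚ (negX L)) ∷ sw (shiftX a (rv 0ℚ (negX L)))
    ≡⟨ cong₂ _∷_ (cong (λ h → (y , a + h)) (hd-negX 0ℚ L)) (sw-shiftX-rv-negX a L) ⟩
  (y , a - hd 0ℚ L) ∷ turn a L ∎

negX-involutive : ∀ L → negX (negX L) ≡ L
negX-involutive [] = refl
negX-involutive ((x , y) ∷ L) = cong₂ _∷_ (cong (_, y) (solve 1 (λ x → :- (:- x) := x) refl x)) (negX-involutive L)

snoc-view : ∀ z (L : Points) → ∃₂ λ w a → z ∷ L ≡ w ∷ʳ a
snoc-view z [] = [] , z , refl
snoc-view z (z' ∷ L) with snoc-view z' L
... | w , a , e = z ∷ w , a , cong (z ∷_) e

module Cyclicity (ψ : Poly) (prim : Primitive ψ)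
  (reflection : ∀ L → evP 0ℚ ψ (sw L) ≡ evP 0ℚ ψ L)
  (depth1-even : ∀ z → evP 0ℚ ψ (neg z ∷ []) ≡ evP 0ℚ ψ (z ∷ [])) where

  open PrimitiveElement ψ prim

  P : Points → ℚ
  P L = evP 0ℚ ψ L

  private
    shift-end : ∀ a L z → evP (- a) ψ (L ∷ʳ z) ≡ P (shiftX a (L ∷ʳ z))
    shift-end a [] z = sym (trans (cong (λ e → evP e ψ (shiftX a (z ∷ []))) (sym (+-inverseʳ a))) (translation a (- a) z []))
    shift-end a (z' ∷ L) z = sym (trans (cong (λ e → evP e ψ (shiftX a (z' ∷ L ∷ʳ z))) (sym (+-inverseʳ a)))
      (translation a (- a) z' (L ∷ʳ z)))

  -- The antipode at the points with negated x leaves the end coordinate -x. Translation by x brings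
  -- it back to 0, where the reflection applies.
  P-turn : ∀ x y L → P (turn x ((x , y) ∷ L)) ≡ - sgn (suc (length L)) * P ((x , y) ∷ L)
  P-turn x y L = begin
    P (turn x ((x , y) ∷ L))
      ≡⟨ cong P (sym (sw-shiftX-rv-negX x ((x , y) ∷ L))) ⟩
    P (sw (shiftX x (rv 0ℚ (negX ((x , y) ∷ L)))))
      ≡⟨ reflection (shiftX x (rv 0ℚ (negX ((x , y) ∷ L)))) ⟩
    P (shiftX x (rv 0ℚ (negX ((x , y) ∷ L))))
      ≡⟨ sym (shift-end x (rv 0ℚ (negX L)) (hd 0ℚ (negX L) , y)) ⟩
    evP (- x) ψ (rv 0ℚ (negX ((x , y) ∷ L)))
      ≡⟨ antipode 0ℚ (- x , y) (negX L) ⟩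
    - sgn (suc (length (negX L))) * P (negX (negX ((x , y) ∷ L)))
      ≡⟨ cong₂ (λ n M → - sgn (suc n) * P M) (length-map _ L) (negX-involutive ((x , y) ∷ L)) ⟩
    - sgn (suc (length L)) * P ((x , y) ∷ L) ∎

  P-rotate : ∀ z M → P (z ∷ M) ≡ P (map (z ⊖_) (M ∷ʳ (0ℚ , 0ℚ)))
  P-rotate z@(x , y) M = sym (begin
    P (map (z ⊖_) (M ∷ʳ (0ℚ , 0ℚ)))
      ≡⟨ cong P (sym (turn-turn x y z M)) ⟩
    P (turn y (turn x (z ∷ M)))
      ≡⟨ P-turn y (x - hd 0ℚ M) (turn x M) ⟩
    - sgn (suc (length (turn x M))) * P (turn x (z ∷ M))
      ≡⟨ cong₂ (λ n p → - sgn (suc n) * p) (length-turn x M) (P-turn x y M) ⟩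
    - s * (- s * P (z ∷ M))
      ≡⟨ square (sgn-±1 (suc (length M))) ⟩
    P (z ∷ M) ∎)
    where
    s = sgn (suc (length M))
    square : s ≡ 1ℚ ⊎ s ≡ - 1ℚ → - s * (- s * P (z ∷ M)) ≡ P (z ∷ M)
    square (inj₁ e) = trans (cong (λ s → - s * (- s * P (z ∷ M))) e)
      (solve 1 (λ p → (:- con 1ℚ) :* ((:- con 1ℚ) :* p) := p) refl (P (z ∷ M)))
    square (inj₂ e) = trans (cong (λ s → - s * (- s * P (z ∷ M))) e)
      (solve 1 (λ p → (:- (:- con 1ℚ)) :* ((:- (:- con 1ℚ)) :* p) := p) refl (P (z ∷ M)))

  -- F is P read cyclically on d+1 points in the differences uᵢ, whose sum is 0;
  -- N is its odd part.
  F : Points → ℚ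
  F [] = 0ℚ
  F ((_ , y₀) ∷ G) = P (xs 0ℚ (shiftY y₀ G))

  N : Points → ℚ
  N G = F G - F (map neg G)

  private
    rotate-points : ∀ a y₀ y₁ G →
      xs 0ℚ (shiftY (- y₁) (map neg (G ∷ʳ (- a , y₀)))) ≡ map ((a , y₁ - y₀) ⊖_) (xs 0ℚ (shiftY y₀ G) ∷ʳ (0ℚ , 0ℚ))
    rotate-points a y₀ y₁ [] = cong (_∷ []) (cong₂ _,_
      (solve 1 (λ a → (:- (:- a)) :+ con 0ℚ := a :- con 0ℚ) refl a)
      (solve 2 (λ p q → (:- p) :- (:- q) := q :- p :- con 0ℚ) refl y₀ y₁))
    rotate-points a y₀ y₁ ((u , y) ∷ G) = cong₂ _∷_
      (cong₂ _,_
        (trans (cong (λ L → - u + hd 0ℚ L) (rotate-points a y₀ y₁ G))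
          (trans (cong (- u +_) (hd-⊖-∷ʳ a (y₁ - y₀) (xs 0ℚ (shiftY y₀ G))))
            (solve 3 (λ u a h → (:- u) :+ (a :- h) := a :- (u :+ h)) refl u a (hd 0ℚ (xs 0ℚ (shiftY y₀ G))))))
        (solve 3 (λ y p q → (:- y) :- (:- q) := (q :- p) :- (y :- p)) refl y y₀ y₁))
      (rotate-points a y₀ y₁ G)

    -- `F` discards the first difference, which the total 0 recovers from the others. This makes the
    -- rotation of P a cyclic shift of the list together with a negation.
    F-rotate : ∀ g G → tot (g ∷ G) ≡ 0ℚ → F (g ∷ G) ≡ F (map neg (G ∷ʳ g))
    F-rotate g [] _ = refl
    F-rotate (u₀ , y₀) ((u₁ , y₁) ∷ G) tot0 = begin
      P ((u₁ + hd 0ℚ (xs 0ℚ (shiftY y₀ G)) , y₁ - y₀) ∷ xs 0ℚ (shiftY y₀ G))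
        ≡⟨ cong (λ h → P ((u₁ + h , y₁ - y₀) ∷ xs 0ℚ (shiftY y₀ G)))
             (trans (hd-xs (shiftY y₀ G)) (tot-shiftY y₀ G)) ⟩
      P ((a , y₁ - y₀) ∷ xs 0ℚ (shiftY y₀ G))
        ≡⟨ P-rotate (a , y₁ - y₀) (xs 0ℚ (shiftY y₀ G)) ⟩
      P (map ((a , y₁ - y₀) ⊖_) (xs 0ℚ (shiftY y₀ G) ∷ʳ (0ℚ , 0ℚ)))
        ≡⟨ cong P (sym (rotate-points a y₀ y₁ G)) ⟩
      P (xs 0ℚ (shiftY (- y₁) (map neg (G ∷ʳ (- a , y₀)))))
        ≡⟨ cong (λ u → P (xs 0ℚ (shiftY (- y₁) (map neg (G ∷ʳ (u , y₀)))))) (sym u₀≡-a) ⟩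
      P (xs 0ℚ (shiftY (- y₁) (map neg (G ∷ʳ (u₀ , y₀))))) ∎
      where
      a = u₁ + tot G
      u₀≡-a : u₀ ≡ - a
      u₀≡-a = begin
        u₀            ≡⟨ solve 2 (λ u a → u := (u :+ a) :- a) refl u₀ a ⟩
        (u₀ + a) - a  ≡⟨ cong (_- a) tot0 ⟩
        0ℚ - a        ≡⟨ +-identityˡ (- a) ⟩
        - a           ∎

    N-rotate : ∀ g G → tot (g ∷ G) ≡ 0ℚ → N (g ∷ G) ≡ - N (G ∷ʳ g)
    N-rotate g G tot0 = begin
      F (g ∷ G) - F (neg g ∷ map neg G)
        ≡⟨ cong₂ _-_ (F-rotate g G tot0) (F-rotate (neg g) (map neg G) (trans (tot-neg (g ∷ G)) (cong -_ tot0))) ⟩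
      F (map neg (G ∷ʳ g)) - F (map neg (map neg G ∷ʳ neg g))
        ≡⟨ cong (λ l → F (map neg (G ∷ʳ g)) - F l)
             (trans (cong (map neg) (sym (map-++ neg G (g ∷ [])))) (neg-involutive (G ∷ʳ g))) ⟩
      F (map neg (G ∷ʳ g)) - F (G ∷ʳ g)
        ≡⟨ solve 2 (λ a b → b :- a := :- (a :- b)) refl (F (G ∷ʳ g)) (F (map neg (G ∷ʳ g))) ⟩
      - N (G ∷ʳ g) ∎

    N-rotate* : ∀ s t → tot (s ++ t) ≡ 0ℚ → N (s ++ t) ≡ sgn (length s) * N (t ++ s)
    N-rotate* [] t _ = trans (cong N (sym (++-identityʳ t))) (sym (*-identityˡ (N (t ++ []))))
    N-rotate* (a ∷ s) t tot0 = begin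
      N (a ∷ s ++ t)
        ≡⟨ N-rotate a (s ++ t) tot0 ⟩
      - N ((s ++ t) ∷ʳ a)
        ≡⟨ cong (λ l → - N l) (++-assoc s t (a ∷ [])) ⟩
      - N (s ++ t ∷ʳ a)
        ≡⟨ cong -_ (N-rotate* s (t ∷ʳ a) (trans (cong tot (sym (++-assoc s t (a ∷ []))))
             (trans (tot-rotate (s ++ t) (a ∷ [])) tot0))) ⟩
      - (sgn (length s) * N ((t ∷ʳ a) ++ s))
        ≡⟨ cong (λ l → - (sgn (length s) * N l)) (++-assoc t (a ∷ []) s) ⟩
      - (sgn (length s) * N (t ++ a ∷ s))
        ≡⟨ solve 2 (λ s n → :- (s :* n) := (:- s) :* n) refl (sgn (length s)) (N (t ++ a ∷ s)) ⟩
      - sgn (length s) * N (t ++ a ∷ s) ∎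

    -- The first entry only supplies the base point z₀, so alternality applies to the remaining
    -- entries.
    F-alternal : ∀ g x a G → splitSum (λ s t → F (g ∷ s ++ x ∷ t)) (a ∷ G) ≡ 0ℚ
    F-alternal (u , y) x a G = begin
      splitSum (λ s t → P (xs 0ℚ (shiftY y (s ++ x ∷ t)))) (a ∷ G)
        ≡⟨ splitSum-cong {g = λ s t → P (xs 0ℚ (shiftY y (s ++ x ∷ t)))}
             {h = λ s t → P (xs 0ℚ (shiftY y s ++ shiftY y (x ∷ t)))} (a ∷ G)
             (λ s t _ → cong (λ l → P (xs 0ℚ l)) (map-++ (λ { (u , v) → (u , v - y) }) s (x ∷ t))) ⟩
      splitSum (λ s t → P (xs 0ℚ (shiftY y s ++ shiftY y (x ∷ t)))) (a ∷ G)
        ≡⟨ sym (splitSum-map _ (λ s t → P (xs 0ℚ (s ++ (proj₁ x , proj₂ x - y) ∷ t))) (a ∷ G)) ⟩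
      splitSum (λ s t → P (xs 0ℚ (s ++ (proj₁ x , proj₂ x - y) ∷ t))) (shiftY y (a ∷ G))
        ≡⟨ alternality (proj₁ x , proj₂ x - y) 0ℚ (proj₁ a , proj₂ a - y) (shiftY y G) ⟩
      0ℚ ∎

    N-alternal : ∀ g x a G → splitSum (λ s t → N (g ∷ s ++ x ∷ t)) (a ∷ G) ≡ 0ℚ
    N-alternal g x a G = begin
      splitSum (λ s t → N (g ∷ s ++ x ∷ t)) (a ∷ G)
        ≡⟨ splitSum-cong (a ∷ G) (λ s t _ → trans
             (cong (λ l → F (g ∷ s ++ x ∷ t) - F (neg g ∷ l)) (map-++ neg s (x ∷ t)))
             (solve 2 (λ p q → p :- q := p :+ (:- con 1ℚ) :* q) refl (F (g ∷ s ++ x ∷ t)) (F (neg g ∷ map neg s ++ neg x ∷ map neg t)))) ⟩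
      splitSum (λ s t → F (g ∷ s ++ x ∷ t) + - 1ℚ * F (neg g ∷ map neg s ++ neg x ∷ map neg t)) (a ∷ G)
        ≡⟨ splitSum-+ (λ s t → F (g ∷ s ++ x ∷ t)) (λ s t → - 1ℚ * F (neg g ∷ map neg s ++ neg x ∷ map neg t)) (a ∷ G) ⟩
      splitSum (λ s t → F (g ∷ s ++ x ∷ t)) (a ∷ G) + splitSum (λ s t → - 1ℚ * F (neg g ∷ map neg s ++ neg x ∷ map neg t)) (a ∷ G)
        ≡⟨ cong₂ _+_ (F-alternal g x a G) (trans (splitSum-*ˡ (- 1ℚ) (λ s t → F (neg g ∷ map neg s ++ neg x ∷ map neg t)) (a ∷ G))
             (cong (- 1ℚ *_) (trans (sym (splitSum-map neg (λ s t → F (neg g ∷ s ++ neg x ∷ t)) (a ∷ G)))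
               (F-alternal (neg g) (neg x) (neg a) (map neg G))))) ⟩
      0ℚ ∎

    -- The alternating sum of N(x ∷ c) over the rotations c of p ++ t that keep
    -- the letters of p together.
    rotations : ℚ × ℚ → Points → Points → ℚ
    rotations x p [] = N (x ∷ p)
    rotations x p (b ∷ t) = N (x ∷ b ∷ t ++ p) - rotations x (p ∷ʳ b) t

    rotations-splitSum : ∀ x p w → splitSum (λ s t → sgn (length s) * N (x ∷ t ++ p ++ s)) w ≡ rotations x p w
    rotations-splitSum x p [] = trans (*-identityˡ (N (x ∷ p ++ []))) (cong (λ l → N (x ∷ l)) (++-identityʳ p))
    rotations-splitSum x p (b ∷ w) = cong₂ _+_
      (trans (*-identityˡ (N (x ∷ b ∷ w ++ p ++ []))) (cong (λ l → N (x ∷ b ∷ w ++ l)) (++-identityʳ p)))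
      (begin
        splitSum (λ s t → - sgn (length s) * N (x ∷ t ++ p ++ b ∷ s)) w
          ≡⟨ splitSum-cong w (λ s t _ → trans
               (cong (λ l → - sgn (length s) * N (x ∷ t ++ l)) (sym (++-assoc p (b ∷ []) s)))
               (solve 2 (λ s n → (:- s) :* n := (:- con 1ℚ) :* (s :* n)) refl (sgn (length s)) (N (x ∷ t ++ (p ∷ʳ b) ++ s)))) ⟩
        splitSum (λ s t → - 1ℚ * (sgn (length s) * N (x ∷ t ++ (p ∷ʳ b) ++ s))) w
          ≡⟨ splitSum-*ˡ (- 1ℚ) (λ s t → sgn (length s) * N (x ∷ t ++ (p ∷ʳ b) ++ s)) w ⟩
        - 1ℚ * splitSum (λ s t → sgn (length s) * N (x ∷ t ++ (p ∷ʳ b) ++ s)) w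
          ≡⟨ cong (- 1ℚ *_) (rotations-splitSum x (p ∷ʳ b) w) ⟩
        - 1ℚ * rotations x (p ∷ʳ b) w
          ≡⟨ solve 1 (λ r → (:- con 1ℚ) :* r := :- r) refl (rotations x (p ∷ʳ b) w) ⟩
        - rotations x (p ∷ʳ b) w ∎)

    -- Bringing a ∷ s to the front costs the sign (-1)^(|s|+1), which cancels the alternation up to
    -- a global sign. What remains is the shuffle of x into b ∷ w with a as base point.
    rotations-vanish : ∀ x a b w → tot (x ∷ a ∷ b ∷ w) ≡ 0ℚ → rotations x (a ∷ []) (b ∷ w) ≡ 0ℚ
    rotations-vanish x a b w tot0 = begin
      rotations x (a ∷ []) (b ∷ w)
        ≡⟨ sym (rotations-splitSum x (a ∷ []) (b ∷ w)) ⟩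
      splitSum (λ s t → sgn (length s) * N (x ∷ t ++ a ∷ s)) (b ∷ w)
        ≡⟨ splitSum-cong (b ∷ w) (λ s t st → begin
             sgn (length s) * N (x ∷ t ++ a ∷ s)
               ≡⟨ solve 2 (λ s n → s :* n := (:- con 1ℚ) :* ((:- s) :* n)) refl (sgn (length s)) (N (x ∷ t ++ a ∷ s)) ⟩
             - 1ℚ * (- sgn (length s) * N (x ∷ t ++ a ∷ s))
               ≡⟨ cong (- 1ℚ *_) (sym (N-rotate* (a ∷ s) (x ∷ t) (total s t st))) ⟩
             - 1ℚ * N (a ∷ s ++ x ∷ t) ∎) ⟩
      splitSum (λ s t → - 1ℚ * N (a ∷ s ++ x ∷ t)) (b ∷ w)
        ≡⟨ splitSum-*ˡ (- 1ℚ) (λ s t → N (a ∷ s ++ x ∷ t)) (b ∷ w) ⟩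
      - 1ℚ * splitSum (λ s t → N (a ∷ s ++ x ∷ t)) (b ∷ w)
        ≡⟨ cong (- 1ℚ *_) (N-alternal a x b w) ⟩
      0ℚ ∎
      where
      total : ∀ s t → s ++ t ≡ b ∷ w → tot ((a ∷ s) ++ x ∷ t) ≡ 0ℚ
      total s t st = begin
        tot ((a ∷ s) ++ x ∷ t)                ≡⟨ tot-rotate (a ∷ s) (x ∷ t) ⟩
        tot (x ∷ t ++ a ∷ s)                  ≡⟨ cong (proj₁ x +_) (tot-rotate t (a ∷ s)) ⟩
        tot (x ∷ a ∷ s ++ t)                  ≡⟨ cong (λ l → tot (x ∷ a ∷ l)) st ⟩
        tot (x ∷ a ∷ b ∷ w)                   ≡⟨ tot0 ⟩
        0ℚ                                    ∎

    -- The first sum has the terms of the last one, since (t ∷ʳ a) ++ p is t ++ a ∷ p, and one more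
    -- rotation at the end. The added term cancels that one.
    rotations-∷ʳ : ∀ x a p t → rotations x p (t ∷ʳ a) + sgn (length t) * N (x ∷ p ++ t ∷ʳ a) ≡ rotations x (a ∷ p) t
    rotations-∷ʳ x a p [] = solve 2 (λ m n → m :- n :+ con 1ℚ :* n := m) refl (N (x ∷ a ∷ p)) (N (x ∷ p ∷ʳ a))
    rotations-∷ʳ x a p (b ∷ t) = begin
      N (x ∷ b ∷ (t ∷ʳ a) ++ p) - rotations x (p ∷ʳ b) (t ∷ʳ a) + - s * N (x ∷ p ++ b ∷ t ∷ʳ a)
        ≡⟨ cong₂ (λ k l → N (x ∷ b ∷ k) - rotations x (p ∷ʳ b) (t ∷ʳ a) + - s * N (x ∷ l))
             (++-assoc t (a ∷ []) p) (sym (++-assoc p (b ∷ []) (t ∷ʳ a))) ⟩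
      N (x ∷ b ∷ t ++ a ∷ p) - rotations x (p ∷ʳ b) (t ∷ʳ a) + - s * N (x ∷ (p ∷ʳ b) ++ t ∷ʳ a)
        ≡⟨ solve 4 (λ m r s n → m :- r :+ (:- s) :* n := m :- (r :+ s :* n)) refl
             (N (x ∷ b ∷ t ++ a ∷ p)) (rotations x (p ∷ʳ b) (t ∷ʳ a)) s (N (x ∷ (p ∷ʳ b) ++ t ∷ʳ a)) ⟩
      N (x ∷ b ∷ t ++ a ∷ p) - (rotations x (p ∷ʳ b) (t ∷ʳ a) + s * N (x ∷ (p ∷ʳ b) ++ t ∷ʳ a))
        ≡⟨ cong (λ r → N (x ∷ b ∷ t ++ a ∷ p) - r) (rotations-∷ʳ x a (p ∷ʳ b) t) ⟩
      N (x ∷ b ∷ t ++ a ∷ p) - rotations x (a ∷ p ∷ʳ b) t ∎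
      where s = sgn (length t)

    rotations-vanish-∷ʳ : ∀ x a b w → tot (x ∷ b ∷ w ∷ʳ a) ≡ 0ℚ → rotations x (b ∷ []) (w ∷ʳ a) ≡ 0ℚ
    rotations-vanish-∷ʳ x a b [] tot0 = rotations-vanish x b a [] tot0
    rotations-vanish-∷ʳ x a b (c ∷ w) tot0 = rotations-vanish x b c (w ∷ʳ a) tot0

    -- The alternating sums over the rotations of a b w and of b w a, which both
    -- vanish, differ only in the sign of one term when |w| is odd.
    N-sgn : ∀ x a b w → tot (x ∷ b ∷ w ∷ʳ a) ≡ 0ℚ → N (x ∷ b ∷ w ∷ʳ a) ≡ sgn (length w) * N (x ∷ b ∷ w ∷ʳ a)
    N-sgn x a b w tot0 = begin
      n
        ≡⟨ x-y≡0⇒x≡y (rotations-vanish x a b w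
             (trans (cong (proj₁ x +_) (sym (tot-rotate (b ∷ w) (a ∷ [])))) tot0)) ⟩
      rotations x (a ∷ b ∷ []) w
        ≡⟨ sym (rotations-∷ʳ x a (b ∷ []) w) ⟩
      rotations x (b ∷ []) (w ∷ʳ a) + sgn (length w) * n
        ≡⟨ cong (_+ sgn (length w) * n) (rotations-vanish-∷ʳ x a b w tot0) ⟩
      0ℚ + sgn (length w) * n
        ≡⟨ +-identityˡ _ ⟩
      sgn (length w) * n ∎
      where n = N (x ∷ b ∷ w ∷ʳ a)

    N-vanish-∷ʳ : ∀ x a b w → tot (x ∷ b ∷ w ∷ʳ a) ≡ 0ℚ → N (x ∷ b ∷ w ∷ʳ a) ≡ 0ℚ
    N-vanish-∷ʳ x a b w tot0 with sgn-±1 (length w)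
    ... | inj₂ odd = x≡-x⇒x≡0 (trans (N-sgn x a b w tot0) (trans (cong (_* n) odd)
            (solve 1 (λ n → (:- con 1ℚ) :* n := :- n) refl n)))
      where n = N (x ∷ b ∷ w ∷ʳ a)
    ... | inj₁ even = x≡-x⇒x≡0 (begin
      n
        ≡⟨ cong N (sym (++-identityʳ c)) ⟩
      N (c ++ [])
        -- A full turn through all |w| + 3 points; with |w| even this is an odd number of sign
        -- changes.
        ≡⟨ N-rotate* c [] (trans (cong tot (++-identityʳ c)) tot0) ⟩
      sgn (length c) * N c
        ≡⟨ cong (λ k → - - sgn k * N c) (trans (length-++ w) (ℕ.+-comm (length w) 1)) ⟩
      - - - sgn (length w) * N c
        ≡⟨ cong (λ s → - - - s * N c) even ⟩
      - - - 1ℚ * N c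
        ≡⟨ solve 1 (λ n → (:- (:- (:- con 1ℚ))) :* n := :- n) refl (N c) ⟩
      - n ∎)
      where
      c : Points
      c = x ∷ b ∷ w ∷ʳ a
      n : ℚ
      n = N c

    N-vanish : ∀ G → tot G ≡ 0ℚ → N G ≡ 0ℚ
    N-vanish [] _ = refl
    N-vanish (x ∷ []) _ = +-inverseʳ (P [])
    -- Here d = 1: a full turn has an even number of steps and alternality needs two points besides
    -- the base. This is the one place where evenness in depth 1 enters.
    N-vanish ((_ , y₀) ∷ (u , y) ∷ []) _ = begin
      P ((u + 0ℚ , y - y₀) ∷ []) - P ((- u + 0ℚ , - y - - y₀) ∷ [])
        ≡⟨ cong (λ z → P ((u + 0ℚ , y - y₀) ∷ []) - P (z ∷ [])) (cong₂ _,_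
             (solve 1 (λ u → (:- u) :+ con 0ℚ := :- (u :+ con 0ℚ)) refl u)
             (solve 2 (λ y z → (:- y) :- (:- z) := :- (y :- z)) refl y y₀)) ⟩
      P ((u + 0ℚ , y - y₀) ∷ []) - P (neg (u + 0ℚ , y - y₀) ∷ [])
        ≡⟨ cong (λ p → P ((u + 0ℚ , y - y₀) ∷ []) - p) (depth1-even (u + 0ℚ , y - y₀)) ⟩
      P ((u + 0ℚ , y - y₀) ∷ []) - P ((u + 0ℚ , y - y₀) ∷ [])
        ≡⟨ +-inverseʳ (P ((u + 0ℚ , y - y₀) ∷ [])) ⟩
      0ℚ ∎
    N-vanish (x ∷ b ∷ z ∷ L) tot0 with snoc-view z L
    ... | w , a , e = trans (cong (λ l → N (x ∷ b ∷ l)) e)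
          (N-vanish-∷ʳ x a b w (trans (cong (λ l → tot (x ∷ b ∷ l)) (sym e)) tot0))

  P-even : ∀ M → P (map neg M) ≡ P M
  P-even M = sym (begin
    P M
      ≡⟨ cong P (sym (trans (cong (xs 0ℚ) (shiftY-zero (gaps M))) (xs-gaps M))) ⟩
    F (g ∷ gaps M)
      ≡⟨ x-y≡0⇒x≡y (N-vanish (g ∷ gaps M) (+-inverseˡ (tot (gaps M)))) ⟩
    P (xs 0ℚ (shiftY 0ℚ (map neg (gaps M))))
      ≡⟨ cong P (trans (cong (xs 0ℚ) (shiftY-zero (map neg (gaps M))))
           (trans (xs-neg (gaps M)) (cong (map neg) (xs-gaps M)))) ⟩
    P (map neg M) ∎)
    where
    g : ℚ × ℚ
    -- The difference that closes the cycle to total 0; with y = 0 in the base point `F` reads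
    -- `gaps M` unshifted.
    g = (- tot (gaps M) , 0ℚ)

  P-cyclic : ∀ z₀ z₁ M → P (map (_⊖ z₀) (z₁ ∷ M)) ≡ P (map (_⊖ z₁) (M ∷ʳ z₀))
  P-cyclic z₀ z₁ M = begin
    P (z₁ ⊖ z₀ ∷ map (_⊖ z₀) M)
      ≡⟨ P-rotate (z₁ ⊖ z₀) (map (_⊖ z₀) M) ⟩
    P (map ((z₁ ⊖ z₀) ⊖_) (map (_⊖ z₀) M ∷ʳ (0ℚ , 0ℚ)))
      ≡⟨ cong P (points M) ⟩
    P (map neg (map (_⊖ z₁) (M ∷ʳ z₀)))
      ≡⟨ P-even (map (_⊖ z₁) (M ∷ʳ z₀)) ⟩
    P (map (_⊖ z₁) (M ∷ʳ z₀)) ∎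
    where
    points : ∀ M → map ((z₁ ⊖ z₀) ⊖_) (map (_⊖ z₀) M ∷ʳ (0ℚ , 0ℚ)) ≡ map neg (map (_⊖ z₁) (M ∷ʳ z₀))
    points [] = cong (_∷ []) (cong₂ _,_ (last-coordinate (proj₁ z₀) (proj₁ z₁)) (last-coordinate (proj₂ z₀) (proj₂ z₁)))
      where
      last-coordinate : ∀ a b → b - a - 0ℚ ≡ - (a - b)
      last-coordinate a b = solve 2 (λ a b → b :- a :- con 0ℚ := :- (a :- b)) refl a b
    points ((x , y) ∷ M) = cong₂ _∷_ (cong₂ _,_ (coordinate (proj₁ z₀) (proj₁ z₁) x) (coordinate (proj₂ z₀) (proj₂ z₁) y)) (points M)
      where
      coordinate : ∀ a b c → b - a - (c - a) ≡ - (c - b)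
      coordinate a b c = solve 3 (λ a b c → b :- a :- (c :- a) := :- (c :- b)) refl a b c

-- The insertions under reflection and under multiples of b₀

splitSum-sw : ∀ (g : Points → Points → ℚ) L → splitSum g (sw L) ≡ splitSum (λ s t → g (sw t) (sw s)) L
splitSum-sw g [] = refl
splitSum-sw g (z ∷ L) = begin
  splitSum g (sw (z ∷ L))
    ≡⟨ cong (splitSum g) (sw-∷ z L) ⟩
  splitSum g (sw L ∷ʳ swap z)
    ≡⟨ splitSum-∷ʳ g (sw L) (swap z) ⟩
  splitSum (λ s t → g s (t ∷ʳ swap z)) (sw L) + g (sw L ∷ʳ swap z) []
    ≡⟨ cong₂ _+_ (splitSum-sw (λ s t → g s (t ∷ʳ swap z)) L) (cong (λ l → g l []) (sym (sw-∷ z L))) ⟩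
  splitSum (λ s t → g (sw t) (sw s ∷ʳ swap z)) L + g (sw (z ∷ L)) []
    ≡⟨ +-comm (splitSum (λ s t → g (sw t) (sw s ∷ʳ swap z)) L) (g (sw (z ∷ L)) []) ⟩
  g (sw (z ∷ L)) [] + splitSum (λ s t → g (sw t) (sw s ∷ʳ swap z)) L
    ≡⟨ cong (g (sw (z ∷ L)) [] +_) (splitSum-cong L (λ s t _ → cong (g (sw t)) (sym (sw-∷ z s)))) ⟩
  g (sw (z ∷ L)) [] + splitSum (λ s t → g (sw t) (sw (z ∷ s))) L ∎

tripleSum : (Points → Points → Points → ℚ) → Points → ℚ
tripleSum g L = splitSum (λ S T → splitSum (g S) T) L

tripleSum-cong : ∀ {g h} → (∀ S A B → g S A B ≡ h S A B) → ∀ L → tripleSum g L ≡ tripleSum h L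
tripleSum-cong e L = splitSum-cong L (λ S T _ → splitSum-cong T (λ A B _ → e S A B))

-- Reflection turns the first cut into the last one, so both orders of making two cuts occur.
tripleSum-assoc : ∀ g L → tripleSum g L ≡ splitSum (λ U B → splitSum (λ S A → g S A B) U) L
tripleSum-assoc g [] = refl
tripleSum-assoc g (z ∷ L) = begin
  g [] [] (z ∷ L) + splitSum (λ A B → g [] (z ∷ A) B) L + tripleSum (λ S → g (z ∷ S)) L
    ≡⟨ cong (g [] [] (z ∷ L) + splitSum (λ A B → g [] (z ∷ A) B) L +_) (tripleSum-assoc (λ S → g (z ∷ S)) L) ⟩
  g [] [] (z ∷ L) + splitSum (λ A B → g [] (z ∷ A) B) L + splitSum (λ U B → splitSum (λ S A → g (z ∷ S) A B) U) L
    ≡⟨ +-assoc (g [] [] (z ∷ L)) _ _ ⟩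
  g [] [] (z ∷ L) + (splitSum (λ A B → g [] (z ∷ A) B) L + splitSum (λ U B → splitSum (λ S A → g (z ∷ S) A B) U) L)
    ≡⟨ cong (g [] [] (z ∷ L) +_) (sym (splitSum-+ (λ A B → g [] (z ∷ A) B) (λ U B → splitSum (λ S A → g (z ∷ S) A B) U) L)) ⟩
  g [] [] (z ∷ L) + splitSum (λ U B → g [] (z ∷ U) B + splitSum (λ S A → g (z ∷ S) A B) U) L ∎

tripleSum-sw : ∀ g L → tripleSum g (sw L) ≡ tripleSum (λ S A B → g (sw B) (sw A) (sw S)) L
tripleSum-sw g L = begin
  splitSum (λ S T → splitSum (g S) T) (sw L)
    ≡⟨ splitSum-sw (λ S T → splitSum (g S) T) L ⟩
  splitSum (λ U B → splitSum (g (sw B)) (sw U)) L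
    ≡⟨ splitSum-cong L (λ U B _ → splitSum-sw (g (sw B)) U) ⟩
  splitSum (λ U B → splitSum (λ S A → g (sw B) (sw A) (sw S)) U) L
    ≡⟨ sym (tripleSum-assoc (λ S A B → g (sw B) (sw A) (sw S)) L) ⟩
  tripleSum (λ S A B → g (sw B) (sw A) (sw S)) L ∎

lastY : ℚ → Points → ℚ
lastY t [] = t
lastY t ((_ , y) ∷ S) = lastY y S

lastY-∷ʳ : ∀ t S x y → lastY t (S ∷ʳ (x , y)) ≡ y
lastY-∷ʳ t [] x y = refl
lastY-∷ʳ t ((_ , y') ∷ S) x y = lastY-∷ʳ y' S x y

sw-++ : ∀ S B → sw (S ++ B) ≡ sw B ++ sw S
sw-++ S B = trans (cong reverse (map-++ swap S B)) (reverse-++ (map swap S) (map swap B))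

hd-sw : ∀ t S → hd t (sw S) ≡ lastY t S
hd-sw t [] = refl
hd-sw t ((x , y) ∷ S) = trans (cong (hd t) (sw-∷ (x , y) S))
  (trans (sym (hd-++ t (sw S) ((y , x) ∷ []))) (hd-sw y S))

lastY-sw : ∀ t B → lastY t (sw B) ≡ hd t B
lastY-sw t [] = refl
lastY-sw t ((x , y) ∷ B) = trans (cong (lastY t) (sw-∷ (x , y) B)) (lastY-∷ʳ t (sw B) y x)

sw-⊖ : ∀ a b A → sw (map (_⊖ (a , b)) A) ≡ map (_⊖ (b , a)) (sw A)
sw-⊖ a b [] = refl
sw-⊖ a b ((x , y) ∷ A) = begin
  sw (map (_⊖ (a , b)) ((x , y) ∷ A))                  ≡⟨ sw-∷ (x - a , y - b) (map (_⊖ (a , b)) A) ⟩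
  sw (map (_⊖ (a , b)) A) ∷ʳ (y - b , x - a)           ≡⟨ cong (_∷ʳ (y - b , x - a)) (sw-⊖ a b A) ⟩
  map (_⊖ (b , a)) (sw A) ∷ʳ (y - b , x - a)           ≡⟨ sym (map-++ (_⊖ (b , a)) (sw A) ((y , x) ∷ [])) ⟩
  map (_⊖ (b , a)) (sw A ∷ʳ (y , x))                   ≡⟨ cong (map (_⊖ (b , a))) (sym (sw-∷ (x , y) A)) ⟩
  map (_⊖ (b , a)) (sw ((x , y) ∷ A))                  ∎

⊖-shiftY : ∀ e t A → map (_⊖ (e , 0ℚ)) (shiftY t A) ≡ map (_⊖ (e , t)) A
⊖-shiftY e t [] = refl
⊖-shiftY e t ((x , y) ∷ A) = cong₂ _∷_ (cong (x - e ,_) (+-identityʳ (y - t))) (⊖-shiftY e t A)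

module Reflection (Ψ : ℚ → Points → ℚ) (P : Points → ℚ)
  (translate : ∀ e A → Ψ e A ≡ P (map (_⊖ (e , 0ℚ)) A))
  (reflection : ∀ L → P (sw L) ≡ P L)
  (cyclic : ∀ z₀ z₁ M → P (map (_⊖ z₀) (z₁ ∷ M)) ≡ P (map (_⊖ z₁) (M ∷ʳ z₀))) where

  open Insertion Ψ 0ℚ

  private
    translate-shiftY : ∀ e t A → Ψ e (shiftY t A) ≡ P (map (_⊖ (e , t)) A)
    translate-shiftY e t A = trans (translate e (shiftY t A)) (cong P (⊖-shiftY e t A))

    -- `lastY t S` is the y of the letter to the left of the inserted block and `hd 0ℚ B` the x of
    -- the gap to its right. Reflection exchanges these two, so invariance of P under `sw` is enough
    -- for the right insertions.
    R-term : ℚ → (Points → ℚ) → Points → Points → Points → ℚ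
    R-term t f S A B = Ψ (hd 0ℚ B) (shiftY (lastY t S) A) * f (S ++ B)

    R-triple : ∀ t f L → R₀ t f L + R⁺ f L ≡ tripleSum (R-term t f) L
    R-triple t f [] = +-identityʳ _
    R-triple t f (z ∷ L) = cong (R₀ t f (z ∷ L) +_) (R-triple (proj₂ z) (λ M → f (z ∷ M)) L)

    R-term-sw : ∀ f S A B → R-term 0ℚ (f ∘ sw) S A B ≡ R-term 0ℚ f (sw B) (sw A) (sw S)
    R-term-sw f S A B = cong₂ _*_
      (begin
        Ψ (hd 0ℚ B) (shiftY (lastY 0ℚ S) A)
          ≡⟨ translate-shiftY (hd 0ℚ B) (lastY 0ℚ S) A ⟩
        P (map (_⊖ (hd 0ℚ B , lastY 0ℚ S)) A)
          ≡⟨ sym (reflection (map (_⊖ (hd 0ℚ B , lastY 0ℚ S)) A)) ⟩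
        P (sw (map (_⊖ (hd 0ℚ B , lastY 0ℚ S)) A))
          ≡⟨ cong P (sw-⊖ (hd 0ℚ B) (lastY 0ℚ S) A) ⟩
        P (map (_⊖ (lastY 0ℚ S , hd 0ℚ B)) (sw A))
          ≡⟨ cong₂ (λ a b → P (map (_⊖ (a , b)) (sw A))) (sym (hd-sw 0ℚ S)) (sym (lastY-sw 0ℚ B)) ⟩
        P (map (_⊖ (hd 0ℚ (sw S) , lastY 0ℚ (sw B))) (sw A))
          ≡⟨ sym (translate-shiftY (hd 0ℚ (sw S)) (lastY 0ℚ (sw B)) (sw A)) ⟩
        Ψ (hd 0ℚ (sw S)) (shiftY (lastY 0ℚ (sw B)) (sw A)) ∎)
      (cong f (sw-++ S B))

    -- A left insertion with its letter included in the block and the base point moved from the last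
    -- point to the first by cyclicity. The surviving letter has the x of the first point and the y
    -- of the last, a form that reflection preserves.
    block : (Points → ℚ) → Points → Points → ℚ
    block f [] B = 0ℚ
    block f (m ∷ M) B = P (map (_⊖ m) M) * f ((proj₁ m , lastY (proj₂ m) M) ∷ B)

    block-∷ʳ : ∀ f A x y B → block f (A ∷ʳ (x , y)) B ≡ P (map (_⊖ (x , y)) A) * f ((hd x A , y) ∷ B)
    block-∷ʳ f [] x y B = refl
    block-∷ʳ f (m@(a , b) ∷ A) x y B = cong₂ _*_ (sym (cyclic (x , y) m A))
      (cong (λ c → f ((a , c) ∷ B)) (lastY-∷ʳ b A x y))

    L-block : ∀ f T → splitSum (L-term f) T ≡ splitSum (block f) T
    L-block f T = begin
      splitSum (L-term f) T                    ≡⟨ splitSum-cong T (λ A B _ → term A B) ⟩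
      splitSum (advance (block f)) T           ≡⟨ sym (+-identityˡ _) ⟩
      0ℚ + splitSum (advance (block f)) T      ≡⟨ sym (splitSum-advance (block f) T) ⟩
      splitSum (block f) T                     ∎
      where
      term : ∀ A B → L-term f A B ≡ advance (block f) A B
      term A [] = refl
      term A ((x , y) ∷ B) = trans (cong (_* f ((hd x A , y) ∷ B)) (translate-shiftY x y A))
        (sym (block-∷ʳ f A x y B))

    L-triple : ∀ f L → L⁺ f L ≡ tripleSum (λ S → block (λ M → f (S ++ M))) L
    L-triple f [] = refl
    L-triple f (z ∷ L) = cong₂ _+_ (L-block f (z ∷ L)) (L-triple (λ M → f (z ∷ M)) L)

    -- With the last point as base, reflection reverses the other points and makes the base the
    -- first point, which is the form in which `block` is defined.
    block-sw : ∀ f S M B → block (λ N → f (sw (S ++ N))) M B ≡ block (λ N → f (sw B ++ N)) (sw M) (sw S)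
    block-sw f S [] B = refl
    block-sw f S (m ∷ M) B with snoc-view m M
    ... | A , (x , y) , e = begin
      block (λ N → f (sw (S ++ N))) (m ∷ M) B
        ≡⟨ cong (λ l → block (λ N → f (sw (S ++ N))) l B) e ⟩
      block (λ N → f (sw (S ++ N))) (A ∷ʳ (x , y)) B
        ≡⟨ block-∷ʳ (λ N → f (sw (S ++ N))) A x y B ⟩
      P (map (_⊖ (x , y)) A) * f (sw (S ++ (hd x A , y) ∷ B))
        ≡⟨ cong₂ _*_
             (trans (sym (reflection (map (_⊖ (x , y)) A))) (cong P (sw-⊖ x y A)))
             (cong f (begin
               sw (S ++ (hd x A , y) ∷ B)               ≡⟨ sw-++ S ((hd x A , y) ∷ B) ⟩
               sw ((hd x A , y) ∷ B) ++ sw S            ≡⟨ cong (_++ sw S) (sw-∷ (hd x A , y) B) ⟩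
               (sw B ∷ʳ (y , hd x A)) ++ sw S           ≡⟨ ++-assoc (sw B) ((y , hd x A) ∷ []) (sw S) ⟩
               sw B ++ (y , hd x A) ∷ sw S              ≡⟨ cong (λ h → sw B ++ (y , h) ∷ sw S) (sym (lastY-sw x A)) ⟩
               sw B ++ (y , lastY x (sw A)) ∷ sw S      ∎)) ⟩
      block (λ N → f (sw B ++ N)) ((y , x) ∷ sw A) (sw S)
        ≡⟨ cong (λ l → block (λ N → f (sw B ++ N)) l (sw S)) (sym (trans (cong sw e) (sw-∷ʳ A (x , y)))) ⟩
      block (λ N → f (sw B ++ N)) (sw (m ∷ M)) (sw S) ∎

  Φ-sw : ∀ f L → Φ (f ∘ sw) L ≡ Φ f (sw L)
  Φ-sw f L = cong₂ _-_
    (begin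
      R₀ 0ℚ (f ∘ sw) L + R⁺ (f ∘ sw) L                          ≡⟨ R-triple 0ℚ (f ∘ sw) L ⟩
      tripleSum (R-term 0ℚ (f ∘ sw)) L                          ≡⟨ tripleSum-cong (R-term-sw f) L ⟩
      tripleSum (λ S A B → R-term 0ℚ f (sw B) (sw A) (sw S)) L  ≡⟨ sym (tripleSum-sw (R-term 0ℚ f) L) ⟩
      tripleSum (R-term 0ℚ f) (sw L)                            ≡⟨ sym (R-triple 0ℚ f (sw L)) ⟩
      R₀ 0ℚ f (sw L) + R⁺ f (sw L)                              ∎)
    (begin
      L⁺ (f ∘ sw) L                                                   ≡⟨ L-triple (f ∘ sw) L ⟩
      tripleSum (λ S → block (λ M → f (sw (S ++ M)))) L               ≡⟨ tripleSum-cong (block-sw f) L ⟩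
      tripleSum (λ S A B → block (λ N → f (sw B ++ N)) (sw A) (sw S)) L
        ≡⟨ sym (tripleSum-sw (λ S → block (λ M → f (S ++ M))) L) ⟩
      tripleSum (λ S → block (λ M → f (S ++ M))) (sw L)               ≡⟨ sym (L-triple f (sw L)) ⟩
      L⁺ f (sw L)                                                     ∎)

-- σ_{b₀} is right multiplication by b₀, so that a multiple of b₀ does not
-- contribute to Φ when e = 0.
module AddB₀ (Ψ₁ Ψ₂ : ℚ → Points → ℚ) (c : ℚ)
  (at-[] : ∀ e → Ψ₁ e [] ≡ Ψ₂ e [] + c * e)
  (at-∷ : ∀ e z A → Ψ₁ e (z ∷ A) ≡ Ψ₂ e (z ∷ A)) where

  private
    module I₁ = Insertion Ψ₁ 0ℚ
    module I₂ = Insertion Ψ₂ 0ℚ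

    expand : ∀ x t → (Ψ₂ x [] + c * x) * t ≡ Ψ₂ x [] * t + c * x * t
    expand x t = *-distribʳ-+ t (Ψ₂ x []) (c * x)

    R₀-add : ∀ t f L → I₁.R₀ t f L ≡ I₂.R₀ t f L + c * hd 0ℚ L * f L
    R₀-add t f [] = trans (cong (_* f []) (at-[] 0ℚ)) (expand 0ℚ (f []))
    R₀-add t f ((x , y) ∷ L) = trans (cong₂ _+_
        (trans (cong (_* f ((x , y) ∷ L)) (at-[] x)) (expand x (f ((x , y) ∷ L))))
        (splitSum-cong L (λ A B _ → cong (_* f B) (at-∷ (hd 0ℚ B) (x , y - t) (shiftY t A)))))
      (solve 3 (λ a b s → a :+ b :+ s := a :+ s :+ b) refl
        (Ψ₂ x [] * f ((x , y) ∷ L)) (c * x * f ((x , y) ∷ L)) _)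

    -- Insertion of b₀ at the left end and after each letter meets every gap once; the last gap has
    -- coordinate 0, so c times the sum of all x appears. `L-add` meets the gap before each letter
    -- and yields the same term, hence the cancellation.
    R-add : ∀ t f L → I₁.R₀ t f L + I₁.R⁺ f L ≡ I₂.R₀ t f L + I₂.R⁺ f L + c * tot L * f L
    R-add t f [] = trans (cong (_+ 0ℚ) (R₀-add t f []))
      (solve 2 (λ a b → a :+ b :+ con 0ℚ := a :+ con 0ℚ :+ b) refl (I₂.R₀ t f []) (c * 0ℚ * f []))
    R-add t f (z@(x , y) ∷ L) = trans (cong₂ _+_ (R₀-add t f (z ∷ L)) (R-add y (λ M → f (z ∷ M)) L))
      (solve 6 (λ r r' c x s f → r :+ c :* x :* f :+ (r' :+ c :* s :* f) := r :+ r' :+ c :* (x :+ s) :* f) refl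
        (I₂.R₀ t f (z ∷ L)) (I₂.R₀ y (λ M → f (z ∷ M)) L + I₂.R⁺ (λ M → f (z ∷ M)) L) c x (tot L) (f (z ∷ L)))

    L-add : ∀ f L → I₁.L⁺ f L ≡ I₂.L⁺ f L + c * tot L * f L
    L-add f [] = solve 2 (λ c f → con 0ℚ := con 0ℚ :+ c :* con 0ℚ :* f) refl c (f [])
    L-add f (z@(x , y) ∷ L) = trans (cong₂ _+_
        (cong₂ _+_ (trans (cong (_* f (z ∷ L)) (at-[] x)) (expand x (f (z ∷ L))))
          (splitSum-cong {g = λ A B → I₁.L-term f (z ∷ A) B} {h = λ A B → I₂.L-term f (z ∷ A) B} L
            (λ { A [] _ → refl ; A ((x' , y') ∷ B) _ →
              cong (_* f ((x , y') ∷ B)) (at-∷ x' (x , y - y') (shiftY y' A)) })))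
        (L-add (λ M → f (z ∷ M)) L))
      (solve 7 (λ a s r c x t f → a :+ c :* x :* f :+ s :+ (r :+ c :* t :* f) := a :+ s :+ r :+ c :* (x :+ t) :* f) refl
        (Ψ₂ x [] * f (z ∷ L)) (splitSum (λ A B → I₂.L-term f (z ∷ A) B) L) (I₂.L⁺ (λ M → f (z ∷ M)) L) c x (tot L) (f (z ∷ L)))

  Φ-add : ∀ f L → I₁.Φ f L ≡ I₂.Φ f L
  Φ-add f L = trans (cong₂ _-_ (R-add 0ℚ f L) (L-add f L))
    (solve 3 (λ r l t → (r :+ t) :- (l :+ t) := r :- l) refl (I₂.R₀ 0ℚ f L + I₂.R⁺ f L) (I₂.L⁺ f L) (c * tot L * f L))

-- Linearity in depth 0 and parity in depth 1

ev-[]-power : ∀ e w → ev e w [] ≡ ev 1ℚ w [] * e ^ length w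
ev-[]-power e [] = refl
ev-[]-power e (zero ∷ w) = trans (cong (e *_) (ev-[]-power e w))
  (solve 3 (λ e v p → e :* (v :* p) := con 1ℚ :* v :* (e :* p)) refl e (ev 1ℚ w []) (e ^ length w))
ev-[]-power e (suc j ∷ w) = sym (*-zeroˡ (e ^ length (suc j ∷ w)))

ev-[]-letter : ∀ e w → ℕδ.δ 1 (length w) * ev e w [] ≡ e * δ (0 ∷ []) w
ev-[]-letter e [] = sym (trans (cong (e *_) (δ-diff {0 ∷ []} {[]} (λ ()))) (*-zeroʳ e))
ev-[]-letter e (zero ∷ []) = trans (*-identityˡ (e * 1ℚ)) (cong (e *_) (sym (δ-same {0 ∷ []} refl)))
ev-[]-letter e (suc j ∷ []) = sym (trans (cong (e *_) (δ-diff {0 ∷ []} {suc j ∷ []} (λ ()))) (*-zeroʳ e))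
ev-[]-letter e (x ∷ y ∷ w) = trans (cong (_* ev e (x ∷ y ∷ w) []) (ℕδ.δ-diff {1} {length (x ∷ y ∷ w)} (λ ())))
  (trans (*-zeroˡ (ev e (x ∷ y ∷ w) [])) (sym (trans (cong (e *_) (δ-diff {0 ∷ []} {x ∷ y ∷ w} (λ ()))) (*-zeroʳ e))))

-- In depth 0 a primitive element is an additive polynomial in e, hence linear.
depth0-linear : ∀ φ → Primitive φ → ∀ e → evP e φ [] ≡ e * coeff φ (0 ∷ [])
depth0-linear φ prim e = begin
  evP e φ []
    ≡⟨ pair-cong φ (λ w → trans
         (solve 2 (λ d v → v := (con 1ℚ :- d) :* v :+ d :* v) refl (ℕδ.δ 1 (length w)) (ev e w []))
         (cong ((1ℚ - ℕδ.δ 1 (length w)) * ev e w [] +_) (ev-[]-letter e w))) ⟩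
  pair φ (λ w → (1ℚ - ℕδ.δ 1 (length w)) * ev e w [] + e * δ (0 ∷ []) w)
    ≡⟨ pair-+ φ _ _ ⟩
  pair φ (λ w → (1ℚ - ℕδ.δ 1 (length w)) * ev e w []) + pair φ (λ w → e * δ (0 ∷ []) w)
    ≡⟨ cong₂ _+_ nonlinear (trans (pair-*ˡ φ e (δ (0 ∷ []))) (cong (e *_) (sym (coeff-pair φ (0 ∷ []))))) ⟩
  0ℚ + e * coeff φ (0 ∷ [])
    ≡⟨ +-identityˡ _ ⟩
  e * coeff φ (0 ∷ []) ∎
  where
  open PrimitiveElement φ prim
  f : Word → ℚ
  f w = ev 1ℚ w [] * (2ℚ ^ length w - 2ℚ ^ 1)
  r : ℕ → ℚ
  r n = proj₁ (2^-gap-inverse 1 n)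
  -- Additivity at x + x makes the value at 2x twice the value at x. So the terms of length n,
  -- weighted by 2^n - 2, sum to 0 at every x; dividing by these weights removes all n ≠ 1.
  doubling : ∀ x → pair (reweight f length φ) (x ^_) ≡ 0ℚ
  doubling x = begin
    pair (reweight f length φ) (x ^_)
      ≡⟨ pair-reweight f length φ (x ^_) ⟩
    pair φ (λ w → ev 1ℚ w [] * (2ℚ ^ length w - 2ℚ ^ 1) * x ^ length w)
      ≡⟨ pair-cong φ (λ w → begin
           ev 1ℚ w [] * (2ℚ ^ length w - 2ℚ ^ 1) * x ^ length w
             ≡⟨ solve 4 (λ v a b p → v :* (a :- b) :* p := v :* (a :* p) :- b :* (v :* p)) refl
                  (ev 1ℚ w []) (2ℚ ^ length w) (2ℚ ^ 1) (x ^ length w) ⟩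
           ev 1ℚ w [] * (2ℚ ^ length w * x ^ length w) - 2ℚ ^ 1 * (ev 1ℚ w [] * x ^ length w)
             ≡⟨ cong₂ (λ p q → ev 1ℚ w [] * p - 2ℚ ^ 1 * q) (sym (^-distrib-* 2ℚ x (length w))) (sym (ev-[]-power x w)) ⟩
           ev 1ℚ w [] * (2ℚ * x) ^ length w - 2ℚ ^ 1 * ev x w []
             ≡⟨ cong (_- 2ℚ ^ 1 * ev x w []) (sym (ev-[]-power (2ℚ * x) w)) ⟩
           ev (2ℚ * x) w [] - 2ℚ ^ 1 * ev x w [] ∎) ⟩
    pair φ (λ w → ev (2ℚ * x) w [] - 2ℚ ^ 1 * ev x w [])
      ≡⟨ trans (pair-- φ _ _) (cong (λ s → evP (2ℚ * x) φ [] - s) (pair-*ˡ φ (2ℚ ^ 1) (λ w → ev x w []))) ⟩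
    evP (2ℚ * x) φ [] - 2ℚ ^ 1 * evP x φ []
      ≡⟨ cong (_- 2ℚ ^ 1 * evP x φ []) (trans
           (cong (λ t → evP t φ []) (solve 1 (λ x → (con 1ℚ :+ con 1ℚ) :* x := x :+ x) refl x))
           (depth0-additive x x)) ⟩
    evP x φ [] + evP x φ [] - 2ℚ ^ 1 * evP x φ []
      ≡⟨ solve 1 (λ v → v :+ v :- (con 1ℚ :+ con 1ℚ) :* con 1ℚ :* v := con 0ℚ) refl (evP x φ []) ⟩
    0ℚ ∎
  nonlinear : pair φ (λ w → (1ℚ - ℕδ.δ 1 (length w)) * ev e w []) ≡ 0ℚ
  nonlinear = begin
    pair φ (λ w → (1ℚ - ℕδ.δ 1 (length w)) * ev e w [])
      ≡⟨ pair-cong φ (λ w → trans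
           (cong₂ _*_ (sym (proj₂ (2^-gap-inverse 1 (length w)))) (ev-[]-power e w))
           (solve 4 (λ g r v p → g :* r :* (v :* p) := v :* g :* (r :* p)) refl
             (2ℚ ^ length w - 2ℚ ^ 1) (r (length w)) (ev 1ℚ w []) (e ^ length w))) ⟩
    pair φ (λ w → f w * (r (length w) * e ^ length w))
      ≡⟨ sym (pair-reweight f length φ (λ n → r n * e ^ n)) ⟩
    pair (reweight f length φ) (λ n → r n * e ^ n)
      ≡⟨ vanishing-polynomial (reweight f length φ) doubling (λ n → r n * e ^ n) ⟩
    0ℚ ∎

-- Weight minus depth, the degree of the monomial read by `ev`. For b₀^m b_k it is m + k - 1, so the
-- parity condition of 𝔩𝔮 kills the odd degrees in depth 1.
degree : Word → ℕ
degree [] = 0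
degree (zero ∷ w) = suc (degree w)
degree (suc j ∷ w) = j ℕ.+ degree w

depth : Word → ℕ
depth [] = 0
depth (zero ∷ w) = depth w
depth (suc j ∷ w) = suc (depth w)

sgn-+ : ∀ m n → sgn (m ℕ.+ n) ≡ sgn m * sgn n
sgn-+ zero n = sym (*-identityˡ (sgn n))
sgn-+ (suc m) n = trans (cong -_ (sgn-+ m n))
  (solve 2 (λ a b → :- (a :* b) := (:- a) :* b) refl (sgn m) (sgn n))

ev-neg : ∀ e w L → ev (- e) w (map neg L) ≡ sgn (degree w) * ev e w L
ev-neg e [] [] = refl
ev-neg e [] (_ ∷ _) = refl
ev-neg e (zero ∷ w) L = trans (cong₂ _*_ (hd-neg L) (ev-neg e w L))
  (solve 3 (λ h s v → (:- h) :* (s :* v) := (:- s) :* (h :* v)) refl (hd e L) (sgn (degree w)) (ev e w L))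
  where
  hd-neg : ∀ L → hd (- e) (map neg L) ≡ - hd e L
  hd-neg [] = refl
  hd-neg (_ ∷ _) = refl
ev-neg e (suc j ∷ w) [] = sym (*-zeroʳ (sgn (j ℕ.+ degree w)))
ev-neg e (suc j ∷ w) ((x , y) ∷ L) = begin
  (- y) ^ j * ev (- e) w (map neg L)
    ≡⟨ cong₂ _*_ (sym (sgn-^ y j)) (ev-neg e w L) ⟩
  sgn j * y ^ j * (sgn (degree w) * ev e w L)
    ≡⟨ solve 4 (λ s p t v → s :* p :* (t :* v) := s :* t :* (p :* v)) refl (sgn j) (y ^ j) (sgn (degree w)) (ev e w L) ⟩
  sgn j * sgn (degree w) * (y ^ j * ev e w L)
    ≡⟨ cong (_* (y ^ j * ev e w L)) (sym (sgn-+ j (degree w))) ⟩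
  sgn (j ℕ.+ degree w) * (y ^ j * ev e w L) ∎

ev-depth : ∀ e w L → ¬ (depth w ≡ length L) → ev e w L ≡ 0ℚ
ev-depth e [] [] ne = ⊥-elim (ne refl)
ev-depth e [] (_ ∷ _) ne = refl
ev-depth e (zero ∷ w) L ne = trans (cong (hd e L *_) (ev-depth e w L ne)) (*-zeroʳ (hd e L))
ev-depth e (suc j ∷ w) [] ne = refl
ev-depth e (suc j ∷ w) ((x , y) ∷ L) ne =
  trans (cong (y ^ j *_) (ev-depth e w L (λ eq → ne (cong suc eq)))) (*-zeroʳ (y ^ j))

degree-block : ∀ m j → degree (replicate m 0 ++ suc j ∷ []) ≡ j ℕ.+ m
degree-block zero j = refl
degree-block (suc m) j = trans (cong suc (degree-block m j)) (sym (ℕ.+-suc j m))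

depth-block : ∀ m j → depth (replicate m 0 ++ suc j ∷ []) ≡ 1
depth-block zero j = refl
depth-block (suc m) j = depth-block m j

depth1-block : ∀ w z → ev 0ℚ w (z ∷ []) ≡ 0ℚ ⊎ ∃₂ λ m j → w ≡ replicate m 0 ++ suc j ∷ []
depth1-block [] z = inj₁ refl
depth1-block (zero ∷ w) z with depth1-block w z
... | inj₁ e = inj₁ (trans (cong (proj₁ z *_) e) (*-zeroʳ (proj₁ z)))
... | inj₂ (m , j , e) = inj₂ (suc m , j , cong (0 ∷_) e)
depth1-block (suc j ∷ []) z = inj₂ (0 , j , refl)
depth1-block (suc j ∷ x ∷ w) z = inj₁ (trans (cong (proj₂ z ^ j *_) (ev-∷-[] x w)) (*-zeroʳ (proj₂ z ^ j)))

-1≢1 : ¬ (1ℚ ≡ - 1ℚ)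
-1≢1 ()

odd⇒% : ∀ n → sgn n ≡ - 1ℚ → suc n % 2 ≡ 0
odd⇒% zero e = ⊥-elim (-1≢1 e)
odd⇒% (suc zero) e = refl
odd⇒% (suc (suc n)) e = odd⇒% n (trans (solve 1 (λ s → s := :- (:- s)) refl (sgn n)) e)

%⇒odd : ∀ n → suc n % 2 ≡ 0 → sgn n ≡ - 1ℚ
%⇒odd zero ()
%⇒odd (suc zero) e = refl
%⇒odd (suc (suc n)) e = trans (solve 1 (λ s → :- (:- s) := s) refl (sgn n)) (%⇒odd n e)

OddVanish : Poly → Set
OddVanish φ = ∀ m k → 1 ℕ.≤ k → (k ℕ.+ m) % 2 ≡ 0 → coeff φ (replicate m 0 ++ (k ∷ [])) ≡ 0ℚ

oddVanish⇒even : ∀ φ → OddVanish φ → ∀ z → evP 0ℚ φ (neg z ∷ []) ≡ evP 0ℚ φ (z ∷ [])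
oddVanish⇒even φ odd z = x-y≡0⇒x≡y (begin
  evP 0ℚ φ (neg z ∷ []) - evP 0ℚ φ (z ∷ [])
    ≡⟨ sym (pair-- φ _ _) ⟩
  pair φ (λ w → ev 0ℚ w (neg z ∷ []) - ev 0ℚ w (z ∷ []))
    ≡⟨ pair-coeff-vanish φ _ vanish ⟩
  0ℚ ∎)
  where
  vanish : ∀ w → coeff φ w * (ev 0ℚ w (neg z ∷ []) - ev 0ℚ w (z ∷ [])) ≡ 0ℚ
  vanish w = trans (cong (λ v → coeff φ w * (v - ev 0ℚ w (z ∷ []))) (ev-neg 0ℚ w (z ∷ []))) (cases (depth1-block w z))
    where
    cases : ev 0ℚ w (z ∷ []) ≡ 0ℚ ⊎ (∃₂ λ m j → w ≡ replicate m 0 ++ suc j ∷ []) →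
      coeff φ w * (sgn (degree w) * ev 0ℚ w (z ∷ []) - ev 0ℚ w (z ∷ [])) ≡ 0ℚ
    cases (inj₁ e) = trans (cong (λ v → coeff φ w * (sgn (degree w) * v - v)) e)
      (solve 2 (λ c s → c :* (s :* con 0ℚ :- con 0ℚ) := con 0ℚ) refl (coeff φ w) (sgn (degree w)))
    cases (inj₂ (m , j , refl)) with sgn-±1 (degree w)
    ... | inj₁ s = trans (cong (λ s → coeff φ w * (s * ev 0ℚ w (z ∷ []) - ev 0ℚ w (z ∷ []))) s)
          (solve 2 (λ c v → c :* (con 1ℚ :* v :- v) := con 0ℚ) refl (coeff φ w) (ev 0ℚ w (z ∷ [])))
    ... | inj₂ s = trans (cong (_* v) (odd m (suc j) (ℕ.s≤s ℕ.z≤n)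
            (odd⇒% (j ℕ.+ m) (trans (cong sgn (sym (degree-block m j))) s)))) (*-zeroˡ v)
      where v = sgn (degree w) * ev 0ℚ w (z ∷ []) - ev 0ℚ w (z ∷ [])

-- The weight `f` is 2 on words of depth 1 and odd degree and 0 elsewhere. The weighted ψ has the
-- value Ψ(z) - Ψ(-z) in depth 1, hence vanishes at all points, and its coefficient at `w` is twice
-- that of ψ.
even⇒oddVanish : ∀ ψ → (∀ e z → evP (- e) ψ (neg z ∷ []) ≡ evP e ψ (z ∷ [])) → OddVanish ψ
even⇒oddVanish ψ even m (suc j) _ par = x+x≡0⇒x≡0 (begin
  coeff ψ w + coeff ψ w
    ≡⟨ solve 1 (λ c → c :+ c := con 1ℚ :* (con 1ℚ :- (:- con 1ℚ)) :* c) refl (coeff ψ w) ⟩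
  1ℚ * (1ℚ - - 1ℚ) * coeff ψ w
    ≡⟨ cong₂ (λ a s → a * (1ℚ - s) * coeff ψ w)
         (sym (ℕδ.δ-same (depth-block m j)))
         (sym (trans (cong sgn (degree-block m j)) (%⇒odd (j ℕ.+ m) par))) ⟩
  f w * coeff ψ w
    ≡⟨ cong (f w *_) (coeff-pair ψ w) ⟩
  f w * pair ψ (δ w)
    ≡⟨ sym (pair-*ˡ ψ (f w) (δ w)) ⟩
  pair ψ (λ u → f w * δ w u)
    ≡⟨ pair-cong ψ (λ u → sym (δ-transport w f u)) ⟩
  pair ψ (λ u → f u * δ w u)
    ≡⟨ sym (pair-reweight f (λ u → u) ψ (δ w)) ⟩
  pair (reweight f (λ u → u) ψ) (δ w)
    ≡⟨ sym (coeff-pair (reweight f (λ u → u) ψ) w) ⟩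
  coeff (reweight f (λ u → u) ψ) w
    ≡⟨ coeff-vanish (reweight f (λ u → u) ψ) (λ e L → trans (pair-reweight f (λ u → u) ψ (λ u → ev e u L)) (van e L)) w ⟩
  0ℚ ∎)
  where
  w : Word
  w = replicate m 0 ++ suc j ∷ []
  f : Word → ℚ
  f u = ℕδ.δ 1 (depth u) * (1ℚ - sgn (degree u))
  off-depth : ∀ e L → ¬ (length L ≡ 1) → ∀ u → f u * ev e u L ≡ 0ℚ
  off-depth e L ne u with depth u ℕ.≟ 1
  ... | yes d = trans (cong (1ℚ * (1ℚ - sgn (degree u)) *_) (ev-depth e u L (λ eq → ne (trans (sym eq) d))))
                  (*-zeroʳ (1ℚ * (1ℚ - sgn (degree u))))
  ... | no _ = solve 2 (λ s v → con 0ℚ :* s :* v := con 0ℚ) refl (1ℚ - sgn (degree u)) (ev e u L)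
  in-depth : ∀ e z u → f u * ev e u (z ∷ []) ≡ ev e u (z ∷ []) - ev (- e) u (neg z ∷ [])
  in-depth e z u with depth u ℕ.≟ 1
  ... | yes _ = trans
    (solve 2 (λ s v → con 1ℚ :* (con 1ℚ :- s) :* v := v :- s :* v) refl (sgn (degree u)) (ev e u (z ∷ [])))
    (cong (λ v → ev e u (z ∷ []) - v) (sym (ev-neg e u (z ∷ []))))
  ... | no ne = trans
    (solve 2 (λ s v → con 0ℚ :* s :* v := con 0ℚ) refl (1ℚ - sgn (degree u)) (ev e u (z ∷ [])))
    (sym (cong₂ _-_ (ev-depth e u (z ∷ []) ne) (ev-depth (- e) u (neg z ∷ []) ne)))
  van : ∀ e L → pair ψ (λ u → f u * ev e u L) ≡ 0ℚ
  van e [] = pair-0 ψ (off-depth e [] (λ ()))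
  van e (z ∷ []) = begin
    pair ψ (λ u → f u * ev e u (z ∷ []))                      ≡⟨ pair-cong ψ (in-depth e z) ⟩
    pair ψ (λ u → ev e u (z ∷ []) - ev (- e) u (neg z ∷ []))  ≡⟨ pair-- ψ _ _ ⟩
    evP e ψ (z ∷ []) - evP (- e) ψ (neg z ∷ [])               ≡⟨ cong (λ v → evP e ψ (z ∷ []) - v) (even e z) ⟩
    evP e ψ (z ∷ []) - evP e ψ (z ∷ [])                       ≡⟨ +-inverseʳ (evP e ψ (z ∷ [])) ⟩
    0ℚ                                                        ∎
  van e (z ∷ z' ∷ L) = pair-0 ψ (off-depth e (z ∷ z' ∷ L) (λ ()))

-- Adding multiples of b₀, and the two inclusions

addB₀ : ℚ → Poly → Poly
addB₀ a ψ = ψ ⊕ scale a b₀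

addB₀-pair : ∀ a ψ g → pair (addB₀ a ψ) g ≡ pair ψ g + a * g (0 ∷ [])
addB₀-pair a ψ g = trans (pair-++ ψ (scale a b₀) g)
  (cong (pair ψ g +_) (trans (scale-pair a b₀ g) (cong (a *_) (wordP-pair (0 ∷ []) g))))

addB₀-primitive : ∀ a ψ → Primitive ψ → Primitive (addB₀ a ψ)
addB₀-primitive a ψ prim h = begin
  pair (addB₀ a ψ) (λ w → dsum w h)
    ≡⟨ addB₀-pair a ψ (λ w → dsum w h) ⟩
  pair ψ (λ w → dsum w h) + a * (h (0 ∷ []) [] + h [] (0 ∷ []))
    ≡⟨ cong (_+ a * (h (0 ∷ []) [] + h [] (0 ∷ []))) (prim h) ⟩
  pair ψ (λ w → h w []) + pair ψ (λ w → h [] w) + a * (h (0 ∷ []) [] + h [] (0 ∷ []))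
    ≡⟨ solve 5 (λ p q a b c → p :+ q :+ a :* (b :+ c) := (p :+ a :* b) :+ (q :+ a :* c)) refl
         (pair ψ (λ w → h w [])) (pair ψ (λ w → h [] w)) a (h (0 ∷ []) []) (h [] (0 ∷ [])) ⟩
  (pair ψ (λ w → h w []) + a * h (0 ∷ []) []) + (pair ψ (λ w → h [] w) + a * h [] (0 ∷ []))
    ≡⟨ cong₂ _+_ (sym (addB₀-pair a ψ (λ w → h w []))) (sym (addB₀-pair a ψ (λ w → h [] w))) ⟩
  pair (addB₀ a ψ) (λ w → h w []) + pair (addB₀ a ψ) (λ w → h [] w) ∎

addB₀-ev-[] : ∀ a ψ e → evP e (addB₀ a ψ) [] ≡ evP e ψ [] + a * e
addB₀-ev-[] a ψ e = trans (addB₀-pair a ψ (λ w → ev e w [])) (cong (λ v → evP e ψ [] + a * v) (*-identityʳ e))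

addB₀-ev-∷ : ∀ a ψ e z L → evP e (addB₀ a ψ) (z ∷ L) ≡ evP e ψ (z ∷ L)
addB₀-ev-∷ a ψ e (x , y) L = trans (addB₀-pair a ψ (λ w → ev e w ((x , y) ∷ L)))
  (solve 3 (λ p a x → p :+ a :* (x :* con 0ℚ) := p) refl (evP e ψ ((x , y) ∷ L)) a x)

addB₀-ev-0 : ∀ a ψ L → evP 0ℚ (addB₀ a ψ) L ≡ evP 0ℚ ψ L
addB₀-ev-0 a ψ [] = trans (addB₀-ev-[] a ψ 0ℚ)
  (solve 2 (λ p a → p :+ a :* con 0ℚ := p) refl (evP 0ℚ ψ []) a)
addB₀-ev-0 a ψ (z ∷ L) = addB₀-ev-∷ a ψ 0ℚ z L

Φ-of : Poly → (Points → ℚ) → Points → ℚ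
Φ-of ψ = Insertion.Φ (λ e L → evP e ψ L) 0ℚ

σ⁰τ-ev : ∀ ψ x e L → evP e (σ⁰ ψ (τ x)) L ≡ Φ-of ψ (evP 0ℚ x ∘ sw) L
σ⁰τ-ev ψ x e L = trans (π₀-ev e (σ ψ (τ x)) L) (trans (σ-ev ψ 0ℚ (τ x) L)
  (Insertion.Φ-cong (λ e L → evP e ψ L) 0ℚ (τ-ev 0ℚ x) L))

τσ⁰-ev : ∀ ψ x e L → evP e (τ (σ⁰ ψ x)) L ≡ Φ-of ψ (evP 0ℚ x) (sw L)
τσ⁰-ev ψ x e L = trans (τ-ev e (σ⁰ ψ x) L) (trans (π₀-ev 0ℚ (σ ψ x) (sw L)) (σ-ev ψ 0ℚ x (sw L)))

module Stabiliser (ψ : Poly) (lie : IsLie ψ)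
  (stab : ∀ x → In⁰ x → σ⁰ ψ (τ x) ≈ τ (σ⁰ ψ x)) where

  open PrimitiveElement ψ (lie⇒primitive ψ lie)
  open Insertion (λ e L → evP e ψ L) 0ℚ

  private
    P : Points → ℚ
    P L = evP 0ℚ ψ L

    commute : ∀ x → In⁰ x → ∀ L → Φ (evP 0ℚ x ∘ sw) L ≡ Φ (evP 0ℚ x) (sw L)
    commute x x∈ L = trans (sym (σ⁰τ-ev ψ x 0ℚ L))
      (trans (pair-≈ (σ⁰ ψ (τ x)) (τ (σ⁰ ψ x)) (stab x x∈) (λ w → ev 0ℚ w L)) (τσ⁰-ev ψ x 0ℚ L))

    unit one : Points → ℚ
    unit [] = 1ℚ
    unit (_ ∷ _) = 0ℚ
    one (_ ∷ []) = 1ℚ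
    one _ = 0ℚ

    -- For a word fixed by τ the test function is invariant under `sw`, and the commutation becomes
    -- a symmetry of `Φ f` alone. The empty word and b₁ are such words.
    commute-with : ∀ w → In⁰ (wordP w) → ∀ {f} → (∀ L → ev 0ℚ w L ≡ f L) → (∀ L → f (sw L) ≡ f L) →
      ∀ L → Φ f L ≡ Φ f (sw L)
    commute-with w w∈ {f} fw fsw L = begin
      Φ f L                              ≡⟨ Φ-cong (λ M → sym (trans (evf (sw M)) (fsw M))) L ⟩
      Φ (evP 0ℚ (wordP w) ∘ sw) L        ≡⟨ commute (wordP w) w∈ L ⟩
      Φ (evP 0ℚ (wordP w)) (sw L)        ≡⟨ Φ-cong evf (sw L) ⟩
      Φ f (sw L)                         ∎
      where
      evf : ∀ M → evP 0ℚ (wordP w) M ≡ f M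
      evf M = trans (wordP-pair w (λ u → ev 0ℚ u M)) (fw M)

    unit-sw : ∀ L → unit (sw L) ≡ unit L
    unit-sw [] = refl
    unit-sw (z ∷ L) = trans (cong unit (sw-∷ z L)) (snoc (sw L))
      where
      snoc : ∀ M → unit (M ∷ʳ swap z) ≡ 0ℚ
      snoc [] = refl
      snoc (_ ∷ _) = refl

    one-sw : ∀ L → one (sw L) ≡ one L
    one-sw [] = refl
    one-sw (z ∷ []) = refl
    one-sw (z ∷ z' ∷ L) = trans (cong one (trans (sw-∷ z (z' ∷ L)) (cong (_∷ʳ swap z) (sw-∷ z' L)))) (snoc (sw L))
      where
      snoc : ∀ M → one ((M ∷ʳ swap z') ∷ʳ swap z) ≡ 0ℚ
      snoc [] = refl
      snoc (_ ∷ []) = refl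
      snoc (_ ∷ _ ∷ _) = refl

    -- This is σ_ψ(1) = ψ: the empty word has no letter at which to insert, so only left
    -- multiplication contributes.
    Φ-unit : ∀ L → Φ unit L ≡ P L
    Φ-unit L = begin
      R₀ 0ℚ unit L + R⁺ unit L - L⁺ unit L
        ≡⟨ cong₂ _-_ (cong₂ _+_
             (splitSum-last L (λ A z B → *-zeroʳ (evP (hd 0ℚ (z ∷ B)) ψ (shiftY 0ℚ A))))
             (R⁺-0 (λ _ _ → refl) L)) (L⁺-0 (λ _ _ → refl) L) ⟩
      P (shiftY 0ℚ L) * 1ℚ + 0ℚ - 0ℚ
        ≡⟨ solve 1 (λ p → p :* con 1ℚ :+ con 0ℚ :- con 0ℚ := p) refl (P (shiftY 0ℚ L)) ⟩
      P (shiftY 0ℚ L)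
        ≡⟨ cong P (shiftY-zero L) ⟩
      P L ∎

  reflection : ∀ L → P (sw L) ≡ P L
  reflection L = sym (begin
    P L              ≡⟨ sym (Φ-unit L) ⟩
    Φ unit L         ≡⟨ commute-with [] (λ _ → refl) (λ { [] → refl ; (_ ∷ _) → refl }) unit-sw L ⟩
    Φ unit (sw L)    ≡⟨ Φ-unit (sw L) ⟩
    P (sw L)         ∎)

  private
    ev-one : ∀ L → ev 0ℚ (1 ∷ []) L ≡ one L
    ev-one [] = refl
    ev-one (_ ∷ []) = refl
    ev-one (_ ∷ _ ∷ _) = refl

    -- In depth 2 the test function is nonzero only when ψ takes exactly one of the two points. This
    -- leaves ψ b₁ from left multiplication and the two halves of the commutator at b₁.
    Φ-one : ∀ x₁ y₁ x₂ y₂ → Φ one ((x₁ , y₁) ∷ (x₂ , y₂) ∷ []) ≡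
      evP x₂ ψ ((x₁ , y₁ - 0ℚ) ∷ []) + P ((x₂ , y₂ - y₁) ∷ []) - evP x₂ ψ ((x₁ , y₁ - y₂) ∷ [])
    Φ-one x₁ y₁ x₂ y₂ = solve 7 (λ a b c d g k m →
        (a :* con 0ℚ :+ (b :* con 1ℚ :+ c :* con 0ℚ)) :+ ((m :* con 0ℚ :+ d :* con 1ℚ) :+ (k :* con 0ℚ :+ con 0ℚ))
        :- ((a :* con 0ℚ :+ (g :* con 1ℚ :+ con 0ℚ)) :+ ((m :* con 0ℚ :+ con 0ℚ) :+ con 0ℚ))
        := b :+ d :- g) refl
      (evP x₁ ψ []) (evP x₂ ψ ((x₁ , y₁ - 0ℚ) ∷ [])) (P (shiftY 0ℚ ((x₁ , y₁) ∷ (x₂ , y₂) ∷ [])))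
      (P ((x₂ , y₂ - y₁) ∷ [])) (evP x₂ ψ ((x₁ , y₁ - y₂) ∷ [])) (P []) (evP x₂ ψ [])

    to-0 : ∀ e x y → evP e ψ ((x , y) ∷ []) ≡ P ((x - e , y) ∷ [])
    to-0 e x y = sym (trans
      (cong₂ (λ t x → evP t ψ ((x , y) ∷ [])) (sym (+-inverseˡ e)) (+-comm x (- e)))
      (translation (- e) e (x , y) []))

  -- Commutation on b₁, read at the points (x , y), (0 , 0).
  P₁-even : ∀ x y → P ((y , x) ∷ []) ≡ P ((- y , - x) ∷ [])
  P₁-even x y = begin
    A
      ≡⟨ solve 3 (λ a b c → a := (c :+ a :- b) :- c :+ b) refl A B E ⟩
    (E + A - B) - E + B
      ≡⟨ cong (λ t → t - E + B) (sym key) ⟩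
    E - E + B
      ≡⟨ solve 2 (λ c b → c :- c :+ b := b) refl E B ⟩
    B ∎
    where
    A B E : ℚ
    A = P ((y , x) ∷ [])
    B = P ((- y , - x) ∷ [])
    E = P ((- y , 0ℚ) ∷ [])
    x-0 : ∀ t → t - 0ℚ ≡ t
    x-0 t = +-identityʳ t
    zero-x : ∀ t → 0ℚ - t ≡ - t
    zero-x t = +-identityˡ (- t)
    key : E ≡ E + A - B
    key = begin
      E
        ≡⟨ reflection ((0ℚ , - y) ∷ []) ⟩
      P ((0ℚ , - y) ∷ [])
        ≡⟨ cong (λ t → P ((0ℚ , t) ∷ [])) (sym (zero-x y)) ⟩
      P ((0ℚ , 0ℚ - y) ∷ [])
        -- With the second point at the origin the y-shift of b₁ is 0, so left multiplication and
        -- left insertion have the same value at (x , y) and cancel.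
        ≡⟨ solve 2 (λ a b → b := a :+ b :- a) refl (P ((x , y - 0ℚ) ∷ [])) (P ((0ℚ , 0ℚ - y) ∷ [])) ⟩
      P ((x , y - 0ℚ) ∷ []) + P ((0ℚ , 0ℚ - y) ∷ []) - P ((x , y - 0ℚ) ∷ [])
        ≡⟨ sym (Φ-one x y 0ℚ 0ℚ) ⟩
      Φ one ((x , y) ∷ (0ℚ , 0ℚ) ∷ [])
        ≡⟨ commute-with (1 ∷ []) (λ _ → refl) ev-one one-sw ((x , y) ∷ (0ℚ , 0ℚ) ∷ []) ⟩
      Φ one ((0ℚ , 0ℚ) ∷ (y , x) ∷ [])
        ≡⟨ Φ-one 0ℚ 0ℚ y x ⟩
      evP y ψ ((0ℚ , 0ℚ - 0ℚ) ∷ []) + P ((y , x - 0ℚ) ∷ []) - evP y ψ ((0ℚ , 0ℚ - x) ∷ [])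
        ≡⟨ cong₂ _-_ (cong₂ _+_
             (trans (to-0 y 0ℚ (0ℚ - 0ℚ)) (cong (λ t → P ((t , 0ℚ) ∷ [])) (zero-x y)))
             (cong (λ t → P ((y , t) ∷ [])) (x-0 x)))
             (trans (to-0 y 0ℚ (0ℚ - x)) (cong₂ (λ s t → P ((s , t) ∷ [])) (zero-x y) (zero-x x))) ⟩
      E + A - B ∎

  depth1-even : ∀ e z → evP (- e) ψ (neg z ∷ []) ≡ evP e ψ (z ∷ [])
  depth1-even e (x , y) = begin
    evP (- e) ψ ((- x , - y) ∷ [])      ≡⟨ to-0 (- e) (- x) (- y) ⟩
    P ((- x - - e , - y) ∷ [])
      ≡⟨ cong (λ t → P ((t , - y) ∷ [])) (solve 2 (λ x e → (:- x) :- (:- e) := :- (x :- e)) refl x e) ⟩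
    P ((- (x - e) , - y) ∷ [])          ≡⟨ sym (P₁-even y (x - e)) ⟩
    P ((x - e , y) ∷ [])                ≡⟨ sym (to-0 e x y) ⟩
    evP e ψ ((x , y) ∷ [])              ∎

stab⇒lq : ∀ ψ → InStab ψ → InLqPlusQb₀ ψ
stab⇒lq ψ (lie , stab) = φ , c , (no-b₀ , primitive⇒lie φ (addB₀-primitive (- c) ψ (lie⇒primitive ψ lie)) , τ-inv , odd) , split
  where
  open Stabiliser ψ lie stab
  c : ℚ
  c = coeff ψ (0 ∷ [])
  φ : Poly
  -- Subtracting c b₀ affects none of the other conditions: b₀ is primitive, and its value is 0 at e
  -- = 0 and in positive depth.
  φ = addB₀ (- c) ψ
  no-b₀ : coeff φ (0 ∷ []) ≡ 0ℚ
  no-b₀ = begin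
    coeff φ (0 ∷ [])                                         ≡⟨ coeff-pair φ (0 ∷ []) ⟩
    pair φ (δ (0 ∷ []))                                      ≡⟨ addB₀-pair (- c) ψ (δ (0 ∷ [])) ⟩
    pair ψ (δ (0 ∷ [])) + - c * δ (0 ∷ []) (0 ∷ [])
      ≡⟨ cong₂ (λ a d → a + - c * d) (sym (coeff-pair ψ (0 ∷ []))) (δ-same {0 ∷ []} refl) ⟩
    c + - c * 1ℚ                                             ≡⟨ solve 1 (λ c → c :+ (:- c) :* con 1ℚ := con 0ℚ) refl c ⟩
    0ℚ                                                       ∎
  τ-inv : τ (π₀ φ) ≈ π₀ φ
  τ-inv = evP-injective (τ (π₀ φ)) (π₀ φ) (λ e L → begin
    evP e (τ (π₀ φ)) L    ≡⟨ trans (τ-ev e (π₀ φ) L) (π₀-ev 0ℚ φ (sw L)) ⟩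
    evP 0ℚ φ (sw L)       ≡⟨ addB₀-ev-0 (- c) ψ (sw L) ⟩
    evP 0ℚ ψ (sw L)       ≡⟨ reflection L ⟩
    evP 0ℚ ψ L            ≡⟨ sym (addB₀-ev-0 (- c) ψ L) ⟩
    evP 0ℚ φ L            ≡⟨ sym (π₀-ev e φ L) ⟩
    evP e (π₀ φ) L        ∎)
  odd : OddVanish φ
  odd = even⇒oddVanish φ (λ e z → trans (addB₀-ev-∷ (- c) ψ (- e) (neg z) [])
    (trans (depth1-even e z) (sym (addB₀-ev-∷ (- c) ψ e z []))))
  split : ψ ≈ addB₀ c φ
  split w = begin
    coeff ψ w
      ≡⟨ coeff-pair ψ w ⟩
    pair ψ (δ w)
      ≡⟨ solve 3 (λ p c d → p := p :+ (:- c) :* d :+ c :* d) refl (pair ψ (δ w)) c (δ w (0 ∷ [])) ⟩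
    pair ψ (δ w) + - c * δ w (0 ∷ []) + c * δ w (0 ∷ [])
      ≡⟨ cong (_+ c * δ w (0 ∷ [])) (sym (addB₀-pair (- c) ψ (δ w))) ⟩
    pair φ (δ w) + c * δ w (0 ∷ [])
      ≡⟨ sym (addB₀-pair c φ (δ w)) ⟩
    pair (addB₀ c φ) (δ w)
      ≡⟨ sym (coeff-pair (addB₀ c φ) w) ⟩
    coeff (addB₀ c φ) w ∎

lq⇒stab : ∀ ψ → InLqPlusQb₀ ψ → InStab ψ
lq⇒stab ψ (φ , c , (no-b₀ , lie , τ-inv , odd) , ψ≈) = primitive⇒lie ψ primψ , commute
  where
  primφ : Primitive φ
  primφ = lie⇒primitive φ lie
  to-φ : ∀ g → pair ψ g ≡ pair (addB₀ c φ) g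
  to-φ = pair-≈ ψ (addB₀ c φ) ψ≈
  primψ : Primitive ψ
  primψ h = trans (to-φ (λ w → dsum w h)) (trans (addB₀-primitive c φ primφ h)
    (cong₂ _+_ (sym (to-φ (λ w → h w []))) (sym (to-φ (λ w → h [] w)))))
  reflection : ∀ L → evP 0ℚ φ (sw L) ≡ evP 0ℚ φ L
  reflection L = begin
    evP 0ℚ φ (sw L)        ≡⟨ sym (trans (τ-ev 0ℚ (π₀ φ) L) (π₀-ev 0ℚ φ (sw L))) ⟩
    evP 0ℚ (τ (π₀ φ)) L    ≡⟨ pair-≈ (τ (π₀ φ)) (π₀ φ) τ-inv (λ w → ev 0ℚ w L) ⟩
    evP 0ℚ (π₀ φ) L        ≡⟨ π₀-ev 0ℚ φ L ⟩
    evP 0ℚ φ L             ∎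
  open PrimitiveElement φ primφ using (translation)
  open Cyclicity φ primφ reflection (oddVanish⇒even φ odd) using (P-cyclic)
  -- The vanishing coefficient of b₀ enters here. A multiple of b₀ in φ would give a value
  -- proportional to e, and `translate` would fail at the empty list.
  depth0 : ∀ e → evP e φ [] ≡ 0ℚ
  depth0 e = trans (depth0-linear φ primφ e) (trans (cong (e *_) no-b₀) (*-zeroʳ e))
  shift : ∀ e A → shiftX (- e) A ≡ map (_⊖ (e , 0ℚ)) A
  shift e [] = refl
  shift e ((x , y) ∷ A) = cong₂ _∷_ (cong₂ _,_ (+-comm (- e) x) (sym (+-identityʳ y))) (shift e A)
  translate : ∀ e A → evP e φ A ≡ evP 0ℚ φ (map (_⊖ (e , 0ℚ)) A)
  translate e [] = trans (depth0 e) (sym (depth0 0ℚ))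
  translate e (z ∷ A) = trans (sym (translation (- e) e z A))
    (cong₂ (λ t M → evP t φ M) (+-inverseˡ e) (shift e (z ∷ A)))
  open Reflection (λ e L → evP e φ L) (λ L → evP 0ℚ φ L) translate reflection P-cyclic using (Φ-sw)
  open AddB₀ (λ e L → evP e ψ L) (λ e L → evP e φ L) c
    (λ e → trans (to-φ (λ w → ev e w [])) (addB₀-ev-[] c φ e))
    (λ e z A → trans (to-φ (λ w → ev e w (z ∷ A))) (addB₀-ev-∷ c φ e z A)) using (Φ-add)
  commute : ∀ x → In⁰ x → σ⁰ ψ (τ x) ≈ τ (σ⁰ ψ x)
  commute x _ = evP-injective (σ⁰ ψ (τ x)) (τ (σ⁰ ψ x)) (λ e L → begin
    evP e (σ⁰ ψ (τ x)) L               ≡⟨ σ⁰τ-ev ψ x e L ⟩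
    Φ-of ψ (evP 0ℚ x ∘ sw) L           ≡⟨ Φ-add (evP 0ℚ x ∘ sw) L ⟩
    Φ-of φ (evP 0ℚ x ∘ sw) L           ≡⟨ Φ-sw (evP 0ℚ x) L ⟩
    Φ-of φ (evP 0ℚ x) (sw L)           ≡⟨ sym (Φ-add (evP 0ℚ x) (sw L)) ⟩
    Φ-of ψ (evP 0ℚ x) (sw L)           ≡⟨ sym (τσ⁰-ev ψ x e L) ⟩
    evP e (τ (σ⁰ ψ x)) L               ∎)

-- Comparing the coefficients of b₀ gives c, which 𝔩𝔮 requires to be 0; this makes the sum direct.
lq∩ℚb₀ : ∀ φ (c : ℚ) → InLq φ → φ ≈ scale c b₀ → c ≡ 0ℚ
lq∩ℚb₀ φ c (no-b₀ , _) φ≈ = begin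
  c                               ≡⟨ solve 1 (λ c → c := c :* con 1ℚ :+ con 0ℚ) refl c ⟩
  coeff (scale c b₀) (0 ∷ [])     ≡⟨ sym (φ≈ (0 ∷ [])) ⟩
  coeff φ (0 ∷ [])                ≡⟨ no-b₀ ⟩
  0ℚ                              ∎

theorem2p16 : (∀ ψ → InStab ψ ⇔ InLqPlusQb₀ ψ)
    × (∀ φ (c : ℚ) → InLq φ → φ ≈ scale c b₀ → c ≡ 0ℚ)
theorem2p16 = (λ ψ → mk⇔ (stab⇒lq ψ) (lq⇒stab ψ)) , lq∩ℚb₀
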